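{- Let $\Delta\ge 3$, $c\in[0,\Delta-2]$, $\kappa=\Delta+c$. In the incremental rooted-forest model (only insertions), the rooted version of {\textsc{DistMaint}} has expected amortized recourse $\Theta(1/\Delta)$: for every insertion sequence its expected amortized recourse is $O(1/\Delta)$, and there are insertion sequences for which it is $\Omega(1/\Delta)$.
   Context: A dynamic rooted forest on a fixed vertex set starts with no edges, every vertex being a root of its own tree; an insertion $(p,r)$ requires $r$ to be the root of its tree and $p$ in another tree, and makes $r$ a child of $p$. The maximum degree stays at most $\Delta$. The palette is $[\kappa]$; $A(x)$ denotes the colors not used on edges incident to vertex $x$. The recourse of an update is the number of previously colored edges whose color changes; expected amortized recourse is the expectation of total recourse divided by the number of updates. The update sequence is fixed in advance (oblivious adversary). Rooted {\textsc{DistMaint}}: on insertion of $(p,r)$, choose its color $\beta$ uniformly at random from $A(p)$, insert it, and call RootToChild$(r,\beta)$: if no child edge of $r$ has color $\beta$, stop; otherwise let $(r,w)$ be that child edge, choose $\alpha$ uniformly at random from $A(r)$, recolor $(r,w)$ to $\alpha$ and call FixForbidden$(w,\beta,\alpha)$. FixForbidden$(v,\alpha,\beta)$: if no child edge of $v$ has color $\beta$, stop; otherwise recolor that child edge $(v,w)$ to $\alpha$ and call FixForbidden$(w,\beta,\alpha)$. All random choices are independent. -}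

module Defs where

open import Data.Nat as ℕ using (ℕ; zero; suc; _+_; _≤_)
open import Data.Integer using (+_)
open import Data.Fin using (Fin; _≟_)
open import Data.List using (List; []; _∷_; _++_; map; concatMap; filterᵇ; length; allFin; head; foldr)
open import Data.Bool.ListAction using (any)
open import Data.Maybe using (Maybe; just; nothing)
open import Data.Product using (_×_; _,_; proj₁)
open import Data.Bool using (Bool; true; false; if_then_else_; not; _∧_)
open import Relation.Nullary.Decidable using (⌊_⌋)
open import Relation.Binary.PropositionalEquality using (_≡_; _≢_)
open import Data.Rational as ℚ using (ℚ; 0ℚ; 1ℚ)

-- Colored rooted forests on vertex set Fin n with palette Fin κ.
-- Each non-root vertex v stores (parent of v , color of edge (parent,v)).

Forest : ℕ → ℕ → Set
Forest n κ = Fin n → Maybe (Fin n × Fin κ)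

emptyForest : ∀ {n κ} → Forest n κ
emptyForest _ = nothing

setEdge : ∀ {n κ} → Forest n κ → Fin n → Fin n → Fin κ → Forest n κ
setEdge F w p a v = if ⌊ v ≟ w ⌋ then just (p , a) else F v

incidentColors : ∀ {n κ} → Forest n κ → Fin n → List (Fin κ)
incidentColors {n} F x = own (F x) ++ concatMap child (allFin n)
  where
  own : Maybe (_ × _) → List _
  own nothing = []
  own (just (_ , c)) = c ∷ []
  child : Fin _ → List _
  child w with F w
  ... | nothing = []
  ... | just (p , c) = if ⌊ p ≟ x ⌋ then c ∷ [] else []

avail : ∀ {n κ} → Forest n κ → Fin n → List (Fin κ)
avail {κ = κ} F x =
  filterᵇ (λ a → not (any (λ b → ⌊ a ≟ b ⌋) (incidentColors F x))) (allFin κ)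

childWithColor : ∀ {n κ} → Forest n κ → Fin n → Fin κ → Maybe (Fin n)
childWithColor {n} F x β = head (filterᵇ test (allFin n))
  where
  test : Fin n → Bool
  test w with F w
  ... | nothing = false
  ... | just (p , c) = ⌊ p ≟ x ⌋ ∧ ⌊ c ≟ β ⌋

Dist : Set → Set
Dist A = List (ℚ × A)

return : ∀ {A : Set} → A → Dist A
return x = (1ℚ , x) ∷ []

_>>=_ : ∀ {A B : Set} → Dist A → (A → Dist B) → Dist B
d >>= f = concatMap (λ { (p , x) → map (λ { (q , y) → (p ℚ.* q , y) }) (f x) }) d

-- uniform distribution on a list (empty distribution on the empty list;
-- this case never arises for valid update sequences)
uniform : ∀ {A : Set} → List A → Dist A
uniform [] = []
uniform (x ∷ xs) = map (λ y → ((+ 1) ℚ./ suc (length xs) , y)) (x ∷ xs)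

expectation : Dist ℕ → ℚ
expectation d = foldr (λ { (p , t) acc → p ℚ.* ((+ t) ℚ./ 1) ℚ.+ acc }) 0ℚ d

-- Rooted DistMaint.  Recourse = number of recolorings of existing edges.

-- FixForbidden(v, α, β), with fuel (n steps suffice: it walks down a path)
fixForbidden : ∀ {n κ} → ℕ → Forest n κ → Fin n → Fin κ → Fin κ → Forest n κ × ℕ
fixForbidden zero F v α β = F , 0
fixForbidden (suc k) F v α β with childWithColor F v β
... | nothing = F , 0
... | just w with fixForbidden k (setEdge F w v α) w β α
...   | F' , r = F' , suc r

rootToChild : ∀ {n κ} → Forest n κ → Fin n → Fin κ → Dist (Forest n κ × ℕ)
rootToChild {n} F r β with childWithColor F r β
... | nothing = return (F , 0)
... | just w = uniform (avail F r) >>= λ α →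
      step (fixForbidden n (setEdge F w r α) w β α)
  where
  step : Forest _ _ × ℕ → Dist (Forest _ _ × ℕ)
  step (F' , k) = return (F' , suc k)

insertEdge : ∀ {n κ} → Forest n κ → Fin n × Fin n → Dist (Forest n κ × ℕ)
insertEdge F (p , r) = uniform (avail F p) >>= λ β → rootToChild (setEdge F r p β) r β

runSeq : ∀ {n κ} → Forest n κ → List (Fin n × Fin n) → Dist ℕ
runSeq F [] = return 0
runSeq F (u ∷ us) = insertEdge F u >>= λ { (F' , k) → runSeq F' us >>= λ t → return (k + t) }

expectedTotalRecourse : ∀ {n} (κ : ℕ) → List (Fin n × Fin n) → ℚ
expectedTotalRecourse {n} κ us = expectation (runSeq {n} {κ} emptyForest us)

Parents : ℕ → Set
Parents n = Fin n → Maybe (Fin n)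

noParents : ∀ {n} → Parents n
noParents _ = nothing

link : ∀ {n} → Parents n → Fin n → Fin n → Parents n
link P r p v = if ⌊ v ≟ r ⌋ then just p else P v

-- root of the tree of v (fuel n suffices in a forest on n vertices)
rootWith : ∀ {n} → ℕ → Parents n → Fin n → Fin n
rootWith zero P v = v
rootWith (suc k) P v with P v
... | nothing = v
... | just p = rootWith k P p

rootOf : ∀ {n} → Parents n → Fin n → Fin n
rootOf {n} P v = rootWith n P v

degree : ∀ {n} → Parents n → Fin n → ℕ
degree {n} P x = own (P x) + length (filterᵇ isChild (allFin n))
  where
  own : Maybe (Fin n) → ℕ
  own nothing = 0
  own (just _) = 1
  isChild : Fin n → Bool
  isChild w with P w
  ... | nothing = false
  ... | just p = ⌊ p ≟ x ⌋

data ValidSeq {n : ℕ} (Δ : ℕ) : Parents n → List (Fin n × Fin n) → Set where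
  done : ∀ {P} → ValidSeq Δ P []
  step : ∀ {P p r us} →
         P r ≡ nothing →
         rootOf P p ≢ r →
         (∀ x → degree (link P r p) x ≤ Δ) →
         ValidSeq Δ (link P r p) us →
         ValidSeq Δ P ((p , r) ∷ us)

{-# OPTIONS --safe #-}

-- Upper bound.  Inserting edges keeps the colouring uniform among all proper
-- colourings of the current forest.  When (p , r) is inserted and its colour β
-- collides with a child edge of r, the recolouring with a fixed new colour α is
-- inverted by the same procedure with α and β exchanged; summing over α, the
-- expected recourse is 1/κ times the mean, over uniform proper colourings of the
-- new forest, of the total length of the chains that start at r, one for each
-- colour.  Transposing two colours strictly below a vertex shows that a chain
-- continues into a given child with probability 1/(κ − 1) ≤ 1/2, so this mean is
-- at most the sum of 2^(1 − d) over the descendants of r at distance d.  Every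
-- vertex r is charged only once, with the descendants it has at that moment, so
-- all charges together are at most Σ_d 2^(1 − d) ≤ 2 per edge, and the expected
-- total recourse is at most 2/κ per insertion.
--
-- Lower bound.  Build a path from the bottom up.  The new parent is isolated, so
-- its edge gets a uniform colour, which hits the single child edge of the old
-- root with probability 1/κ ≥ 1/(2Δ).

module Submission where

open import Defs
open import Data.Nat using (ℕ; _+_; _≤_)
open import Data.Fin using (Fin)
open import Data.List using (List; length)
open import Data.Product using (Σ; ∃; _×_)
open import Data.Integer using (+_)
open import Data.Rational using (ℚ; 0ℚ; _<_; _*_; _/_)
open import Data.Rational using () renaming (_≤_ to _≤ℚ_)

open import Data.Bool using (Bool; true; false; T; not; if_then_else_; _∨_)
open import Data.Bool.ListAction using (any)
open import Data.Empty using (⊥; ⊥-elim)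
open import Data.Fin using (zero; suc; toℕ; fromℕ<; _≟_)
import Data.Fin.Properties as Finₚ
import Data.Integer as ℤ
import Data.Integer.Properties as ℤₚ
open import Data.List using ([]; _∷_; _++_; map; concatMap; filter; filterᵇ; head; allFin)
open import Data.List.Membership.Propositional using (_∈_)
open import Data.List.Membership.Propositional.Properties using (∈-allFin; ∈-++⁻; ∈-concatMap⁺; ∈-concatMap⁻; ∈-filter⁺; ∈-filter⁻)
open import Data.List.Properties using (map-tabulate; length-tabulate; filter-≐; filter-all)
import Data.List.Relation.Unary.All as All
open import Data.List.Relation.Unary.AllPairs using (_∷_)
import Data.List.Relation.Unary.Any as Any
open import Data.List.Relation.Unary.Any using (here; there)
open import Data.List.Relation.Unary.Any.Properties using (any⁺; any⁻)
open import Data.List.Relation.Unary.Unique.Propositional using (Unique)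
import Data.List.Relation.Unary.Unique.Propositional.Properties as Uniqueₚ
open import Data.Maybe using (Maybe; just; nothing; maybe′)
import Data.Maybe as Maybe
import Data.Maybe.Properties as Maybeₚ
import Data.Nat as ℕ
open import Data.Nat using (zero; suc; _∸_; z≤n; s≤s)
import Data.Nat.Properties as ℕₚ
open import Data.Product using (_,_; proj₁; proj₂)
import Data.Product.Properties as Productₚ
import Data.Rational as ℚ
open import Data.Rational using (1ℚ; ½; toℚᵘ; nonNegative)
open import Data.Rational using () renaming (_+_ to _+ℚ_)
import Data.Rational.Properties as ℚₚ
open import Data.Rational.Solver using (module +-*-Solver)
import Data.Rational.Unnormalised as ℚᵘ
import Data.Rational.Unnormalised.Properties as ℚᵘₚ
open import Data.Sum using (_⊎_; inj₁; inj₂)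
open import Data.Vec using (Vec; []; _∷_; lookup; replicate; tabulate; _[_]≔_)
open import Data.Vec.Properties using (≡-dec; ∷-injective; lookup∘update; lookup∘update′; []≔-idempotent; []≔-commutes; []≔-lookup; lookup∘tabulate; tabulate∘lookup; tabulate-cong)
open import Function using (_∘_)
open import Relation.Binary.Definitions using (DecidableEquality)
open import Relation.Binary.PropositionalEquality using (_≡_; _≢_; _≗_; refl; sym; trans; cong; cong₂; subst; subst₂; module ≡-Reasoning)
open import Relation.Nullary using (¬_; Dec; yes; no; does)
open import Relation.Nullary.Decidable using (¬?; _×-dec_; _⊎-dec_; _→-dec_; dec-true; dec-false; toWitness; fromWitness; ⌊_⌋)

open +-*-Solver using (solve; _:=_; _:+_; _:*_; con)

-- Rational arithmetic and finite sums

-- The uniform distribution is kept unnormalised: all vectors of n colours are summed with weight 1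
-- if proper and 0 otherwise, a root carrying a free dummy colour. Uniformity survives because of
-- one count. Let d be the number of children of r. In a collision the colour of r is that of a
-- child, so κ - d colours are free at r. Up to a common factor, a proper colouring of the new
-- forest is reached with weight 1 without recolouring, and with weight 1/(κ - d) for each of the d
-- colours at the children of r: in total κ/(κ - d), the same for all. Dividing the weight 1/(κ - d)
-- of a chain by this total leaves the 1/κ of the bound. The number of proper colourings is never
-- computed. The identity for one insertion holds for an arbitrary payoff g: the payoff 1 gives the
-- normalising factor, and the payoff recourse plus future cost gives the bound. The upper bound
-- keeps only inequalities, because a uniform choice from an empty list has mass 0. The lower bound
-- cannot afford lost mass and exhibits free colours, which is easy on a path.

ι : ℕ → ℚ
ι n = (+ n) / 1

private
  toℚᵘ-/ : ∀ k d → toℚᵘ ((+ k) / suc d) ℚᵘ.≃ ℚᵘ.mkℚᵘ (+ k) d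
  toℚᵘ-/ k d = ℚₚ.toℚᵘ-fromℚᵘ (ℚᵘ.mkℚᵘ (+ k) d)

ι-+ : ∀ m n → ι (m + n) ≡ ι m +ℚ ι n
ι-+ m n = ℚₚ.toℚᵘ-injective (begin
  toℚᵘ (ι (m + n))                      ≈⟨ toℚᵘ-/ (m + n) 0 ⟩
  ℚᵘ.mkℚᵘ (+ (m + n)) 0                 ≈⟨ ℚᵘ.*≡* (cong (ℤ._* + 1) eq) ⟩
  ℚᵘ.mkℚᵘ (+ m) 0 ℚᵘ.+ ℚᵘ.mkℚᵘ (+ n) 0  ≈⟨ ℚᵘₚ.+-cong (toℚᵘ-/ m 0) (toℚᵘ-/ n 0) ⟨
  toℚᵘ (ι m) ℚᵘ.+ toℚᵘ (ι n)            ≈⟨ ℚₚ.toℚᵘ-homo-+ (ι m) (ι n) ⟨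
  toℚᵘ (ι m +ℚ ι n)                     ∎)
  where
  open ℚᵘₚ.≃-Reasoning
  eq : + (m + n) ≡ + m ℤ.* + 1 ℤ.+ + n ℤ.* + 1
  eq = sym (cong₂ ℤ._+_ (ℤₚ.*-identityʳ (+ m)) (ℤₚ.*-identityʳ (+ n)))

ι-nonneg : ∀ n → 0ℚ ≤ℚ ι n
ι-nonneg n = ℚₚ.nonNegative⁻¹ (ι n) {{ℚₚ.normalize-nonNeg n 1}}

ι-mono : ∀ {m n} → m ≤ n → ι m ≤ℚ ι n
ι-mono {m} {n} m≤n = subst (λ k → ι m ≤ℚ ι k) (ℕₚ.m+[n∸m]≡n m≤n)
  (subst (ι m ≤ℚ_) (sym (ι-+ m (n ∸ m)))
    (subst (_≤ℚ ι m +ℚ ι (n ∸ m)) (ℚₚ.+-identityʳ (ι m)) (ℚₚ.+-monoʳ-≤ (ι m) (ι-nonneg (n ∸ m)))))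

ι-injective : ∀ {m n} → ι m ≡ ι n → m ≡ n
ι-injective {m} {n} eq = ℤₚ.+-injective (begin
  + m          ≡⟨ ℤₚ.*-identityʳ (+ m) ⟨
  + m ℤ.* + 1  ≡⟨ ℚᵘₚ.drop-*≡* m≃n ⟩
  + n ℤ.* + 1  ≡⟨ ℤₚ.*-identityʳ (+ n) ⟩
  + n          ∎)
  where
  open ≡-Reasoning
  m≃n : ℚᵘ.mkℚᵘ (+ m) 0 ℚᵘ.≃ ℚᵘ.mkℚᵘ (+ n) 0
  m≃n = ℚᵘₚ.≃-trans (ℚᵘₚ.≃-sym (toℚᵘ-/ m 0))
          (ℚᵘₚ.≃-trans (ℚₚ.toℚᵘ-cong eq) (toℚᵘ-/ n 0))

inv : ℕ → ℚ
inv zero    = 0ℚ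
inv (suc n) = (+ 1) / suc n

inv-nonneg : ∀ n → 0ℚ ≤ℚ inv n
inv-nonneg zero    = ℚₚ.≤-refl
inv-nonneg (suc n) = ℚₚ.nonNegative⁻¹ (inv (suc n)) {{ℚₚ.normalize-nonNeg 1 (suc n)}}

inv-*-ι : ∀ n → inv (suc n) * ι (suc n) ≡ 1ℚ
inv-*-ι n = ℚₚ.toℚᵘ-injective (begin
  toℚᵘ (inv (suc n) * ι (suc n))            ≈⟨ ℚₚ.toℚᵘ-homo-* (inv (suc n)) (ι (suc n)) ⟩
  toℚᵘ (inv (suc n)) ℚᵘ.* toℚᵘ (ι (suc n))  ≈⟨ ℚᵘₚ.*-cong (toℚᵘ-/ 1 n) (toℚᵘ-/ (suc n) 0) ⟩
  ℚᵘ.mkℚᵘ (+ 1) n ℚᵘ.* ℚᵘ.mkℚᵘ (+ suc n) 0  ≈⟨ ℚᵘ.*≡* eq ⟩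
  ℚᵘ.1ℚᵘ                                    ∎)
  where
  open ℚᵘₚ.≃-Reasoning
  eq : (+ 1 ℤ.* + suc n) ℤ.* + 1 ≡ + 1 ℤ.* + (suc n ℕ.* 1)
  eq = trans (ℤₚ.*-identityʳ _) (cong (λ k → + 1 ℤ.* + k) (sym (ℕₚ.*-identityʳ (suc n))))

inv-*-ι-≤1 : ∀ n → inv n * ι n ≤ℚ 1ℚ
inv-*-ι-≤1 zero    = ℚₚ.nonNegative⁻¹ 1ℚ
inv-*-ι-≤1 (suc n) = ℚₚ.≤-reflexive (inv-*-ι n)

*-monoˡ-≤ : ∀ {a x y} → 0ℚ ≤ℚ a → x ≤ℚ y → a * x ≤ℚ a * y
*-monoˡ-≤ {a} 0≤a = ℚₚ.*-monoˡ-≤-nonNeg a {{nonNegative 0≤a}}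

*-monoʳ-≤ : ∀ {a x y} → 0ℚ ≤ℚ a → x ≤ℚ y → x * a ≤ℚ y * a
*-monoʳ-≤ {a} 0≤a = ℚₚ.*-monoʳ-≤-nonNeg a {{nonNegative 0≤a}}

*-nonneg : ∀ {a b} → 0ℚ ≤ℚ a → 0ℚ ≤ℚ b → 0ℚ ≤ℚ a * b
*-nonneg {a} {b} 0≤a 0≤b = subst (_≤ℚ a * b) (ℚₚ.*-zeroʳ a) (*-monoˡ-≤ 0≤a 0≤b)

+-nonneg : ∀ {a b} → 0ℚ ≤ℚ a → 0ℚ ≤ℚ b → 0ℚ ≤ℚ a +ℚ b
+-nonneg = ℚₚ.+-mono-≤

module _ {A : Set} where

  -- The Iverson bracket: restricting a sum to a decidable set becomes multiplication by a weight,
  -- while the list summed over stays the same.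
  ⟪_⟫ : Dec A → ℚ
  ⟪ d ⟫ = if does d then 1ℚ else 0ℚ

  ⟪⟫-nonneg : (d : Dec A) → 0ℚ ≤ℚ ⟪ d ⟫
  ⟪⟫-nonneg (yes _) = ℚₚ.nonNegative⁻¹ 1ℚ
  ⟪⟫-nonneg (no _)  = ℚₚ.≤-refl

  ⟪⟫-yes : (d : Dec A) → A → ⟪ d ⟫ ≡ 1ℚ
  ⟪⟫-yes d a = cong (if_then 1ℚ else 0ℚ) (dec-true d a)

  ⟪⟫-no : (d : Dec A) → ¬ A → ⟪ d ⟫ ≡ 0ℚ
  ⟪⟫-no d a = cong (if_then 1ℚ else 0ℚ) (dec-false d a)

  ⟪⟫-*-cong : (d : Dec A) {x y : ℚ} → (A → x ≡ y) → ⟪ d ⟫ * x ≡ ⟪ d ⟫ * y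
  ⟪⟫-*-cong (yes a) eq = cong (1ℚ *_) (eq a)
  ⟪⟫-*-cong (no _) {x} {y} eq = trans (ℚₚ.*-zeroˡ x) (sym (ℚₚ.*-zeroˡ y))

  ⟪⟫-*-mono : (d : Dec A) {x y : ℚ} → (A → x ≤ℚ y) → ⟪ d ⟫ * x ≤ℚ ⟪ d ⟫ * y
  ⟪⟫-*-mono (yes a) le = *-monoˡ-≤ (ℚₚ.nonNegative⁻¹ 1ℚ) (le a)
  ⟪⟫-*-mono (no _) {x} {y} le = ℚₚ.≤-reflexive (trans (ℚₚ.*-zeroˡ x) (sym (ℚₚ.*-zeroˡ y)))

⟪⟫-*-≤ : {A : Set} (d : Dec A) {x : ℚ} → 0ℚ ≤ℚ x → ⟪ d ⟫ * x ≤ℚ x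
⟪⟫-*-≤ (yes _) {x} 0≤x = ℚₚ.≤-reflexive (ℚₚ.*-identityˡ x)
⟪⟫-*-≤ (no _)  {x} 0≤x = subst (_≤ℚ x) (sym (ℚₚ.*-zeroˡ x)) 0≤x

⟪⟫-⇔ : {A B : Set} (d : Dec A) (e : Dec B) → (A → B) → (B → A) → ⟪ d ⟫ ≡ ⟪ e ⟫
⟪⟫-⇔ (yes a) e f g = sym (⟪⟫-yes e (f a))
⟪⟫-⇔ (no ¬a) e f g = sym (⟪⟫-no e (¬a ∘ g))

⟪⟫-mono : {A B : Set} (d : Dec A) (e : Dec B) → (A → B) → ⟪ d ⟫ ≤ℚ ⟪ e ⟫
⟪⟫-mono (yes a) e f = ℚₚ.≤-reflexive (sym (⟪⟫-yes e (f a)))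
⟪⟫-mono (no ¬a) e f = ⟪⟫-nonneg e

⟪⟫-¬ : {A : Set} (d : Dec A) → ⟪ ¬? d ⟫ +ℚ ⟪ d ⟫ ≡ 1ℚ
⟪⟫-¬ (yes _) = refl
⟪⟫-¬ (no _)  = refl

⟪⟫-× : {A B : Set} (d : Dec A) (e : Dec B) → ⟪ d ×-dec e ⟫ ≡ ⟪ d ⟫ * ⟪ e ⟫
⟪⟫-× (yes _) e = sym (ℚₚ.*-identityˡ ⟪ e ⟫)
⟪⟫-× (no _)  e = sym (ℚₚ.*-zeroˡ ⟪ e ⟫)

module _ {A : Set} where

  ∑ : List A → (A → ℚ) → ℚ
  ∑ []       f = 0ℚ
  ∑ (x ∷ xs) f = f x +ℚ ∑ xs f

  ∑-cong : ∀ xs {f g : A → ℚ} → (∀ x → f x ≡ g x) → ∑ xs f ≡ ∑ xs g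
  ∑-cong []       eq = refl
  ∑-cong (x ∷ xs) eq = cong₂ _+ℚ_ (eq x) (∑-cong xs eq)

  ∑-mono : ∀ xs {f g : A → ℚ} → (∀ x → f x ≤ℚ g x) → ∑ xs f ≤ℚ ∑ xs g
  ∑-mono []       le = ℚₚ.≤-refl
  ∑-mono (x ∷ xs) le = ℚₚ.+-mono-≤ (le x) (∑-mono xs le)

  ∑-zero : ∀ xs → ∑ xs (λ _ → 0ℚ) ≡ 0ℚ
  ∑-zero []       = refl
  ∑-zero (x ∷ xs) = trans (ℚₚ.+-identityˡ _) (∑-zero xs)

  ∑-nonneg : ∀ xs {f : A → ℚ} → (∀ x → 0ℚ ≤ℚ f x) → 0ℚ ≤ℚ ∑ xs f
  ∑-nonneg xs le = subst (_≤ℚ ∑ xs _) (∑-zero xs) (∑-mono xs le)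

  ∑-+ : ∀ xs (f g : A → ℚ) → ∑ xs (λ x → f x +ℚ g x) ≡ ∑ xs f +ℚ ∑ xs g
  ∑-+ []       f g = refl
  ∑-+ (x ∷ xs) f g = trans (cong ((f x +ℚ g x) +ℚ_) (∑-+ xs f g))
    (solve 4 (λ a b c d → (a :+ b) :+ (c :+ d) := (a :+ c) :+ (b :+ d)) refl
      (f x) (g x) (∑ xs f) (∑ xs g))

  ∑-*ˡ : ∀ xs a (f : A → ℚ) → ∑ xs (λ x → a * f x) ≡ a * ∑ xs f
  ∑-*ˡ []       a f = sym (ℚₚ.*-zeroʳ a)
  ∑-*ˡ (x ∷ xs) a f = trans (cong (a * f x +ℚ_) (∑-*ˡ xs a f)) (sym (ℚₚ.*-distribˡ-+ a (f x) (∑ xs f)))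

  ∑-*ʳ : ∀ xs a (f : A → ℚ) → ∑ xs (λ x → f x * a) ≡ ∑ xs f * a
  ∑-*ʳ xs a f = trans (∑-cong xs (λ x → ℚₚ.*-comm (f x) a))
                  (trans (∑-*ˡ xs a f) (ℚₚ.*-comm a (∑ xs f)))

  ∑-const : ∀ xs (a : ℚ) → ∑ xs (λ _ → a) ≡ ι (length xs) * a
  ∑-const []       a = sym (ℚₚ.*-zeroˡ a)
  ∑-const (x ∷ xs) a = begin
    a +ℚ ∑ xs (λ _ → a)           ≡⟨ cong (a +ℚ_) (∑-const xs a) ⟩
    a +ℚ ι (length xs) * a        ≡⟨ solve 2 (λ a l → a :+ l :* a := (con 1ℚ :+ l) :* a) refl a (ι (length xs)) ⟩
    (1ℚ +ℚ ι (length xs)) * a     ≡⟨ cong (_* a) (ι-+ 1 (length xs)) ⟨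
    ι (suc (length xs)) * a       ∎
    where open ≡-Reasoning

  ι-length : ∀ xs → ι (length xs) ≡ ∑ xs (λ _ → 1ℚ)
  ι-length xs = sym (trans (∑-const xs 1ℚ) (ℚₚ.*-identityʳ (ι (length xs))))

  ∑-++ : ∀ xs ys (f : A → ℚ) → ∑ (xs ++ ys) f ≡ ∑ xs f +ℚ ∑ ys f
  ∑-++ []       ys f = sym (ℚₚ.+-identityˡ _)
  ∑-++ (x ∷ xs) ys f = trans (cong (f x +ℚ_) (∑-++ xs ys f)) (sym (ℚₚ.+-assoc (f x) _ _))

  ∑-filter : ∀ {P : A → Set} (P? : ∀ x → Dec (P x)) xs (f : A → ℚ) →
             ∑ (filter P? xs) f ≡ ∑ xs (λ x → ⟪ P? x ⟫ * f x)
  ∑-filter P? []       f = refl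
  ∑-filter P? (x ∷ xs) f with P? x
  ... | yes _ = cong₂ _+ℚ_ (sym (ℚₚ.*-identityˡ (f x))) (∑-filter P? xs f)
  ... | no _  = trans (∑-filter P? xs f)
                  (sym (trans (cong (_+ℚ _) (ℚₚ.*-zeroˡ (f x))) (ℚₚ.+-identityˡ _)))

module _ {A B : Set} where

  ∑-swap : ∀ (xs : List A) (ys : List B) (f : A → B → ℚ) →
           ∑ xs (λ x → ∑ ys (f x)) ≡ ∑ ys (λ y → ∑ xs (λ x → f x y))
  ∑-swap []       ys f = sym (∑-zero ys)
  ∑-swap (x ∷ xs) ys f = trans (cong (∑ ys (f x) +ℚ_) (∑-swap xs ys f))
                           (sym (∑-+ ys (f x) (λ y → ∑ xs (λ x′ → f x′ y))))

  ∑-map : ∀ (g : A → B) xs (f : B → ℚ) → ∑ (map g xs) f ≡ ∑ xs (f ∘ g)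
  ∑-map g []       f = refl
  ∑-map g (x ∷ xs) f = cong (f (g x) +ℚ_) (∑-map g xs f)

  ∑-concatMap : ∀ (g : A → List B) xs (f : B → ℚ) →
                ∑ (concatMap g xs) f ≡ ∑ xs (λ x → ∑ (g x) f)
  ∑-concatMap g []       f = refl
  ∑-concatMap g (x ∷ xs) f = trans (∑-++ (g x) (concatMap g xs) f)
                               (cong (∑ (g x) f +ℚ_) (∑-concatMap g xs f))

-- Sums over an enumeration and change of variables

module _ {A : Set} (_≟ᴬ_ : DecidableEquality A) where

  -- The sifting property of a delta function: every element is listed exactly once, in the form in
  -- which double sums use it.
  Enumerates : List A → Set
  Enumerates xs = ∀ x (f : A → ℚ) → ∑ xs (λ y → ⟪ x ≟ᴬ y ⟫ * f y) ≡ f x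

  -- A double sum over pairs x, y weighted by `to x ≡ y` within S agrees with the one weighted by
  -- `from y ≡ x` within T. The maps are total; their values outside S and T are killed by the
  -- weights.
  ∑-bijection : ∀ {xs} → Enumerates xs →
    {S T : A → Set} (S? : ∀ x → Dec (S x)) (T? : ∀ x → Dec (T x)) (to from : A → A) →
    (∀ x → S x → T (to x) × from (to x) ≡ x) →
    (∀ y → T y → S (from y) × to (from y) ≡ y) →
    (h : A → ℚ) →
    ∑ xs (λ x → ⟪ S? x ⟫ * h (to x)) ≡ ∑ xs (λ y → ⟪ T? y ⟫ * h y)
  ∑-bijection {xs} enum {S} {T} S? T? to from to✓ from✓ h = begin
    ∑ xs (λ x → ⟪ S? x ⟫ * h (to x))
      ≡⟨ ∑-cong xs (λ x → trans (cong (⟪ S? x ⟫ *_) (sym (enum (to x) h))) (sym (∑-*ˡ xs ⟪ S? x ⟫ (λ y → ⟪ to x ≟ᴬ y ⟫ * h y)))) ⟩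
    ∑ xs (λ x → ∑ xs (λ y → ⟪ S? x ⟫ * (⟪ to x ≟ᴬ y ⟫ * h y)))
      ≡⟨ ∑-swap xs xs _ ⟩
    ∑ xs (λ y → ∑ xs (λ x → ⟪ S? x ⟫ * (⟪ to x ≟ᴬ y ⟫ * h y)))
      ≡⟨ ∑-cong xs (λ y → ∑-cong xs (λ x → exchange x y)) ⟩
    ∑ xs (λ y → ∑ xs (λ x → ⟪ from y ≟ᴬ x ⟫ * (⟪ T? y ⟫ * h y)))
      ≡⟨ ∑-cong xs (λ y → enum (from y) (λ _ → ⟪ T? y ⟫ * h y)) ⟩
    ∑ xs (λ y → ⟪ T? y ⟫ * h y) ∎
    where
    open ≡-Reasoning
    exchange : ∀ x y → ⟪ S? x ⟫ * (⟪ to x ≟ᴬ y ⟫ * h y) ≡ ⟪ from y ≟ᴬ x ⟫ * (⟪ T? y ⟫ * h y)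
    exchange x y = begin
      ⟪ S? x ⟫ * (⟪ to x ≟ᴬ y ⟫ * h y)     ≡⟨ ℚₚ.*-assoc ⟪ S? x ⟫ _ _ ⟨
      ⟪ S? x ⟫ * ⟪ to x ≟ᴬ y ⟫ * h y       ≡⟨ cong (_* h y) (⟪⟫-× (S? x) (to x ≟ᴬ y)) ⟨
      ⟪ S? x ×-dec (to x ≟ᴬ y) ⟫ * h y     ≡⟨ cong (_* h y) (⟪⟫-⇔ (S? x ×-dec (to x ≟ᴬ y)) ((from y ≟ᴬ x) ×-dec T? y)
                                               (λ { (s , refl) → proj₂ (to✓ x s) , proj₁ (to✓ x s) })
                                               (λ { (refl , t) → proj₁ (from✓ y t) , proj₂ (from✓ y t) })) ⟩
      ⟪ (from y ≟ᴬ x) ×-dec T? y ⟫ * h y   ≡⟨ cong (_* h y) (⟪⟫-× (from y ≟ᴬ x) (T? y)) ⟩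
      ⟪ from y ≟ᴬ x ⟫ * ⟪ T? y ⟫ * h y     ≡⟨ ℚₚ.*-assoc ⟪ from y ≟ᴬ x ⟫ _ _ ⟩
      ⟪ from y ≟ᴬ x ⟫ * (⟪ T? y ⟫ * h y)   ∎

  enumerates-≤ : ∀ {xs} → Enumerates xs → ∀ x (f : A → ℚ) → (∀ y → 0ℚ ≤ℚ f y) → f x ≤ℚ ∑ xs f
  enumerates-≤ {xs} enum x f 0≤f = subst (_≤ℚ ∑ xs f) (enum x f) (∑-mono xs (λ y → ⟪⟫-*-≤ (x ≟ᴬ y) (0≤f y)))

∑-allFin : ∀ n (f : Fin (suc n) → ℚ) → ∑ (allFin (suc n)) f ≡ f zero +ℚ ∑ (allFin n) (f ∘ suc)
∑-allFin n f = cong (f zero +ℚ_)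
  (trans (cong (λ xs → ∑ xs f) (sym (map-tabulate {n = n} (λ i → i) suc))) (∑-map suc (allFin n) f))

allFin-enumerates : ∀ n → Enumerates (_≟_ {n}) (allFin n)
allFin-enumerates (suc n) zero f = begin
  ∑ (allFin (suc n)) (λ y → ⟪ zero ≟ y ⟫ * f y)       ≡⟨ ∑-allFin n (λ y → ⟪ zero ≟ y ⟫ * f y) ⟩
  1ℚ * f zero +ℚ ∑ (allFin n) (λ y → 0ℚ * f (suc y))  ≡⟨ cong₂ _+ℚ_ (ℚₚ.*-identityˡ (f zero)) (∑-cong (allFin n) (λ y → ℚₚ.*-zeroˡ (f (suc y)))) ⟩
  f zero +ℚ ∑ (allFin n) (λ _ → 0ℚ)                   ≡⟨ cong (f zero +ℚ_) (∑-zero (allFin n)) ⟩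
  f zero +ℚ 0ℚ                                        ≡⟨ ℚₚ.+-identityʳ (f zero) ⟩
  f zero                                              ∎
  where open ≡-Reasoning
allFin-enumerates (suc n) (suc x) f = begin
  ∑ (allFin (suc n)) (λ y → ⟪ suc x ≟ y ⟫ * f y)                   ≡⟨ ∑-allFin n (λ y → ⟪ suc x ≟ y ⟫ * f y) ⟩
  0ℚ * f zero +ℚ ∑ (allFin n) (λ y → ⟪ suc x ≟ suc y ⟫ * f (suc y)) ≡⟨ cong₂ _+ℚ_ (ℚₚ.*-zeroˡ (f zero)) (∑-cong (allFin n) (λ y → cong (_* f (suc y)) (shift y))) ⟩
  0ℚ +ℚ ∑ (allFin n) (λ y → ⟪ x ≟ y ⟫ * f (suc y))                 ≡⟨ ℚₚ.+-identityˡ _ ⟩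
  ∑ (allFin n) (λ y → ⟪ x ≟ y ⟫ * f (suc y))                       ≡⟨ allFin-enumerates n x (f ∘ suc) ⟩
  f (suc x)                                                        ∎
  where
  open ≡-Reasoning
  shift : ∀ y → ⟪ suc x ≟ suc y ⟫ ≡ ⟪ x ≟ y ⟫
  shift y = ⟪⟫-⇔ (suc x ≟ suc y) (x ≟ y) (λ { refl → refl }) (cong suc)

∑-const-allFin : ∀ κ (x : ℚ) → ∑ (allFin κ) (λ _ → x) ≡ ι κ * x
∑-const-allFin κ x = trans (∑-const (allFin κ) x) (cong (λ k → ι k * x) (length-tabulate {n = κ} (λ i → i)))

module _ {κ : ℕ} where

  allVec : ∀ n → List (Vec (Fin κ) n)
  allVec zero    = [] ∷ []
  allVec (suc n) = concatMap (λ a → map (a ∷_) (allVec n)) (allFin κ)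

  ∑-allVec : ∀ n (f : Vec (Fin κ) (suc n) → ℚ) →
             ∑ (allVec (suc n)) f ≡ ∑ (allFin κ) (λ a → ∑ (allVec n) (λ χ → f (a ∷ χ)))
  ∑-allVec n f = trans (∑-concatMap _ (allFin κ) f) (∑-cong (allFin κ) (λ a → ∑-map (a ∷_) (allVec n) f))

  _≟ⱽ_ : ∀ {n} → DecidableEquality (Vec (Fin κ) n)
  _≟ⱽ_ = ≡-dec _≟_

  allVec-enumerates : ∀ n → Enumerates (_≟ⱽ_ {n}) (allVec n)
  allVec-enumerates zero [] f = trans (ℚₚ.+-identityʳ _) (ℚₚ.*-identityˡ _)
  allVec-enumerates (suc n) (b ∷ ξ) f = begin
    ∑ (allVec (suc n)) (λ χ → ⟪ (b ∷ ξ) ≟ⱽ χ ⟫ * f χ)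
      ≡⟨ ∑-allVec n _ ⟩
    ∑ (allFin κ) (λ a → ∑ (allVec n) (λ χ → ⟪ (b ∷ ξ) ≟ⱽ (a ∷ χ) ⟫ * f (a ∷ χ)))
      ≡⟨ ∑-cong (allFin κ) (λ a → ∑-cong (allVec n) (λ χ → split a χ)) ⟩
    ∑ (allFin κ) (λ a → ∑ (allVec n) (λ χ → ⟪ b ≟ a ⟫ * (⟪ ξ ≟ⱽ χ ⟫ * f (a ∷ χ))))
      ≡⟨ ∑-cong (allFin κ) (λ a → trans (∑-*ˡ (allVec n) ⟪ b ≟ a ⟫ _) (cong (⟪ b ≟ a ⟫ *_) (allVec-enumerates n ξ _))) ⟩
    ∑ (allFin κ) (λ a → ⟪ b ≟ a ⟫ * f (a ∷ ξ))
      ≡⟨ allFin-enumerates κ b _ ⟩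
    f (b ∷ ξ) ∎
    where
    open ≡-Reasoning
    split : ∀ a χ → ⟪ (b ∷ ξ) ≟ⱽ (a ∷ χ) ⟫ * f (a ∷ χ) ≡ ⟪ b ≟ a ⟫ * (⟪ ξ ≟ⱽ χ ⟫ * f (a ∷ χ))
    split a χ = trans
      (cong (_* f (a ∷ χ)) (trans (⟪⟫-⇔ ((b ∷ ξ) ≟ⱽ (a ∷ χ)) ((b ≟ a) ×-dec (ξ ≟ⱽ χ)) ∷-injective (λ { (refl , refl) → refl }))
                                  (⟪⟫-× (b ≟ a) (ξ ≟ⱽ χ))))
      (ℚₚ.*-assoc ⟪ b ≟ a ⟫ _ _)

  -- Each vector arises in κ ways by overwriting coordinate r, one for each discarded entry. This
  -- accounts for replacing the dummy colour of r by a real one.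
  ∑-update : ∀ {n} (r : Fin n) (f : Vec (Fin κ) n → ℚ) →
             ∑ (allVec n) (λ χ → ∑ (allFin κ) (λ β → f (χ [ r ]≔ β))) ≡ ι κ * ∑ (allVec n) f
  ∑-update {suc n} zero f = begin
    ∑ (allVec (suc n)) (λ χ → ∑ (allFin κ) (λ β → f (χ [ zero ]≔ β)))
      ≡⟨ ∑-allVec n _ ⟩
    ∑ (allFin κ) (λ _ → ∑ (allVec n) (λ χ → ∑ (allFin κ) (λ β → f (β ∷ χ))))
      ≡⟨ ∑-const-allFin κ _ ⟩
    ι κ * ∑ (allVec n) (λ χ → ∑ (allFin κ) (λ β → f (β ∷ χ)))
      ≡⟨ cong (ι κ *_) (trans (∑-swap (allVec n) (allFin κ) _) (sym (∑-allVec n f))) ⟩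
    ι κ * ∑ (allVec (suc n)) f ∎
    where open ≡-Reasoning
  ∑-update {suc n} (suc r) f = begin
    ∑ (allVec (suc n)) (λ χ → ∑ (allFin κ) (λ β → f (χ [ suc r ]≔ β)))
      ≡⟨ ∑-allVec n _ ⟩
    ∑ (allFin κ) (λ a → ∑ (allVec n) (λ χ → ∑ (allFin κ) (λ β → f (a ∷ (χ [ r ]≔ β)))))
      ≡⟨ ∑-cong (allFin κ) (λ a → ∑-update r (λ χ → f (a ∷ χ))) ⟩
    ∑ (allFin κ) (λ a → ι κ * ∑ (allVec n) (λ χ → f (a ∷ χ)))
      ≡⟨ trans (∑-*ˡ (allFin κ) (ι κ) _) (cong (ι κ *_) (sym (∑-allVec n f))) ⟩
    ι κ * ∑ (allVec (suc n)) f ∎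
    where open ≡-Reasoning

-- Expectations and the primitives of the algorithm

module _ {A : Set} where

  E : Dist A → (A → ℚ) → ℚ
  E d f = ∑ d (λ px → proj₁ px * f (proj₂ px))

  E-return : ∀ x (f : A → ℚ) → E (return x) f ≡ f x
  E-return x f = trans (ℚₚ.+-identityʳ _) (ℚₚ.*-identityˡ (f x))

  E-uniform : ∀ xs (f : A → ℚ) → E (uniform xs) f ≡ inv (length xs) * ∑ xs f
  E-uniform []       f = refl
  E-uniform (x ∷ xs) f = trans
    (∑-map (λ y → inv (suc (length xs)) , y) (x ∷ xs) (λ px → proj₁ px * f (proj₂ px)))
    (∑-*ˡ (x ∷ xs) (inv (suc (length xs))) f)

E->>= : ∀ {A B : Set} (d : Dist A) (f : A → Dist B) (g : B → ℚ) →
        E (d >>= f) g ≡ E d (λ x → E (f x) g)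
E->>= d f g = trans (∑-concatMap _ d _) (∑-cong d λ { (p , x) →
  trans (∑-map _ (f x) _)
    (trans (∑-cong (f x) (λ { (q , y) → ℚₚ.*-assoc p q (g y) })) (∑-*ˡ (f x) p _)) })

expectation≡E : ∀ d → expectation d ≡ E d ι
expectation≡E []            = refl
expectation≡E ((p , t) ∷ d) = cong (p * ι t +ℚ_) (expectation≡E d)

head-filter-just : ∀ {A : Set} {Q : A → Set} (Q? : ∀ x → Dec (Q x)) xs {w} → head (filter Q? xs) ≡ just w → Q w
head-filter-just Q? (x ∷ xs) eq with Q? x
head-filter-just Q? (x ∷ xs) refl | yes q = q
...                               | no _  = head-filter-just Q? xs eq

head-filter-nothing : ∀ {A : Set} {Q : A → Set} (Q? : ∀ x → Dec (Q x)) xs →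
                      head (filter Q? xs) ≡ nothing → ∀ {w} → w ∈ xs → ¬ Q w
head-filter-nothing Q? (x ∷ xs) eq w∈ with Q? x
head-filter-nothing Q? (x ∷ xs) eq (here refl) | no ¬q = ¬q
head-filter-nothing Q? (x ∷ xs) eq (there w∈)  | no _  = head-filter-nothing Q? xs eq w∈

average-mono : ∀ {A : Set} (xs : List A) {f g : A → ℚ} → (∀ x → f x ≤ℚ g x) →
               inv (length xs) * ∑ xs f ≤ℚ inv (length xs) * ∑ xs g
average-mono xs f≤g = *-monoˡ-≤ (inv-nonneg (length xs)) (∑-mono xs f≤g)

average-≤1 : ∀ {A : Set} (xs : List A) {f : A → ℚ} → (∀ x → f x ≤ℚ 1ℚ) →
                  inv (length xs) * ∑ xs f ≤ℚ 1ℚ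
average-≤1 xs {f} f≤1 = ℚₚ.≤-trans (average-mono xs f≤1)
  (subst (_≤ℚ 1ℚ) (cong (inv (length xs) *_) (sym (trans (∑-const xs 1ℚ) (ℚₚ.*-identityʳ _))))
    (inv-*-ι-≤1 (length xs)))

module _ {n κ : ℕ} where

  _≟ᴱ_ : DecidableEquality (Maybe (Fin n × Fin κ))
  _≟ᴱ_ = Maybeₚ.≡-dec (Productₚ.≡-dec _≟_ _≟_)

  -- The Boolean test inside childWithColor has no accessible name; here and below
  -- the underscores in the later signatures are solved by the preceding definition.
  mutual

    childWithColor≡head : ∀ (F : Forest n κ) x β →
      childWithColor F x β ≡ head (filter (λ w → F w ≟ᴱ just (x , β)) (allFin n))
    childWithColor≡head F x β = cong head (filter-≐ _ _
      ((λ {w} → test⁻ F x β w) , (λ {w} → test⁺ F x β w)) (allFin n))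

    test⁻ : ∀ (F : Forest n κ) x β w → _ → F w ≡ just (x , β)
    test⁻ F x β w t with F w
    ... | just (p , c) with p ≟ x | c ≟ β
    ...   | yes refl | yes refl = refl

    test⁺ : ∀ (F : Forest n κ) x β w → F w ≡ just (x , β) → _
    test⁺ F x β w eq with F w
    test⁺ F x β w refl | just (x , β) with x ≟ x | β ≟ β
    ... | yes _  | yes _  = _
    ... | yes _  | no β≢β = ⊥-elim (β≢β refl)
    ... | no x≢x | _      = ⊥-elim (x≢x refl)

  childWithColor-⇔ : ∀ {F G : Forest n κ} {x β γ} →
    (∀ w → F w ≡ just (x , β) → G w ≡ just (x , γ)) →
    (∀ w → G w ≡ just (x , γ) → F w ≡ just (x , β)) →
    childWithColor F x β ≡ childWithColor G x γ
  childWithColor-⇔ {F} {G} {x} {β} {γ} to from = trans (childWithColor≡head F x β) (trans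
    (cong head (filter-≐ _ _ ((λ {w} → to w) , (λ {w} → from w)) (allFin n)))
    (sym (childWithColor≡head G x γ)))

  childWithColor-cong : ∀ {F G : Forest n κ} → F ≗ G → ∀ x β → childWithColor F x β ≡ childWithColor G x β
  childWithColor-cong F≗G x β = childWithColor-⇔ (λ w → trans (sym (F≗G w))) (λ w → trans (F≗G w))

  childWithColor-just : ∀ (F : Forest n κ) {x β w} → childWithColor F x β ≡ just w → F w ≡ just (x , β)
  childWithColor-just F {x} {β} eq = head-filter-just _ (allFin n) (trans (sym (childWithColor≡head F x β)) eq)

  childWithColor-nothing : ∀ (F : Forest n κ) {x β} → childWithColor F x β ≡ nothing → ∀ w → F w ≢ just (x , β)
  childWithColor-nothing F {x} {β} eq w =
    head-filter-nothing _ (allFin n) (trans (sym (childWithColor≡head F x β)) eq) (∈-allFin w)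

  Used : Forest n κ → Fin n → Fin κ → Set
  Used F x a = (∃ λ y → F x ≡ just (y , a)) ⊎ (∃ λ w → F w ≡ just (x , a))

  used? : ∀ F x a → Dec (Used F x a)
  used? F x a = Finₚ.any? (λ y → F x ≟ᴱ just (y , a)) ⊎-dec Finₚ.any? (λ w → F w ≟ᴱ just (x , a))

  mutual

    ∈-incidentColors⁻ : ∀ F x {a} → a ∈ incidentColors F x → Used F x a
    ∈-incidentColors⁻ F x {a} a∈ with ∈-++⁻ _ a∈
    ... | inj₁ own∈   = inj₁ (∈-own⁻ F x a own∈)
    ... | inj₂ child∈ with Any.satisfied (∈-concatMap⁻ _ {xs = allFin n} child∈)
    ...   | w , a∈w = inj₂ (w , ∈-child⁻ F x a w a∈w)

    ∈-own⁻ : ∀ F x a → a ∈ _ → ∃ λ y → F x ≡ just (y , a)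
    ∈-own⁻ F x a a∈ with F x
    ∈-own⁻ F x a (here refl) | just (y , _) = y , refl

    ∈-child⁻ : ∀ F x a w → a ∈ _ → F w ≡ just (x , a)
    ∈-child⁻ F x a w a∈ with F w
    ... | just (p , c) with p ≟ x | a∈
    ...   | yes refl | here refl = refl

  mutual

    ∈-incidentColors⁺ : ∀ F x {a} → Used F x a → a ∈ incidentColors F x
    ∈-incidentColors⁺ F x (inj₁ (y , eq)) with F x
    ∈-incidentColors⁺ F x (inj₁ (y , refl)) | just (y , a) = here refl
    ∈-incidentColors⁺ F x {a} (inj₂ (w , eq)) with F x
    ... | nothing = ∈-concatMap⁺ _ (Any.map (λ { refl → ∈-child⁺ F x a w eq }) (∈-allFin w))
    ... | just _  = there (∈-concatMap⁺ _ (Any.map (λ { refl → ∈-child⁺ F x a w eq }) (∈-allFin w)))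

    ∈-child⁺ : ∀ F x a w → F w ≡ just (x , a) → a ∈ _
    ∈-child⁺ F x a w eq with F w
    ∈-child⁺ F x a w refl | just (x , a) with x ≟ x
    ... | yes _  = here refl
    ... | no x≢x = ⊥-elim (x≢x refl)

  avail≡filter : ∀ F x → avail F x ≡ filter (λ a → ¬? (used? F x a)) (allFin κ)
  avail≡filter F x = filter-≐ _ _ ((λ {a} → to a) , (λ {a} → from a)) (allFin κ)
    where
    to : ∀ a → T (not (any (λ b → ⌊ a ≟ b ⌋) (incidentColors F x))) → ¬ Used F x a
    to a t used = not-T t (any⁺ _ (Any.map fromWitness (∈-incidentColors⁺ F x used)))
      where
      not-T : ∀ {b} → T (not b) → ¬ T b
      not-T {true} ()
    from : ∀ a → ¬ Used F x a → T (not (any (λ b → ⌊ a ≟ b ⌋) (incidentColors F x)))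
    from a ¬used = T-not (λ t → ¬used (∈-incidentColors⁻ F x (Any.map toWitness (any⁻ _ (incidentColors F x) t))))
      where
      T-not : ∀ {b} → ¬ T b → T (not b)
      T-not {true}  ¬t = ¬t _
      T-not {false} ¬t = _

  Used-cong : ∀ {F G : Forest n κ} → F ≗ G → ∀ {x a} → Used F x a → Used G x a
  Used-cong F≗G {x} (inj₁ (y , eq)) = inj₁ (y , trans (sym (F≗G x)) eq)
  Used-cong F≗G     (inj₂ (w , eq)) = inj₂ (w , trans (sym (F≗G w)) eq)

  avail-cong : ∀ {F G : Forest n κ} → F ≗ G → ∀ x → avail F x ≡ avail G x
  avail-cong {F} {G} F≗G x = trans (avail≡filter F x) (trans
    (filter-≐ _ _ ((_∘ Used-cong (sym ∘ F≗G)) , (_∘ Used-cong F≗G)) (allFin κ))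
    (sym (avail≡filter G x)))

  -- The expectation after `rootToChild`, with the outcome of the child search as an argument so
  -- that it can be analysed by cases.
  afterRootToChild : Forest n κ → Fin n → Fin κ → Maybe (Fin n) → (Forest n κ × ℕ → ℚ) → ℚ
  afterRootToChild F r β nothing  G = G (F , 0)
  afterRootToChild F r β (just w) G = inv (length (avail F r)) * ∑ (avail F r) (λ α →
    G (proj₁ (fixForbidden n (setEdge F w r α) w β α) , suc (proj₂ (fixForbidden n (setEdge F w r α) w β α))))

  E-rootToChild : ∀ F r β G → E (rootToChild F r β) G ≡ afterRootToChild F r β (childWithColor F r β) G
  E-rootToChild F r β G with childWithColor F r β
  ... | nothing = E-return (F , 0) G
  ... | just w  = trans (E->>= (uniform (avail F r)) (return ∘ result) G) (trans (E-uniform (avail F r) _)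
    (cong (inv (length (avail F r)) *_) (∑-cong (avail F r) (λ α → E-return (result α) G))))
    where
    result : Fin κ → Forest n κ × ℕ
    result α = proj₁ (fixForbidden n (setEdge F w r α) w β α) , suc (proj₂ (fixForbidden n (setEdge F w r α) w β α))

  E-insertEdge : ∀ F p r G → E (insertEdge F (p , r)) G ≡
    inv (length (avail F p)) * ∑ (avail F p) (λ β →
      afterRootToChild (setEdge F r p β) r β (childWithColor (setEdge F r p β) r β) G)
  E-insertEdge F p r G = trans (E->>= (uniform (avail F p)) _ G) (trans (E-uniform (avail F p) _)
    (cong (inv (length (avail F p)) *_) (∑-cong (avail F p) (λ β → E-rootToChild (setEdge F r p β) r β G))))

  E-insertEdge-≤1 : ∀ (F : Forest n κ) u G → (∀ x → G x ≤ℚ 1ℚ) → E (insertEdge F u) G ≤ℚ 1ℚ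
  E-insertEdge-≤1 F (p , r) G G≤1 = subst (_≤ℚ 1ℚ) (sym (E-insertEdge F p r G))
    (average-≤1 (avail F p) (λ β → inner (setEdge F r p β) β (childWithColor (setEdge F r p β) r β)))
    where
    inner : ∀ F′ β c → afterRootToChild F′ r β c G ≤ℚ 1ℚ
    inner F′ β nothing  = G≤1 _
    inner F′ β (just w) = average-≤1 (avail F′ r) (λ α → G≤1 _)

  E-runSeq-∷ : ∀ (F : Forest n κ) u us f → E (runSeq F (u ∷ us)) f ≡
               E (insertEdge F u) (λ Fk → E (runSeq (proj₁ Fk) us) (λ t → f (proj₂ Fk + t)))
  E-runSeq-∷ F u us f = trans (E->>= (insertEdge F u) continue f) (∑-cong (insertEdge F u) (λ { (q , F′ , k) →
    cong (q *_) (trans (E->>= (runSeq F′ us) (λ t → return (k + t)) f)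
      (∑-cong (runSeq F′ us) (λ { (q′ , t) → cong (q′ *_) (E-return (k + t) f) }))) }))
    where
    continue : Forest n κ × ℕ → Dist ℕ
    continue Fk = runSeq (proj₁ Fk) us >>= λ t → return (proj₂ Fk + t)

  runSeq-mass-≤1 : ∀ (F : Forest n κ) us → E (runSeq F us) (λ _ → 1ℚ) ≤ℚ 1ℚ
  runSeq-mass-≤1 F []       = ℚₚ.≤-refl
  runSeq-mass-≤1 F (u ∷ us) = subst (_≤ℚ 1ℚ) (sym (E-runSeq-∷ F u us (λ _ → 1ℚ)))
    (E-insertEdge-≤1 F u (λ Fk → E (runSeq (proj₁ Fk) us) (λ _ → 1ℚ)) (λ Fk → runSeq-mass-≤1 (proj₁ Fk) us))

  -- The total mass enters as a factor because it is not 1 in general: a uniform choice from an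
  -- empty list loses mass. It is bounded from above for all sequences and from below on paths.
  E-runSeq-shift : ∀ (F : Forest n κ) us k → E (runSeq F us) (λ t → ι (k + t)) ≡
                   ι k * E (runSeq F us) (λ _ → 1ℚ) +ℚ E (runSeq F us) ι
  E-runSeq-shift F us k = begin
    E d (λ t → ι (k + t))
      ≡⟨ ∑-cong d (λ { (q , t) → trans (cong (q *_) (ι-+ k t))
           (solve 3 (λ q a b → q :* (a :+ b) := a :* (q :* con 1ℚ) :+ q :* b) refl q (ι k) (ι t)) }) ⟩
    ∑ d (λ qt → ι k * (proj₁ qt * 1ℚ) +ℚ proj₁ qt * ι (proj₂ qt))
      ≡⟨ ∑-+ d (λ qt → ι k * (proj₁ qt * 1ℚ)) (λ qt → proj₁ qt * ι (proj₂ qt)) ⟩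
    ∑ d (λ qt → ι k * (proj₁ qt * 1ℚ)) +ℚ E d ι
      ≡⟨ cong (_+ℚ E d ι) (∑-*ˡ d (ι k) (λ qt → proj₁ qt * 1ℚ)) ⟩
    ι k * E d (λ _ → 1ℚ) +ℚ E d ι ∎
    where
    open ≡-Reasoning
    d = runSeq F us

-- Rooted forests and alternating chains

just≢nothing : ∀ {A : Set} {x : A} {m : Maybe A} → m ≡ just x → m ≢ nothing
just≢nothing refl ()

-- Acyclicity in the form of explicit depth and root functions, so that inductions run along the
-- depth, independently of the fuel in `rootWith`.
record Rooted {n : ℕ} (P : Parents n) : Set where
  field
    dep        : Fin n → ℕ
    root       : Fin n → Fin n
    dep-root   : ∀ {v} → P v ≡ nothing → dep v ≡ 0
    dep-child  : ∀ {v p} → P v ≡ just p → dep v ≡ suc (dep p)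
    root-root  : ∀ {v} → P v ≡ nothing → root v ≡ v
    root-child : ∀ {v p} → P v ≡ just p → root v ≡ root p

  atDepth : ∀ m v → dep v ≡ m → ∀ {k} → k ≤ m → ∃ λ u → dep u ≡ k
  atDepth m v eq k≤m with ℕₚ.m≤n⇒m<n∨m≡n k≤m
  ... | inj₂ refl = v , eq
  atDepth (suc m) v eq k≤m | inj₁ (s≤s k≤m′) with P v in Pv
  ... | nothing = ⊥-elim (ℕₚ.0≢1+n (trans (sym (dep-root Pv)) eq))
  ... | just p  = atDepth m p (ℕₚ.suc-injective (trans (sym (dep-child Pv)) eq)) k≤m′

  -- Pigeonhole: v and its ancestors occupy all depths from 0 to `dep v` and are therefore
  -- `suc (dep v)` distinct vertices. Hence fuel n suffices for every walk along a branch.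
  dep<n : ∀ v → dep v ℕ.< n
  dep<n v = Finₚ.injective⇒≤ {f = proj₁ ∘ pick} (λ {i} {j} eq →
    Finₚ.toℕ-injective (trans (sym (proj₂ (pick i))) (trans (cong dep eq) (proj₂ (pick j)))))
    where
    pick : (i : Fin (suc (dep v))) → ∃ λ u → dep u ≡ toℕ i
    pick i = atDepth (dep v) v refl (Finₚ.toℕ≤pred[n] i)

  rootWith≡root : ∀ k v → dep v ≤ k → rootWith k P v ≡ root v
  rootWith≡root zero v d≤0 with P v in Pv
  ... | nothing = sym (root-root Pv)
  ... | just p  = ⊥-elim (ℕₚ.1+n≰n (ℕₚ.≤-trans (ℕₚ.≤-reflexive (sym (dep-child Pv))) (ℕₚ.≤-trans d≤0 z≤n)))
  rootWith≡root (suc k) v d≤k with P v in Pv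
  ... | nothing = sym (root-root Pv)
  ... | just p  = trans (rootWith≡root k p (ℕₚ.≤-pred (subst (_≤ suc k) (dep-child Pv) d≤k))) (sym (root-child Pv))

  rootOf≡root : ∀ v → rootOf P v ≡ root v
  rootOf≡root v = rootWith≡root n v (ℕₚ.<⇒≤ (dep<n v))

rooted-empty : ∀ {n} → Rooted (noParents {n})
rooted-empty = record
  { dep = λ _ → 0 ; root = λ v → v ; dep-root = λ _ → refl ; dep-child = λ ()
  ; root-root = λ _ → refl ; root-child = λ () }

module _ {n : ℕ} (P : Parents n) (r p : Fin n) where

  link-new : link P r p r ≡ just p
  link-new with r ≟ r
  ... | yes _  = refl
  ... | no r≢r = ⊥-elim (r≢r refl)

  link-old : ∀ {v} → v ≢ r → link P r p v ≡ P v
  link-old {v} v≢r with v ≟ r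
  ... | yes v≡r = ⊥-elim (v≢r v≡r)
  ... | no _    = refl

-- The tree of r is hung below p: its depths are shifted by `suc (dep p)` and its root becomes that
-- of p. That p itself lies in this tree is excluded by `rootOf P p ≢ r`.
rooted-link : ∀ {n} {P : Parents n} {r p} → Rooted P → P r ≡ nothing → rootOf P p ≢ r → Rooted (link P r p)
rooted-link {n} {P} {r} {p} R Pr p∉r = record
  { dep = dep′ ; root = root′ ; dep-root = dep-root′ ; dep-child = dep-child′
  ; root-root = root-root′ ; root-child = root-child′ }
  where
  open Rooted R
  dep′ : Fin n → ℕ
  dep′ v = if ⌊ root v ≟ r ⌋ then dep v + suc (dep p) else dep v
  root′ : Fin n → Fin n
  root′ v = if ⌊ root v ≟ r ⌋ then root p else root v
  rootp≢r : root p ≢ r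
  rootp≢r eq = p∉r (trans (rootOf≡root p) eq)
  dep-root′ : ∀ {v} → link P r p v ≡ nothing → dep′ v ≡ 0
  dep-root′ {v} Pv with v ≟ r
  ... | no v≢r rewrite root-root Pv with v ≟ r
  ...   | yes v≡r = ⊥-elim (v≢r v≡r)
  ...   | no _    = dep-root Pv
  root-root′ : ∀ {v} → link P r p v ≡ nothing → root′ v ≡ v
  root-root′ {v} Pv with v ≟ r
  ... | no v≢r rewrite root-root Pv with v ≟ r
  ...   | yes v≡r = ⊥-elim (v≢r v≡r)
  ...   | no _    = refl
  dep-child′ : ∀ {v q} → link P r p v ≡ just q → dep′ v ≡ suc (dep′ q)
  dep-child′ {v} Pv with v ≟ r
  dep-child′ refl | yes refl rewrite root-root Pr with r ≟ r | root p ≟ r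
  ... | no r≢r | _      = ⊥-elim (r≢r refl)
  ... | yes _  | yes eq = ⊥-elim (rootp≢r eq)
  ... | yes _  | no _   = cong (_+ suc (dep p)) (dep-root Pr)
  dep-child′ {v} {q} Pv | no _ rewrite root-child Pv with root q ≟ r
  ... | yes _ = cong (_+ suc (dep p)) (dep-child Pv)
  ... | no _  = dep-child Pv
  root-child′ : ∀ {v q} → link P r p v ≡ just q → root′ v ≡ root′ q
  root-child′ {v} Pv with v ≟ r
  root-child′ refl | yes refl rewrite root-root Pr with r ≟ r | root p ≟ r
  ... | no r≢r | _      = ⊥-elim (r≢r refl)
  ... | yes _  | yes eq = ⊥-elim (rootp≢r eq)
  ... | yes _  | no _   = refl
  root-child′ {v} {q} Pv | no _ rewrite root-child Pv = refl

-- Colourings as vectors, and chains on them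

module _ {n κ : ℕ} where

  -- A colouring gives every vertex the colour of its parent edge; the colour of a
  -- root is a dummy, left unconstrained.
  ⟦_,_⟧ : Parents n → Vec (Fin κ) n → Forest n κ
  ⟦ P , χ ⟧ v = Maybe.map (λ p → p , lookup χ v) (P v)

  ⟦⟧⁺ : ∀ (P : Parents n) χ {w x β} → P w ≡ just x → lookup χ w ≡ β → ⟦ P , χ ⟧ w ≡ just (x , β)
  ⟦⟧⁺ P χ Pw refl rewrite Pw = refl

  ⟦⟧⁻ : ∀ (P : Parents n) χ {w x β} → ⟦ P , χ ⟧ w ≡ just (x , β) → P w ≡ just x × lookup χ w ≡ β
  ⟦⟧⁻ P χ {w} eq with P w
  ⟦⟧⁻ P χ refl | just x = refl , refl

  find : Parents n → Vec (Fin κ) n → Fin n → Fin κ → Maybe (Fin n)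
  find P χ = childWithColor ⟦ P , χ ⟧

  -- fixForbidden split into the new colouring and the number of recoloured edges.
  -- The latter never looks at an edge after changing it, so no update is needed.
  recolor : ℕ → Parents n → Vec (Fin κ) n → Fin n → Fin κ → Fin κ → Vec (Fin κ) n
  recolor zero    P χ v α β = χ
  recolor (suc k) P χ v α β = maybe′ (λ w → recolor k P (χ [ w ]≔ α) w β α) χ (find P χ v β)

  len : ℕ → Parents n → Vec (Fin κ) n → Fin n → Fin κ → Fin κ → ℕ
  len zero    P χ v α β = 0
  len (suc k) P χ v α β = maybe′ (λ w → suc (len k P χ w β α)) 0 (find P χ v β)

  Absent : Parents n → Vec (Fin κ) n → Fin n → Fin κ → Set
  Absent P χ v α = ∀ u → P u ≡ just v → lookup χ u ≢ α

module _ {n κ : ℕ} (P : Parents n) where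

  find-just : ∀ (χ : Vec (Fin κ) n) {v β w} → find P χ v β ≡ just w → P w ≡ just v × lookup χ w ≡ β
  find-just χ eq = ⟦⟧⁻ P χ (childWithColor-just ⟦ P , χ ⟧ eq)

  find-nothing : ∀ (χ : Vec (Fin κ) n) {v β} → find P χ v β ≡ nothing → Absent P χ v β
  find-nothing χ eq u Pu χu = childWithColor-nothing ⟦ P , χ ⟧ eq u (⟦⟧⁺ P χ Pu χu)

  find-absent : ∀ (χ : Vec (Fin κ) n) {v β} → Absent P χ v β → find P χ v β ≡ nothing
  find-absent χ {v} {β} abs with find P χ v β in eq
  ... | nothing = refl
  ... | just w  = ⊥-elim (abs w (proj₁ (find-just χ eq)) (proj₂ (find-just χ eq)))

  find-unique : ∀ (χ : Vec (Fin κ) n) {v β w} → P w ≡ just v → lookup χ w ≡ β →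
                (∀ u → P u ≡ just v → lookup χ u ≡ β → u ≡ w) → find P χ v β ≡ just w
  find-unique χ {v} {β} {w} Pw χw uniq with find P χ v β in eq
  ... | just u  = cong just (uniq u (proj₁ (find-just χ eq)) (proj₂ (find-just χ eq)))
  ... | nothing = ⊥-elim (find-nothing χ eq w Pw χw)

  find-⇔ : ∀ (χ ξ : Vec (Fin κ) n) {v β γ} →
    (∀ w → P w ≡ just v → lookup χ w ≡ β → lookup ξ w ≡ γ) →
    (∀ w → P w ≡ just v → lookup ξ w ≡ γ → lookup χ w ≡ β) →
    find P χ v β ≡ find P ξ v γ
  find-⇔ χ ξ to from = childWithColor-⇔ {F = ⟦ P , χ ⟧} {G = ⟦ P , ξ ⟧}
    (λ w eq → let Pw , χw = ⟦⟧⁻ P χ eq in ⟦⟧⁺ P ξ Pw (to w Pw χw))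
    (λ w eq → let Pw , ξw = ⟦⟧⁻ P ξ eq in ⟦⟧⁺ P χ Pw (from w Pw ξw))

module Chain {n κ : ℕ} {P : Parents n} (R : Rooted P) where
  open Rooted R

  deeper⇒≢ : ∀ {u v} → dep u ≤ dep v → ∀ {w} → P w ≡ just v → u ≢ w
  deeper⇒≢ {v = v} u≤v Pw refl = ℕₚ.1+n≰n (subst (_≤ dep v) (dep-child Pw) u≤v)

  dep-≤-child : ∀ {u v w} → dep u ≤ dep v → P w ≡ just v → dep u ≤ dep w
  dep-≤-child u≤v Pw = ℕₚ.≤-trans u≤v (ℕₚ.≤-trans (ℕₚ.n≤1+n _) (ℕₚ.≤-reflexive (sym (dep-child Pw))))

  recolor-fixed : ∀ k χ v α β u → dep u ≤ dep v → lookup (recolor {κ = κ} k P χ v α β) u ≡ lookup χ u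
  recolor-fixed zero    χ v α β u u≤v = refl
  recolor-fixed (suc k) χ v α β u u≤v with find P χ v β in eq
  ... | nothing = refl
  ... | just w  = trans (recolor-fixed k (χ [ w ]≔ α) w β α u (dep-≤-child u≤v Pw)) (lookup∘update′ (deeper⇒≢ u≤v Pw) χ α)
    where Pw = proj₁ (find-just P χ eq)

  find-update : ∀ (χ : Vec (Fin κ) n) v β x a → dep x ≤ dep v → find P (χ [ x ]≔ a) v β ≡ find P χ v β
  find-update χ v β x a x≤v = find-⇔ P (χ [ x ]≔ a) χ
    (λ w Pw eq → trans (sym (same w Pw)) eq) (λ w Pw eq → trans (same w Pw) eq)
    where
    same : ∀ w → P w ≡ just v → lookup (χ [ x ]≔ a) w ≡ lookup χ w
    same w Pw = lookup∘update′ (deeper⇒≢ x≤v Pw ∘ sym) χ a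

  -- A chain started at v reads and writes only colours of vertices deeper than v, hence commutes
  -- with a change at a vertex not deeper than v. Applied to the vertex just recoloured, this
  -- detaches the first step of a run from the rest.
  recolor-update : ∀ k (χ : Vec (Fin κ) n) v α β x a → dep x ≤ dep v →
                   recolor k P (χ [ x ]≔ a) v α β ≡ recolor k P χ v α β [ x ]≔ a
  recolor-update zero    χ v α β x a x≤v = refl
  recolor-update (suc k) χ v α β x a x≤v rewrite find-update χ v β x a x≤v with find P χ v β in eq
  ... | nothing = refl
  ... | just w  = trans (cong (λ ξ → recolor k P ξ w β α) ([]≔-commutes χ x w (deeper⇒≢ x≤v Pw)))
                        (recolor-update k (χ [ w ]≔ α) w β α x a (dep-≤-child x≤v Pw))
    where Pw = proj₁ (find-just P χ eq)

  len-update : ∀ k (χ : Vec (Fin κ) n) v α β x a → dep x ≤ dep v → len k P (χ [ x ]≔ a) v α β ≡ len k P χ v α β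
  len-update zero    χ v α β x a x≤v = refl
  len-update (suc k) χ v α β x a x≤v rewrite find-update χ v β x a x≤v with find P χ v β in eq
  ... | nothing = refl
  ... | just w  = cong suc (len-update k χ w β α x a (dep-≤-child x≤v (proj₁ (find-just P χ eq))))

  -- After the run, w is the only child of v coloured α, because no child had that colour before; so
  -- the run with exchanged colours retraces the same path. Properness is assumed only strictly
  -- deeper than v, since at r the exchanged colour may collide.
  recolor-inverse : ∀ k (χ : Vec (Fin κ) n) v α β → Absent P χ v α →
    (∀ u x → dep v ℕ.< dep x → P u ≡ just x → lookup χ u ≢ lookup χ x) →
    recolor k P (recolor k P χ v α β) v β α ≡ χ × len k P (recolor k P χ v α β) v β α ≡ len k P χ v α β
  recolor-inverse zero    χ v α β abs proper = refl , refl
  recolor-inverse (suc k) χ v α β abs proper with find P χ v β in eq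
  ... | nothing rewrite find-absent P χ abs = refl , refl
  ... | just w  = inverse
    where
    Pw : P w ≡ just v
    Pw = proj₁ (find-just P χ eq)
    χw : lookup χ w ≡ β
    χw = proj₂ (find-just P χ eq)
    χ′ ξ : Vec (Fin κ) n
    χ′ = recolor k P (χ [ w ]≔ α) w β α
    ξ  = recolor k P χ w β α
    v<w : dep v ℕ.< dep w
    v<w = ℕₚ.≤-reflexive (sym (dep-child Pw))
    χ′≡ : χ′ ≡ ξ [ w ]≔ α
    χ′≡ = recolor-update k χ w β α w α ℕₚ.≤-refl
    ξw : lookup ξ w ≡ β
    ξw = trans (recolor-fixed k χ w β α w ℕₚ.≤-refl) χw
    χ′w : lookup χ′ w ≡ α
    χ′w = trans (cong (λ ζ → lookup ζ w) χ′≡) (lookup∘update w ξ α)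
    find≡ : find P χ′ v α ≡ just w
    find≡ = find-unique P χ′ Pw χ′w only
      where
      only : ∀ u → P u ≡ just v → lookup χ′ u ≡ α → u ≡ w
      only u Pu χ′u with u ≟ w
      ... | yes u≡w = u≡w
      ... | no u≢w  = ⊥-elim (abs u Pu (trans (sym (trans (recolor-fixed k (χ [ w ]≔ α) w β α u (ℕₚ.≤-reflexive (trans (dep-child Pu) (sym (dep-child Pw)))))
                                                     (lookup∘update′ u≢w χ α))) χ′u))
    -- The recolouring of w commutes with the rest of the run, so giving w its old colour β again
    -- leaves a plain run on χ started at w, to which the induction hypothesis applies.
    restore : χ′ [ w ]≔ β ≡ ξ
    restore = trans (cong (_[ w ]≔ β) χ′≡) (trans ([]≔-idempotent ξ w)
                (trans (cong (ξ [ w ]≔_) (sym ξw)) ([]≔-lookup ξ w)))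
    absw : Absent P χ w β
    absw u Pu χu = proper u w v<w Pu (trans χu (sym χw))
    ih = recolor-inverse k χ w β α absw (λ u x w<x → proper u x (ℕₚ.<-trans v<w w<x))
    inverse : recolor (suc k) P χ′ v β α ≡ χ × len (suc k) P χ′ v β α ≡ suc (len k P χ w β α)
    inverse rewrite find≡ =
      trans (cong (λ ζ → recolor k P ζ w α β) restore) (proj₁ ih) ,
      cong suc (trans (cong (λ ζ → len k P ζ w α β) χ′≡) (trans (len-update k ξ w α β w α ℕₚ.≤-refl) (proj₂ ih)))

  -- The invariant during a run: everything is proper at vertices no shallower than v, except that
  -- the parent edge of v may clash with a child edge of v. Depth stands in for membership in the
  -- subtree of v; the run does not touch what lies elsewhere.
  ProperBelow : Fin n → Vec (Fin κ) n → Set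
  ProperBelow v χ =
    (∀ u u′ x → dep v ≤ dep x → P u ≡ just x → P u′ ≡ just x → u ≢ u′ → lookup χ u ≢ lookup χ u′) ×
    (∀ u x → dep v ≤ dep x → x ≢ v → P u ≡ just x → lookup χ u ≢ lookup χ x)

  -- Recolouring w from β to α moves the clash to w: a child of w may have colour α, but none has β.
  -- The recursive call with exchanged colours thus meets the same hypotheses one level deeper and
  -- leaves α absent at w. The fuel condition trades one unit for one level of depth, and depths
  -- stay below n.
  recolor-proper : ∀ k χ v α β → n ≤ dep v + k → ProperBelow v χ → Absent P χ v α →
                   ProperBelow v (recolor k P χ v α β) × Absent P (recolor k P χ v α β) v β
  recolor-proper zero χ v α β fuel _ _ =
    ⊥-elim (ℕₚ.<⇒≱ (dep<n v) (subst (n ≤_) (ℕₚ.+-identityʳ (dep v)) fuel))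
  recolor-proper (suc k) χ v α β fuel (sib , par) abs with find P χ v β in eq
  ... | nothing = (sib , par) , find-nothing P χ eq
  ... | just w  = (sib′ , par′) , abs′
    where
    Pw : P w ≡ just v
    Pw = proj₁ (find-just P χ eq)
    χw : lookup χ w ≡ β
    χw = proj₂ (find-just P χ eq)
    dw : dep w ≡ suc (dep v)
    dw = dep-child Pw
    v≤w : dep v ≤ dep w
    v≤w = ℕₚ.≤-trans (ℕₚ.n≤1+n _) (ℕₚ.≤-reflexive (sym dw))
    w≢v : w ≢ v
    w≢v w≡v = deeper⇒≢ ℕₚ.≤-refl Pw (sym w≡v)
    χ₁ χ′ : Vec (Fin κ) n
    χ₁ = χ [ w ]≔ α
    χ′ = recolor k P χ₁ w β α
    other : ∀ {u} → u ≢ w → lookup χ₁ u ≡ lookup χ u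
    other u≢w = lookup∘update′ u≢w χ α
    below : ∀ {u x} → dep w ≤ dep x → P u ≡ just x → lookup χ₁ u ≡ lookup χ u
    below w≤x Pu = other (deeper⇒≢ w≤x Pu ∘ sym)
    fixed : ∀ {u} → dep u ≤ dep w → u ≢ w → lookup χ′ u ≡ lookup χ u
    fixed u≤w u≢w = trans (recolor-fixed k χ₁ w β α _ u≤w) (other u≢w)
    χ′w : lookup χ′ w ≡ α
    χ′w = trans (recolor-fixed k χ₁ w β α w ℕₚ.≤-refl) (lookup∘update w χ α)
    ih : ProperBelow w χ′ × Absent P χ′ w α
    ih = recolor-proper k χ₁ w β α
      (subst (n ≤_) (trans (ℕₚ.+-suc (dep v) k) (cong (_+ k) (sym dw))) fuel)
      ((λ u u′ x w≤x Pu Pu′ u≢u′ e → sib u u′ x (ℕₚ.≤-trans v≤w w≤x) Pu Pu′ u≢u′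
          (trans (sym (below w≤x Pu)) (trans e (below w≤x Pu′)))) ,
       (λ u x w≤x x≢w Pu e → par u x (ℕₚ.≤-trans v≤w w≤x)
          (λ { refl → ℕₚ.1+n≰n (subst (_≤ dep v) dw w≤x) }) Pu
          (trans (sym (below w≤x Pu)) (trans e (other x≢w)))))
      (λ u Pu e → par u w v≤w w≢v Pu (trans (sym (below ℕₚ.≤-refl Pu)) (trans e (sym χw))))
    child≤w : ∀ {u x} → dep x ≡ dep v → P u ≡ just x → dep u ≤ dep w
    child≤w x≡v Pu = ℕₚ.≤-reflexive (trans (dep-child Pu) (trans (cong suc x≡v) (sym dw)))
    split : ∀ {x} → dep v ≤ dep x → dep x ≡ dep v ⊎ dep w ≤ dep x
    split {x} v≤x with ℕₚ.m≤n⇒m<n∨m≡n v≤x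
    ... | inj₂ e   = inj₁ (sym e)
    ... | inj₁ v<x = inj₂ (subst (_≤ dep x) (sym dw) v<x)
    parent≡v : ∀ {x} → P w ≡ just x → x ≡ v
    parent≡v e = Maybeₚ.just-injective (trans (sym e) Pw)
    sib′ : ∀ u u′ x → dep v ≤ dep x → P u ≡ just x → P u′ ≡ just x → u ≢ u′ → lookup χ′ u ≢ lookup χ′ u′
    sib′ u u′ x v≤x Pu Pu′ u≢u′ e with split v≤x
    ... | inj₂ w≤x = proj₁ (proj₁ ih) u u′ x w≤x Pu Pu′ u≢u′ e
    ... | inj₁ x≡v with u ≟ w | u′ ≟ w
    ...   | yes refl | yes refl = u≢u′ refl
    ...   | yes refl | no u′≢w  with refl ← parent≡v Pu =
            abs u′ Pu′ (trans (sym (fixed (child≤w x≡v Pu′) u′≢w)) (trans (sym e) χ′w))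
    ...   | no u≢w   | yes refl with refl ← parent≡v Pu′ =
            abs u Pu (trans (sym (fixed (child≤w x≡v Pu) u≢w)) (trans e χ′w))
    ...   | no u≢w   | no u′≢w  = sib u u′ x v≤x Pu Pu′ u≢u′
            (trans (sym (fixed (child≤w x≡v Pu) u≢w)) (trans e (fixed (child≤w x≡v Pu′) u′≢w)))
    par′ : ∀ u x → dep v ≤ dep x → x ≢ v → P u ≡ just x → lookup χ′ u ≢ lookup χ′ x
    par′ u x v≤x x≢v Pu e with x ≟ w
    -- The clash that w received with its new colour is gone: the recursive call leaves no child of
    -- w coloured α.
    ... | yes refl = proj₂ ih u Pu (trans e χ′w)
    ... | no x≢w with split v≤x
    ...   | inj₂ w≤x = proj₂ (proj₁ ih) u x w≤x x≢w Pu e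
    ...   | inj₁ x≡v = par u x v≤x x≢v Pu (trans
            (sym (fixed (child≤w x≡v Pu) (λ { refl → x≢v (parent≡v Pu) })))
            (trans e (fixed (ℕₚ.≤-trans (ℕₚ.≤-reflexive x≡v) v≤w) x≢w)))
    abs′ : Absent P χ′ v β
    abs′ u Pu e with u ≟ w
    ... | yes refl = abs-αβ (trans (sym χ′w) e)
      where
      abs-αβ : α ≢ β
      abs-αβ refl = abs w Pw χw
    -- Siblings differed before the run, so only w among the children of v had colour β, and the
    -- other children keep their colours.
    ... | no u≢w = sib u w v ℕₚ.≤-refl Pu Pw u≢w (trans (sym (fixed (child≤w refl Pu) u≢w)) (trans e (sym χw)))

  recolor-present : ∀ k (χ : Vec (Fin κ) n) v α β {w} → find P χ v β ≡ just w →
                    P w ≡ just v × lookup (recolor (suc k) P χ v α β) w ≡ α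
  recolor-present k χ v α β {w} eq = proj₁ (find-just P χ eq) , color
    where
    color : lookup (recolor (suc k) P χ v α β) w ≡ α
    color rewrite eq = trans (recolor-fixed k (χ [ w ]≔ α) w β α w ℕₚ.≤-refl) (lookup∘update w χ α)

-- The algorithm compared with its vector model

module _ {n κ : ℕ} where

  -- The first recolouring in `rootToChild` is itself a step of `fixForbidden` at r, so the chain
  -- absorbs it by using fuel `suc n`. The inserted colour β is read off as the colour of r.
  afterRoot : (Vec (Fin κ) n → ℕ → ℚ) → Parents n → Vec (Fin κ) n → Fin n → ℚ
  afterRoot g P χ r = maybe′
    (λ _ → inv (length (avail ⟦ P , χ ⟧ r)) * ∑ (avail ⟦ P , χ ⟧ r) (λ α →
      g (recolor (suc n) P χ r α (lookup χ r)) (len (suc n) P χ r α (lookup χ r))))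
    (g χ 0) (find P χ r (lookup χ r))

  afterInsert : (Vec (Fin κ) n → ℕ → ℚ) → Parents n → Vec (Fin κ) n → Fin n → Fin n → ℚ
  afterInsert g P χ p r = inv (length (avail ⟦ P , χ ⟧ p)) *
    ∑ (avail ⟦ P , χ ⟧ p) (λ β → afterRoot g (link P r p) (χ [ r ]≔ β) r)

  -- An upper bound only because a uniform choice from an empty list has mass 0.
  value : Parents n → Vec (Fin κ) n → List (Fin n × Fin n) → ℚ
  value P χ []             = 0ℚ
  value P χ ((p , r) ∷ us) = afterInsert (λ χ′ k → ι k +ℚ value (link P r p) χ′ us) P χ p r

  setEdge-⟦⟧ : ∀ {P : Parents n} {F : Forest n κ} {χ : Vec (Fin κ) n} {w v} α → P w ≡ just v → F ≗ ⟦ P , χ ⟧ → setEdge F w v α ≗ ⟦ P , χ [ w ]≔ α ⟧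
  setEdge-⟦⟧ {P} {F} {χ} {w} {v} α Pw F≗ u with u ≟ w
  ... | yes refl = sym (⟦⟧⁺ P (χ [ w ]≔ α) Pw (lookup∘update w χ α))
  ... | no u≢w   = trans (F≗ u) (cong (λ c → Maybe.map (λ q → q , c) (P u)) (sym (lookup∘update′ u≢w χ α)))

  setEdge-link : ∀ {P : Parents n} {F : Forest n κ} {χ : Vec (Fin κ) n} p r β → F ≗ ⟦ P , χ ⟧ → setEdge F r p β ≗ ⟦ link P r p , χ [ r ]≔ β ⟧
  setEdge-link {P} {F} {χ} p r β F≗ u with u ≟ r
  ... | yes refl = cong (λ c → just (p , c)) (sym (lookup∘update r χ β))
  ... | no u≢r   = trans (F≗ u) (cong (λ c → Maybe.map (λ q → q , c) (P u)) (sym (lookup∘update′ u≢r χ β)))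

  fixForbidden-⟦⟧ : ∀ {P : Parents n} → Rooted P → ∀ k {F : Forest n κ} {χ : Vec (Fin κ) n} v α β → F ≗ ⟦ P , χ ⟧ →
    (proj₁ (fixForbidden k F v α β) ≗ ⟦ P , recolor k P χ v α β ⟧) × proj₂ (fixForbidden k F v α β) ≡ len k P χ v α β
  fixForbidden-⟦⟧ R zero v α β F≗ = F≗ , refl
  fixForbidden-⟦⟧ {P} R (suc k) {F} {χ} v α β F≗ rewrite childWithColor-cong F≗ v β with find P χ v β in eq
  ... | nothing = F≗ , refl
  -- The algorithm counts on the forest in which w is already recoloured, `len` on the original
  -- colouring; the chain below w does not see the difference.
  ... | just w  = proj₁ ih , cong suc (trans (proj₂ ih) (Chain.len-update R k χ w β α w α ℕₚ.≤-refl))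
    where ih = fixForbidden-⟦⟧ R k w β α (setEdge-⟦⟧ {P = P} {χ = χ} α (proj₁ (find-just P χ eq)) F≗)

  afterRootToChild-≤ : ∀ {P : Parents n} → Rooted P → ∀ {F : Forest n κ} {χ} → F ≗ ⟦ P , χ ⟧ → ∀ r {β} → β ≡ lookup χ r →
    ∀ G g → (∀ {F′ χ′} k → F′ ≗ ⟦ P , χ′ ⟧ → G (F′ , k) ≤ℚ g χ′ k) →
    afterRootToChild F r β (childWithColor F r β) G ≤ℚ afterRoot g P χ r
  afterRootToChild-≤ {P} R {F} {χ} F≗ r {β} refl G g G≤g
    rewrite childWithColor-cong F≗ r β with find P χ r β in eq
  ... | nothing = G≤g 0 F≗
  ... | just w rewrite avail-cong F≗ r = average-mono (avail ⟦ P , χ ⟧ r) (λ α →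
      subst (λ k → G (proj₁ (fix α) , suc (proj₂ (fix α))) ≤ℚ g (recolor n P (χ [ w ]≔ α) w β α) k)
        (cong suc (trans (proj₂ (sim α)) (Chain.len-update R n χ w β α w α ℕₚ.≤-refl)))
        (G≤g (suc (proj₂ (fix α))) (proj₁ (sim α))))
    where
    fix : Fin κ → Forest n κ × ℕ
    fix α = fixForbidden n (setEdge F w r α) w β α
    sim : ∀ α → (proj₁ (fix α) ≗ ⟦ P , recolor n P (χ [ w ]≔ α) w β α ⟧) × proj₂ (fix α) ≡ len n P (χ [ w ]≔ α) w β α
    sim α = fixForbidden-⟦⟧ R n w β α (setEdge-⟦⟧ {P = P} {χ = χ} α (proj₁ (find-just P χ eq)) F≗)

  E-insertEdge-≤ : ∀ {P : Parents n} {p r} → Rooted (link P r p) → ∀ {F : Forest n κ} {χ} → F ≗ ⟦ P , χ ⟧ → ∀ G g →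
    (∀ {F′ χ′} k → F′ ≗ ⟦ link P r p , χ′ ⟧ → G (F′ , k) ≤ℚ g χ′ k) →
    E (insertEdge F (p , r)) G ≤ℚ afterInsert g P χ p r
  E-insertEdge-≤ {P} {p} {r} R {F} {χ} F≗ G g G≤g = subst (_≤ℚ afterInsert g P χ p r) (sym (E-insertEdge F p r G)) bound
    where
    bound : inv (length (avail F p)) * ∑ (avail F p) (λ β →
              afterRootToChild (setEdge F r p β) r β (childWithColor (setEdge F r p β) r β) G) ≤ℚ afterInsert g P χ p r
    bound rewrite avail-cong F≗ p = average-mono (avail ⟦ P , χ ⟧ p) (λ β →
      afterRootToChild-≤ R {χ = χ [ r ]≔ β} (setEdge-link {χ = χ} p r β F≗) r (sym (lookup∘update r χ β)) G g G≤g)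

  -- The bound holds for every χ that represents F, whatever dummy colours it gives to the roots.
  -- This permits averaging over all χ at the start, where the forest is empty.
  runSeq-≤-value : ∀ {Δ} {P : Parents n} {us} → Rooted P → ValidSeq Δ P us → ∀ {F : Forest n κ} {χ} → F ≗ ⟦ P , χ ⟧ →
                   E (runSeq F us) ι ≤ℚ value P χ us
  runSeq-≤-value R done F≗ = ℚₚ.≤-refl
  runSeq-≤-value {P = P} {(p , r) ∷ us} R (step Pr p≁r _ valid) {F} {χ} F≗ =
    subst (_≤ℚ value P χ ((p , r) ∷ us)) (sym (E-runSeq-∷ F (p , r) us ι))
      (E-insertEdge-≤ R′ F≗ _ (λ χ′ k → ι k +ℚ value (link P r p) χ′ us) (λ {F′} {χ′} k F′≗ → begin
        E (runSeq F′ us) (λ t → ι (k + t))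
          ≡⟨ E-runSeq-shift F′ us k ⟩
        ι k * E (runSeq F′ us) (λ _ → 1ℚ) +ℚ E (runSeq F′ us) ι
          ≤⟨ ℚₚ.+-mono-≤ (*-monoˡ-≤ (ι-nonneg k) (runSeq-mass-≤1 F′ us)) (runSeq-≤-value R′ valid F′≗) ⟩
        ι k * 1ℚ +ℚ value (link P r p) χ′ us
          ≡⟨ cong (_+ℚ value (link P r p) χ′ us) (ℚₚ.*-identityʳ (ι k)) ⟩
        ι k +ℚ value (link P r p) χ′ us ∎))
    where
    open ℚₚ.≤-Reasoning
    R′ = rooted-link R Pr p≁r

-- Uniform proper colourings are preserved

_≟ᴾ_ : ∀ {n} (x y : Maybe (Fin n)) → Dec (x ≡ y)
_≟ᴾ_ = Maybeₚ.≡-dec _≟_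

∸-from-+ : ∀ {a b c} → a + b ≡ c → a ≡ c ∸ b
∸-from-+ {a} {b} eq = trans (sym (ℕₚ.m+n∸n≡m a b)) (cong (_∸ b) eq)

module _ {n : ℕ} (P : Parents n) where

  parentEdges : Fin n → ℕ
  parentEdges x = maybe′ (λ _ → 1) 0 (P x)

  children : Fin n → ℕ
  children x = length (filter (λ w → P w ≟ᴾ just x) (allFin n))

  ι-children : ∀ x → ι (children x) ≡ ∑ (allFin n) (λ w → ⟪ P w ≟ᴾ just x ⟫)
  ι-children x = trans (ι-length (filter (λ w → P w ≟ᴾ just x) (allFin n)))
    (trans (∑-filter (λ w → P w ≟ᴾ just x) (allFin n) (λ _ → 1ℚ))
      (∑-cong (allFin n) (λ w → ℚₚ.*-identityʳ ⟪ P w ≟ᴾ just x ⟫)))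

module _ {n κ : ℕ} (P : Parents n) where

  Has : Vec (Fin κ) n → Fin n → Fin κ → Set
  Has χ v a = ∃ λ w → P w ≡ just v × lookup χ w ≡ a

  has? : ∀ χ v a → Dec (Has χ v a)
  has? χ v a = Finₚ.any? (λ w → (P w ≟ᴾ just v) ×-dec (lookup χ w ≟ a))

  SiblingsDiffer : Vec (Fin κ) n → Set
  SiblingsDiffer χ = ∀ u u′ x → P u ≡ just x → P u′ ≡ just x → u ≢ u′ → lookup χ u ≢ lookup χ u′

  siblingsDiffer? : ∀ χ → Dec (SiblingsDiffer χ)
  siblingsDiffer? χ = Finₚ.all? λ u → Finₚ.all? λ u′ → Finₚ.all? λ x →
    (P u ≟ᴾ just x) →-dec (P u′ ≟ᴾ just x) →-dec ¬? (u ≟ u′) →-dec ¬? (lookup χ u ≟ lookup χ u′)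

  Proper : Vec (Fin κ) n → Set
  Proper χ = SiblingsDiffer χ × (∀ u x y → P u ≡ just x → P x ≡ just y → lookup χ u ≢ lookup χ x)

  proper? : ∀ χ → Dec (Proper χ)
  proper? χ = siblingsDiffer? χ ×-dec (Finₚ.all? λ u → Finₚ.all? λ x → Finₚ.all? λ y →
    (P u ≟ᴾ just x) →-dec (P x ≟ᴾ just y) →-dec ¬? (lookup χ u ≟ lookup χ x))

  ProperExcept : Fin n → Vec (Fin κ) n → Set
  ProperExcept r χ = SiblingsDiffer χ ×
    (∀ u x y → x ≢ r → P u ≡ just x → P x ≡ just y → lookup χ u ≢ lookup χ x)

  properExcept? : ∀ r χ → Dec (ProperExcept r χ)
  properExcept? r χ = siblingsDiffer? χ ×-dec (Finₚ.all? λ u → Finₚ.all? λ x → Finₚ.all? λ y →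
    ¬? (x ≟ r) →-dec (P u ≟ᴾ just x) →-dec (P x ≟ᴾ just y) →-dec ¬? (lookup χ u ≟ lookup χ x))

  -- As siblings differ, at most one child of x has colour a, so existence can be replaced by a
  -- count.
  ⟪has⟫ : ∀ χ → SiblingsDiffer χ → ∀ x a →
          ⟪ has? χ x a ⟫ ≡ ∑ (allFin n) (λ w → ⟪ P w ≟ᴾ just x ⟫ * ⟪ lookup χ w ≟ a ⟫)
  ⟪has⟫ χ sib x a with has? χ x a
  ... | no ¬has = sym (trans (∑-cong (allFin n) (λ w → trans (sym (⟪⟫-× (P w ≟ᴾ just x) (lookup χ w ≟ a)))
                         (⟪⟫-no ((P w ≟ᴾ just x) ×-dec (lookup χ w ≟ a)) (λ { (Pw , χw) → ¬has (w , Pw , χw) }))))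
                         (∑-zero (allFin n)))
  ... | yes (w₀ , Pw₀ , χw₀) = sym (trans (∑-cong (allFin n) single) (allFin-enumerates n w₀ (λ _ → 1ℚ)))
    where
    unique : ∀ w → P w ≡ just x × lookup χ w ≡ a → w₀ ≡ w
    unique w (Pw , χw) with w₀ ≟ w
    ... | yes eq = eq
    ... | no neq = ⊥-elim (sib w₀ w x Pw₀ Pw neq (trans χw₀ (sym χw)))
    single : ∀ w → ⟪ P w ≟ᴾ just x ⟫ * ⟪ lookup χ w ≟ a ⟫ ≡ ⟪ w₀ ≟ w ⟫ * 1ℚ
    single w = trans (sym (⟪⟫-× (P w ≟ᴾ just x) (lookup χ w ≟ a)))
      (trans (⟪⟫-⇔ ((P w ≟ᴾ just x) ×-dec (lookup χ w ≟ a)) (w₀ ≟ w) (unique w) (λ { refl → Pw₀ , χw₀ }))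
             (sym (ℚₚ.*-identityʳ ⟪ w₀ ≟ w ⟫)))

  ∑-has : ∀ χ → SiblingsDiffer χ → ∀ x → ∑ (allFin κ) (λ a → ⟪ has? χ x a ⟫) ≡ ι (children P x)
  ∑-has χ sib x = begin
    ∑ (allFin κ) (λ a → ⟪ has? χ x a ⟫)
      ≡⟨ ∑-cong (allFin κ) (⟪has⟫ χ sib x) ⟩
    ∑ (allFin κ) (λ a → ∑ (allFin n) (λ w → ⟪ P w ≟ᴾ just x ⟫ * ⟪ lookup χ w ≟ a ⟫))
      ≡⟨ ∑-swap (allFin κ) (allFin n) _ ⟩
    ∑ (allFin n) (λ w → ∑ (allFin κ) (λ a → ⟪ P w ≟ᴾ just x ⟫ * ⟪ lookup χ w ≟ a ⟫))
      ≡⟨ ∑-cong (allFin n) (λ w → ∑-cong (allFin κ) (λ a → ℚₚ.*-comm ⟪ P w ≟ᴾ just x ⟫ ⟪ lookup χ w ≟ a ⟫)) ⟩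
    ∑ (allFin n) (λ w → ∑ (allFin κ) (λ a → ⟪ lookup χ w ≟ a ⟫ * ⟪ P w ≟ᴾ just x ⟫))
      ≡⟨ ∑-cong (allFin n) (λ w → allFin-enumerates κ (lookup χ w) (λ _ → ⟪ P w ≟ᴾ just x ⟫)) ⟩
    ∑ (allFin n) (λ w → ⟪ P w ≟ᴾ just x ⟫)
      ≡⟨ ι-children P x ⟨
    ι (children P x) ∎
    where open ≡-Reasoning

  -- Free and used colours partition the palette. `own` is what the parent edge adds to the colours
  -- of the children: one colour if it differs from theirs, nothing at a root or in a collision.
  length-avail : ∀ χ → SiblingsDiffer χ → ∀ x (own : Fin κ → ℚ) d → ∑ (allFin κ) own ≡ ι d →
    (∀ a → ⟪ used? ⟦ P , χ ⟧ x a ⟫ ≡ own a +ℚ ⟪ has? χ x a ⟫) →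
    length (avail ⟦ P , χ ⟧ x) + (d + children P x) ≡ κ
  length-avail χ sib x own d ∑own used≡ = ι-injective (begin
    ι (length A + (d + children P x))
      ≡⟨ ι-+ (length A) (d + children P x) ⟩
    ι (length A) +ℚ ι (d + children P x)
      ≡⟨ cong₂ _+ℚ_ (ι-length A) (ι-+ d (children P x)) ⟩
    ∑ A (λ _ → 1ℚ) +ℚ (ι d +ℚ ι (children P x))
      ≡⟨ cong₂ (λ s t → s +ℚ t) (trans (cong (λ as → ∑ as (λ _ → 1ℚ)) (avail≡filter ⟦ P , χ ⟧ x)) (∑-filter (λ a → ¬? (used? ⟦ P , χ ⟧ x a)) (allFin κ) (λ _ → 1ℚ)))
           (cong₂ _+ℚ_ (sym ∑own) (sym (∑-has χ sib x))) ⟩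
    ∑ (allFin κ) (λ a → ⟪ ¬? (used? ⟦ P , χ ⟧ x a) ⟫ * 1ℚ) +ℚ (∑ (allFin κ) own +ℚ ∑ (allFin κ) (λ a → ⟪ has? χ x a ⟫))
      ≡⟨ cong₂ _+ℚ_ (∑-cong (allFin κ) (λ a → ℚₚ.*-identityʳ ⟪ ¬? (used? ⟦ P , χ ⟧ x a) ⟫))
           (trans (sym (∑-+ (allFin κ) own (λ a → ⟪ has? χ x a ⟫))) (∑-cong (allFin κ) (sym ∘ used≡))) ⟩
    ∑ (allFin κ) (λ a → ⟪ ¬? (used? ⟦ P , χ ⟧ x a) ⟫) +ℚ ∑ (allFin κ) (λ a → ⟪ used? ⟦ P , χ ⟧ x a ⟫)
      ≡⟨ ∑-+ (allFin κ) (λ a → ⟪ ¬? (used? ⟦ P , χ ⟧ x a) ⟫) (λ a → ⟪ used? ⟦ P , χ ⟧ x a ⟫) ⟨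
    ∑ (allFin κ) (λ a → ⟪ ¬? (used? ⟦ P , χ ⟧ x a) ⟫ +ℚ ⟪ used? ⟦ P , χ ⟧ x a ⟫)
      ≡⟨ ∑-cong (allFin κ) (λ a → ⟪⟫-¬ (used? ⟦ P , χ ⟧ x a)) ⟩
    ∑ (allFin κ) (λ _ → 1ℚ)
      ≡⟨ ∑-const-allFin κ 1ℚ ⟩
    ι κ * 1ℚ
      ≡⟨ ℚₚ.*-identityʳ (ι κ) ⟩
    ι κ ∎)
    where
    open ≡-Reasoning
    A = avail ⟦ P , χ ⟧ x

  has⇒used : ∀ χ {x a} → Has χ x a → Used ⟦ P , χ ⟧ x a
  has⇒used χ (w , Pw , χw) = inj₂ (w , ⟦⟧⁺ P χ Pw χw)

  used⇒ : ∀ χ {x a} → Used ⟦ P , χ ⟧ x a → (∃ λ y → P x ≡ just y × lookup χ x ≡ a) ⊎ Has χ x a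
  used⇒ χ (inj₁ (y , eq)) = inj₁ (y , ⟦⟧⁻ P χ eq)
  used⇒ χ (inj₂ (w , eq)) = inj₂ (w , ⟦⟧⁻ P χ eq)

  length-avail-proper : ∀ χ → Proper χ → ∀ x → length (avail ⟦ P , χ ⟧ x) ≡ κ ∸ (parentEdges P x + children P x)
  length-avail-proper χ (sib , par) x = byParent (P x) refl
    where
    ofOther : ∀ {a} → ¬ (∃ λ y → P x ≡ just y × lookup χ x ≡ a) → Used ⟦ P , χ ⟧ x a → Has χ x a
    ofOther ¬own used with used⇒ χ used
    ... | inj₁ own = ⊥-elim (¬own own)
    ... | inj₂ has = has
    notOwn : ∀ {a} → ¬ (∃ λ y → P x ≡ just y × lookup χ x ≡ a) → ⟪ used? ⟦ P , χ ⟧ x a ⟫ ≡ 0ℚ +ℚ ⟪ has? χ x a ⟫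
    notOwn {a} ¬own = trans (⟪⟫-⇔ (used? ⟦ P , χ ⟧ x a) (has? χ x a) (ofOther ¬own) (has⇒used χ)) (sym (ℚₚ.+-identityˡ ⟪ has? χ x a ⟫))
    ∑own : ∑ (allFin κ) (λ a → ⟪ lookup χ x ≟ a ⟫) ≡ ι 1
    ∑own = trans (∑-cong (allFin κ) (λ a → sym (ℚₚ.*-identityʳ ⟪ lookup χ x ≟ a ⟫))) (allFin-enumerates κ (lookup χ x) (λ _ → 1ℚ))
    byParent : ∀ m → P x ≡ m → length (avail ⟦ P , χ ⟧ x) ≡ κ ∸ (maybe′ (λ _ → 1) 0 m + children P x)
    byParent nothing  Px = ∸-from-+ (length-avail χ sib x (λ _ → 0ℚ) 0 (∑-zero (allFin κ))
      (λ a → notOwn (λ { (y , Px′ , _) → just≢nothing Px′ Px })))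
    byParent (just y) Px = ∸-from-+ (length-avail χ sib x (λ a → ⟪ lookup χ x ≟ a ⟫) 1 ∑own used≡)
      where
      used≡ : ∀ a → ⟪ used? ⟦ P , χ ⟧ x a ⟫ ≡ ⟪ lookup χ x ≟ a ⟫ +ℚ ⟪ has? χ x a ⟫
      used≡ a = bySelf (lookup χ x ≟ a)
        where
        bySelf : (d : Dec (lookup χ x ≡ a)) → ⟪ used? ⟦ P , χ ⟧ x a ⟫ ≡ ⟪ d ⟫ +ℚ ⟪ has? χ x a ⟫
        bySelf (yes χx) = trans (⟪⟫-yes (used? ⟦ P , χ ⟧ x a) (inj₁ (y , ⟦⟧⁺ P χ Px χx)))
          (sym (cong (1ℚ +ℚ_) (⟪⟫-no (has? χ x a) (λ { (w , Pw , χw) → par w x y Pw Px (trans χw (sym χx)) }))))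
        bySelf (no χx≢) = notOwn (λ { (_ , _ , χx) → χx≢ χx })

  collision⇒has : ∀ χ x → Has χ x (lookup χ x) → ∀ {a} → Used ⟦ P , χ ⟧ x a → Has χ x a
  collision⇒has χ x collision used with used⇒ χ used
  ... | inj₁ (_ , _ , refl) = collision
  ... | inj₂ has            = has

  length-avail-collision : ∀ χ → SiblingsDiffer χ → ∀ x → Has χ x (lookup χ x) →
                           length (avail ⟦ P , χ ⟧ x) ≡ κ ∸ children P x
  length-avail-collision χ sib x collision = ∸-from-+ (length-avail χ sib x (λ _ → 0ℚ) 0 (∑-zero (allFin κ))
    (λ a → trans (⟪⟫-⇔ (used? ⟦ P , χ ⟧ x a) (has? χ x a) (collision⇒has χ x collision) (has⇒used χ)) (sym (ℚₚ.+-identityˡ ⟪ has? χ x a ⟫))))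

-- The effect of one insertion on sums over proper colourings, with `P′` in the role of `link P r p`

module Step {n κ : ℕ} {P P′ : Parents n} {p r : Fin n} (Pr : P r ≡ nothing)
            (P′r : P′ r ≡ just p) (P′≡P : ∀ {v} → v ≢ r → P′ v ≡ P v) (R′ : Rooted P′) where

  open Rooted R′
  open Chain {κ = κ} R′

  old⇒link : ∀ {u x} → P u ≡ just x → u ≢ r × P′ u ≡ just x
  old⇒link {u} Pu = u≢r , trans (P′≡P u≢r) Pu
    where
    u≢r : u ≢ r
    u≢r refl = just≢nothing Pu Pr

  link⇒old : ∀ {u x} → u ≢ r → P′ u ≡ just x → P u ≡ just x
  link⇒old u≢r = trans (sym (P′≡P u≢r))

  link-parent : ∀ {x} → P′ r ≡ just x → x ≡ p
  link-parent eq = Maybeₚ.just-injective (trans (sym eq) P′r)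

  p≢r : p ≢ r
  p≢r = deeper⇒≢ ℕₚ.≤-refl P′r

  -- Together with `fromExcept` this merges the choice of a proper χ and of a colour β free at p
  -- into a single vector. The choice of β ignores the children of r, hence the exception at r.
  toExcept : ∀ (χ : Vec (Fin κ) n) {β} → Proper P χ → ¬ Used ⟦ P , χ ⟧ p β → ProperExcept P′ r (χ [ r ]≔ β)
  toExcept χ {β} (sib , par) ¬used = sib′ , par′
    where
    other : ∀ {u} → u ≢ r → lookup (χ [ r ]≔ β) u ≡ lookup χ u
    other u≢r = lookup∘update′ u≢r χ β
    self : lookup (χ [ r ]≔ β) r ≡ β
    self = lookup∘update r χ β
    sib′ : SiblingsDiffer P′ (χ [ r ]≔ β)
    sib′ u u′ x Pu Pu′ u≢u′ e with u ≟ r | u′ ≟ r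
    ... | yes refl | yes refl = u≢u′ refl
    ... | yes refl | no u′≢r with refl ← link-parent Pu =
      ¬used (inj₂ (u′ , ⟦⟧⁺ P χ (link⇒old u′≢r Pu′) (trans (sym (other u′≢r)) (trans (sym e) self))))
    ... | no u≢r | yes refl with refl ← link-parent Pu′ =
      ¬used (inj₂ (u , ⟦⟧⁺ P χ (link⇒old u≢r Pu) (trans (sym (other u≢r)) (trans e self))))
    ... | no u≢r | no u′≢r = sib u u′ x (link⇒old u≢r Pu) (link⇒old u′≢r Pu′) u≢u′
      (trans (sym (other u≢r)) (trans e (other u′≢r)))
    par′ : ∀ u x y → x ≢ r → P′ u ≡ just x → P′ x ≡ just y → lookup (χ [ r ]≔ β) u ≢ lookup (χ [ r ]≔ β) x
    par′ u x y x≢r Pu Px e with u ≟ r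
    ... | yes refl with refl ← link-parent Pu =
      ¬used (inj₁ (y , ⟦⟧⁺ P χ (link⇒old x≢r Px) (trans (sym (other x≢r)) (trans (sym e) self))))
    ... | no u≢r = par u x y (link⇒old u≢r Pu) (link⇒old x≢r Px) (trans (sym (other u≢r)) (trans e (other x≢r)))

  fromExcept : ∀ (χ : Vec (Fin κ) n) {β} → ProperExcept P′ r (χ [ r ]≔ β) → Proper P χ × ¬ Used ⟦ P , χ ⟧ p β
  fromExcept χ {β} (sib′ , par′) = (sib , par) , ¬used
    where
    other : ∀ {u} → u ≢ r → lookup (χ [ r ]≔ β) u ≡ lookup χ u
    other u≢r = lookup∘update′ u≢r χ β
    self : lookup (χ [ r ]≔ β) r ≡ β
    self = lookup∘update r χ β
    sib : SiblingsDiffer P χ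
    sib u u′ x Pu Pu′ u≢u′ e =
      let u≢r , P′u = old⇒link Pu ; u′≢r , P′u′ = old⇒link Pu′
      in sib′ u u′ x P′u P′u′ u≢u′ (trans (other u≢r) (trans e (sym (other u′≢r))))
    par : ∀ u x y → P u ≡ just x → P x ≡ just y → lookup χ u ≢ lookup χ x
    par u x y Pu Px e =
      let u≢r , P′u = old⇒link Pu ; x≢r , P′x = old⇒link Px
      in par′ u x y x≢r P′u P′x (trans (other u≢r) (trans e (sym (other x≢r))))
    ¬used : ¬ Used ⟦ P , χ ⟧ p β
    ¬used used with used⇒ P χ used
    ... | inj₁ (y , Pp , χp) = par′ r p y p≢r P′r (proj₂ (old⇒link Pp)) (trans self (sym (trans (other p≢r) χp)))
    ... | inj₂ (w , Pw , χw) =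
      let w≢r , P′w = old⇒link Pw
      in sib′ r w p P′r P′w (w≢r ∘ sym) (trans self (sym (trans (other w≢r) χw)))

  proper⇒except : ∀ (ξ : Vec (Fin κ) n) → Proper P′ ξ → ProperExcept P′ r ξ
  proper⇒except ξ (sib , par) = sib , λ u x y _ → par u x y

  proper⇒¬has : ∀ (ξ : Vec (Fin κ) n) → Proper P′ ξ → ¬ Has P′ ξ r (lookup ξ r)
  proper⇒¬has ξ (sib , par) (w , Pw , ξw) = par w r p Pw P′r ξw

  except⇒proper : ∀ (ξ : Vec (Fin κ) n) → ProperExcept P′ r ξ → ¬ Has P′ ξ r (lookup ξ r) → Proper P′ ξ
  except⇒proper ξ (sib , par) ¬has = sib , par′
    where
    par′ : ∀ u x y → P′ u ≡ just x → P′ x ≡ just y → lookup ξ u ≢ lookup ξ x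
    par′ u x y Pu Px e with x ≟ r
    ... | yes refl = ¬has (u , Pu , e)
    ... | no x≢r   = par u x y x≢r Pu Px e

  ¬has⇒absent : ∀ (ξ : Vec (Fin κ) n) {v α} → ¬ Has P′ ξ v α → Absent P′ ξ v α
  ¬has⇒absent ξ ¬has u Pu ξu = ¬has (u , Pu , ξu)

  -- Roots have depth 0, while r has a parent and so positive depth. Vertices at least as deep as r
  -- thus carry real colours, to which properness applies.
  belowRoot⇒child : ∀ {x} → dep r ≤ dep x → ∃ λ y → P′ x ≡ just y
  belowRoot⇒child {x} r≤x with P′ x in P′x
  ... | just y  = y , refl
  ... | nothing = ⊥-elim (ℕₚ.1+n≰n (ℕₚ.≤-trans (ℕₚ.≤-reflexive (sym (dep-child P′r)))
                    (ℕₚ.≤-trans r≤x (ℕₚ.≤-trans (ℕₚ.≤-reflexive (dep-root P′x)) z≤n))))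

  record Exchanged (ξ : Vec (Fin κ) n) (α β : Fin κ) : Set where
    ξ′ : Vec (Fin κ) n
    ξ′ = recolor (suc n) P′ ξ r α β
    field
      proper  : ProperExcept P′ r ξ′
      ¬has    : ¬ Has P′ ξ′ r β
      same    : lookup ξ′ r ≡ lookup ξ r
      has     : Has P′ ξ r β → Has P′ ξ′ r α
      inverse : recolor (suc n) P′ ξ′ r β α ≡ ξ
      sameLen : len (suc n) P′ ξ′ r β α ≡ len (suc n) P′ ξ r α β

  -- With β = lookup ξ r this exchanges the colourings in which β collides at r and
  -- α is free with the proper colourings in which α occurs at a child of r.
  exchange : ∀ ξ α β → ProperExcept P′ r ξ → ¬ Has P′ ξ r α → Exchanged ξ α β
  exchange ξ α β (sib , par) ¬hasα = record
    { proper  = sib′ , par′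
    ; ¬has    = λ { (u , Pu , e) → proj₂ below u Pu e }
    ; same    = fixed ℕₚ.≤-refl
    ; has     = has′
    ; inverse = proj₁ inv′
    ; sameLen = proj₂ inv′
    }
    where
    ξ′ : Vec (Fin κ) n
    ξ′ = recolor (suc n) P′ ξ r α β
    fixed : ∀ {u} → dep u ≤ dep r → lookup ξ′ u ≡ lookup ξ u
    fixed = recolor-fixed (suc n) ξ r α β _
    below : ProperBelow r ξ′ × Absent P′ ξ′ r β
    below = recolor-proper (suc n) ξ r α β (ℕₚ.≤-trans (ℕₚ.n≤1+n n) (ℕₚ.m≤n+m (suc n) (dep r)))
      ((λ u u′ x _ → sib u u′ x) , (λ u x r≤x x≢r Pu → par u x _ x≢r Pu (proj₂ (belowRoot⇒child r≤x))))
      (¬has⇒absent ξ ¬hasα)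
    child≤ : ∀ {u x} → P′ u ≡ just x → ¬ (dep r ≤ dep x) → dep u ≤ dep r
    child≤ Pu r≰x = ℕₚ.≤-trans (ℕₚ.≤-reflexive (dep-child Pu)) (ℕₚ.≰⇒> r≰x)
    sib′ : SiblingsDiffer P′ ξ′
    sib′ u u′ x Pu Pu′ u≢u′ e with dep r ℕₚ.≤? dep x
    ... | yes r≤x = proj₁ (proj₁ below) u u′ x r≤x Pu Pu′ u≢u′ e
    ... | no r≰x  = sib u u′ x Pu Pu′ u≢u′ (trans (sym (fixed (child≤ Pu r≰x))) (trans e (fixed (child≤ Pu′ r≰x))))
    par′ : ∀ u x y → x ≢ r → P′ u ≡ just x → P′ x ≡ just y → lookup ξ′ u ≢ lookup ξ′ x
    par′ u x y x≢r Pu Px e with dep r ℕₚ.≤? dep x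
    ... | yes r≤x = proj₂ (proj₁ below) u x r≤x x≢r Pu e
    ... | no r≰x  = par u x y x≢r Pu Px (trans (sym (fixed (child≤ Pu r≰x))) (trans e (fixed (ℕₚ.<⇒≤ (ℕₚ.≰⇒> r≰x)))))
    has′ : Has P′ ξ r β → Has P′ ξ′ r α
    has′ (w , Pw , ξw) = byFind (find P′ ξ r β) refl
      where
      byFind : ∀ m → find P′ ξ r β ≡ m → Has P′ ξ′ r α
      byFind (just u) eq = u , recolor-present n ξ r α β eq
      byFind nothing  eq = ⊥-elim (find-nothing P′ ξ eq w Pw ξw)
    inv′ = recolor-inverse (suc n) ξ r α β (¬has⇒absent ξ ¬hasα)
      (λ u x r<x Pu → par u x _ (λ { refl → ℕₚ.1+n≰n r<x }) Pu (proj₂ (belowRoot⇒child (ℕₚ.<⇒≤ r<x))))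

  -- `μ` is the probability of each colour free at p. `i` is that of each new colour α in a
  -- collision, where the colour of r is also a colour of a child and does not count separately.
  μ i : ℚ
  μ = inv (κ ∸ (parentEdges P p + children P p))
  i = inv (κ ∸ children P′ r)

  Collides : Fin κ → Vec (Fin κ) n → Set
  Collides α ξ = ProperExcept P′ r ξ × Has P′ ξ r (lookup ξ r) × ¬ Has P′ ξ r α

  collides? : ∀ α ξ → Dec (Collides α ξ)
  collides? α ξ = properExcept? P′ r ξ ×-dec (has? P′ ξ r (lookup ξ r) ×-dec ¬? (has? P′ ξ r α))

  Resolved : Fin κ → Vec (Fin κ) n → Set
  Resolved α ξ = Proper P′ ξ × Has P′ ξ r α

  resolved? : ∀ α ξ → Dec (Resolved α ξ)
  resolved? α ξ = proper? P′ ξ ×-dec has? P′ ξ r α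

  module _ (g : Vec (Fin κ) n → ℕ → ℚ) where

    -- Change of variables along `exchange`. The chain leaves the colour of r unchanged, so the
    -- inverse can read β off r again, and it has the same length in both directions; the payoff
    -- thus depends on the resulting colouring alone.
    ∑-collides : ∀ α →
      ∑ (allVec n) (λ ξ → ⟪ collides? α ξ ⟫ * g (recolor (suc n) P′ ξ r α (lookup ξ r)) (len (suc n) P′ ξ r α (lookup ξ r)))
      ≡ ∑ (allVec n) (λ ξ → ⟪ resolved? α ξ ⟫ * g ξ (len (suc n) P′ ξ r (lookup ξ r) α))
    ∑-collides α = trans
      (∑-cong (allVec n) (λ ξ → ⟪⟫-*-cong (collides? α ξ) (λ { (except , _ , ¬hasα) →
        let open Exchanged (exchange ξ α (lookup ξ r) except ¬hasα)
        in cong (g ξ′) (trans (sym sameLen) (cong (λ β → len (suc n) P′ ξ′ r β α) (sym same))) })))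
      (∑-bijection _≟ⱽ_ {allVec n} (allVec-enumerates n) (collides? α) (resolved? α)
        (λ ξ → recolor (suc n) P′ ξ r α (lookup ξ r)) (λ ξ → recolor (suc n) P′ ξ r (lookup ξ r) α)
        (λ { ξ (except , collision , ¬hasα) →
          let open Exchanged (exchange ξ α (lookup ξ r) except ¬hasα)
          in (except⇒proper ξ′ proper (subst (λ β → ¬ Has P′ ξ′ r β) (sym same) ¬has) , has collision) ,
             trans (cong (λ β → recolor (suc n) P′ ξ′ r β α) same) inverse })
        (λ { ξ (prop , hasα) →
          let open Exchanged (exchange ξ (lookup ξ r) α (proper⇒except ξ prop) (proper⇒¬has ξ prop))
          in (proper , subst (Has P′ ξ′ r) (sym same) (has hasα) , ¬has) ,
             trans (cong (recolor (suc n) P′ ξ′ r α) same) inverse })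
        (λ ξ → g ξ (len (suc n) P′ ξ r (lookup ξ r) α)))

    -- If no child of r shares its colour, the colouring is already proper. Otherwise the colours
    -- free at r are exactly those absent from its children, which makes the sum over free α a sum
    -- over `Collides`.
    afterRoot-split : ∀ ξ → ⟪ properExcept? P′ r ξ ⟫ * afterRoot g P′ ξ r ≡
      ⟪ proper? P′ ξ ⟫ * g ξ 0 +ℚ
      i * ∑ (allFin κ) (λ α → ⟪ collides? α ξ ⟫ * g (recolor (suc n) P′ ξ r α (lookup ξ r)) (len (suc n) P′ ξ r α (lookup ξ r)))
    afterRoot-split ξ = byFind (find P′ ξ r (lookup ξ r)) refl
      where
      open ≡-Reasoning
      γ : Fin κ → ℚ
      γ α = g (recolor (suc n) P′ ξ r α (lookup ξ r)) (len (suc n) P′ ξ r α (lookup ξ r))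
      A = avail ⟦ P′ , ξ ⟧ r
      byFind : ∀ m → find P′ ξ r (lookup ξ r) ≡ m →
        ⟪ properExcept? P′ r ξ ⟫ * maybe′ (λ _ → inv (length A) * ∑ A γ) (g ξ 0) m ≡
        ⟪ proper? P′ ξ ⟫ * g ξ 0 +ℚ i * ∑ (allFin κ) (λ α → ⟪ collides? α ξ ⟫ * γ α)
      byFind nothing eq = begin
        ⟪ properExcept? P′ r ξ ⟫ * g ξ 0
          ≡⟨ cong (_* g ξ 0) (⟪⟫-⇔ (properExcept? P′ r ξ) (proper? P′ ξ) (λ except → except⇒proper ξ except ¬has) (proper⇒except ξ)) ⟩
        ⟪ proper? P′ ξ ⟫ * g ξ 0
          ≡⟨ ℚₚ.+-identityʳ (⟪ proper? P′ ξ ⟫ * g ξ 0) ⟨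
        ⟪ proper? P′ ξ ⟫ * g ξ 0 +ℚ 0ℚ
          ≡⟨ cong (⟪ proper? P′ ξ ⟫ * g ξ 0 +ℚ_) (trans (sym (ℚₚ.*-zeroʳ i)) (cong (i *_) (trans (sym (∑-zero (allFin κ)))
               (∑-cong (allFin κ) (λ α → sym (trans (cong (_* γ α) (⟪⟫-no (collides? α ξ) (λ c → ¬has (proj₁ (proj₂ c))))) (ℚₚ.*-zeroˡ (γ α)))))))) ⟩
        ⟪ proper? P′ ξ ⟫ * g ξ 0 +ℚ i * ∑ (allFin κ) (λ α → ⟪ collides? α ξ ⟫ * γ α) ∎
        where
        ¬has : ¬ Has P′ ξ r (lookup ξ r)
        ¬has (w , Pw , ξw) = find-nothing P′ ξ eq w Pw ξw
      byFind (just w) eq = begin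
        ⟪ properExcept? P′ r ξ ⟫ * (inv (length A) * ∑ A γ)
          ≡⟨ ⟪⟫-*-cong (properExcept? P′ r ξ) (λ except → cong₂ _*_
               (cong inv (length-avail-collision P′ ξ (proj₁ except) r collision))
               (trans (cong (λ as → ∑ as γ) (avail≡filter ⟦ P′ , ξ ⟧ r)) (∑-filter (λ α → ¬? (used? ⟦ P′ , ξ ⟧ r α)) (allFin κ) γ))) ⟩
        ⟪ properExcept? P′ r ξ ⟫ * (i * ∑ (allFin κ) (λ α → ⟪ ¬? (used? ⟦ P′ , ξ ⟧ r α) ⟫ * γ α))
          ≡⟨ solve 3 (λ a b c → a :* (b :* c) := b :* (a :* c)) refl ⟪ properExcept? P′ r ξ ⟫ i _ ⟩
        i * (⟪ properExcept? P′ r ξ ⟫ * ∑ (allFin κ) (λ α → ⟪ ¬? (used? ⟦ P′ , ξ ⟧ r α) ⟫ * γ α))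
          ≡⟨ cong (i *_) (trans (sym (∑-*ˡ (allFin κ) ⟪ properExcept? P′ r ξ ⟫ _)) (∑-cong (allFin κ) merge)) ⟩
        i * ∑ (allFin κ) (λ α → ⟪ collides? α ξ ⟫ * γ α)
          ≡⟨ ℚₚ.+-identityˡ _ ⟨
        0ℚ +ℚ i * ∑ (allFin κ) (λ α → ⟪ collides? α ξ ⟫ * γ α)
          ≡⟨ cong (_+ℚ i * ∑ (allFin κ) (λ α → ⟪ collides? α ξ ⟫ * γ α))
               (trans (cong (_* g ξ 0) (⟪⟫-no (proper? P′ ξ) (λ prop → proper⇒¬has ξ prop collision))) (ℚₚ.*-zeroˡ (g ξ 0))) ⟨
        ⟪ proper? P′ ξ ⟫ * g ξ 0 +ℚ i * ∑ (allFin κ) (λ α → ⟪ collides? α ξ ⟫ * γ α) ∎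
        where
        collision : Has P′ ξ r (lookup ξ r)
        collision = w , find-just P′ ξ eq
        merge : ∀ α → ⟪ properExcept? P′ r ξ ⟫ * (⟪ ¬? (used? ⟦ P′ , ξ ⟧ r α) ⟫ * γ α) ≡ ⟪ collides? α ξ ⟫ * γ α
        merge α = trans (sym (ℚₚ.*-assoc ⟪ properExcept? P′ r ξ ⟫ ⟪ ¬? (used? ⟦ P′ , ξ ⟧ r α) ⟫ (γ α)))
          (cong (_* γ α) (trans (sym (⟪⟫-× (properExcept? P′ r ξ) (¬? (used? ⟦ P′ , ξ ⟧ r α))))
            (⟪⟫-⇔ (properExcept? P′ r ξ ×-dec ¬? (used? ⟦ P′ , ξ ⟧ r α)) (collides? α ξ)
              (λ { (except , ¬used) → except , collision , ¬used ∘ has⇒used P′ ξ })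
              (λ { (except , _ , ¬hasα) → except , ¬hasα ∘ collision⇒has P′ ξ r collision }))))

    insertion : Vec (Fin κ) n → ℚ
    insertion χ = inv (length (avail ⟦ P , χ ⟧ p)) * ∑ (avail ⟦ P , χ ⟧ p) (λ β → afterRoot g P′ (χ [ r ]≔ β) r)

    insertion-split : ∀ χ → ⟪ proper? P χ ⟫ * insertion χ ≡
      μ * ∑ (allFin κ) (λ β → ⟪ properExcept? P′ r (χ [ r ]≔ β) ⟫ * afterRoot g P′ (χ [ r ]≔ β) r)
    insertion-split χ = begin
      ⟪ proper? P χ ⟫ * insertion χ
        ≡⟨ ⟪⟫-*-cong (proper? P χ) (λ prop → cong₂ _*_ (cong inv (length-avail-proper P χ prop p))
             (trans (cong (λ as → ∑ as γ) (avail≡filter ⟦ P , χ ⟧ p)) (∑-filter (λ β → ¬? (used? ⟦ P , χ ⟧ p β)) (allFin κ) γ))) ⟩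
      ⟪ proper? P χ ⟫ * (μ * ∑ (allFin κ) (λ β → ⟪ ¬? (used? ⟦ P , χ ⟧ p β) ⟫ * γ β))
        ≡⟨ solve 3 (λ a b c → a :* (b :* c) := b :* (a :* c)) refl ⟪ proper? P χ ⟫ μ _ ⟩
      μ * (⟪ proper? P χ ⟫ * ∑ (allFin κ) (λ β → ⟪ ¬? (used? ⟦ P , χ ⟧ p β) ⟫ * γ β))
        ≡⟨ cong (μ *_) (trans (sym (∑-*ˡ (allFin κ) ⟪ proper? P χ ⟫ _)) (∑-cong (allFin κ) merge)) ⟩
      μ * ∑ (allFin κ) (λ β → ⟪ properExcept? P′ r (χ [ r ]≔ β) ⟫ * γ β) ∎
      where
      open ≡-Reasoning
      γ : Fin κ → ℚ
      γ β = afterRoot g P′ (χ [ r ]≔ β) r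
      merge : ∀ β → ⟪ proper? P χ ⟫ * (⟪ ¬? (used? ⟦ P , χ ⟧ p β) ⟫ * γ β) ≡ ⟪ properExcept? P′ r (χ [ r ]≔ β) ⟫ * γ β
      merge β = trans (sym (ℚₚ.*-assoc ⟪ proper? P χ ⟫ ⟪ ¬? (used? ⟦ P , χ ⟧ p β) ⟫ (γ β)))
        (cong (_* γ β) (trans (sym (⟪⟫-× (proper? P χ) (¬? (used? ⟦ P , χ ⟧ p β))))
          (⟪⟫-⇔ (proper? P χ ×-dec ¬? (used? ⟦ P , χ ⟧ p β)) (properExcept? P′ r (χ [ r ]≔ β))
            (λ { (prop , ¬used) → toExcept χ prop ¬used }) (fromExcept χ))))

    -- The algorithm read backwards: a proper ξ of the new forest comes from no collision, or from
    -- one resolved with a colour α that is now at a child of r. For g constant 1 the last factor is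
    -- the same for all proper ξ, which is the invariance of the uniform distribution.
    ∑-insertion : ∑ (allVec n) (λ χ → ⟪ proper? P χ ⟫ * insertion χ) ≡
      μ * (ι κ * ∑ (allVec n) (λ ξ → ⟪ proper? P′ ξ ⟫ *
        (g ξ 0 +ℚ i * ∑ (allFin κ) (λ α → ⟪ has? P′ ξ r α ⟫ * g ξ (len (suc n) P′ ξ r (lookup ξ r) α)))))
    ∑-insertion = begin
      ∑ V (λ χ → ⟪ proper? P χ ⟫ * insertion χ)
        ≡⟨ ∑-cong V insertion-split ⟩
      ∑ V (λ χ → μ * ∑ C (λ β → f (χ [ r ]≔ β)))
        ≡⟨ trans (∑-*ˡ V μ _) (cong (μ *_) (∑-update r f)) ⟩
      μ * (ι κ * ∑ V f)
        ≡⟨ cong (λ s → μ * (ι κ * s)) split ⟩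
      μ * (ι κ * ∑ V (λ ξ → ⟪ proper? P′ ξ ⟫ * (g ξ 0 +ℚ i * ∑ C (λ α → ⟪ has? P′ ξ r α ⟫ * h ξ α)))) ∎
      where
      open ≡-Reasoning
      V = allVec {κ} n
      C = allFin κ
      f : Vec (Fin κ) n → ℚ
      f ξ = ⟪ properExcept? P′ r ξ ⟫ * afterRoot g P′ ξ r
      h : Vec (Fin κ) n → Fin κ → ℚ
      h ξ α = g ξ (len (suc n) P′ ξ r (lookup ξ r) α)
      γ : Vec (Fin κ) n → Fin κ → ℚ
      γ ξ α = g (recolor (suc n) P′ ξ r α (lookup ξ r)) (len (suc n) P′ ξ r α (lookup ξ r))
      exch : ∑ V (λ ξ → ∑ C (λ α → ⟪ collides? α ξ ⟫ * γ ξ α)) ≡ ∑ V (λ ξ → ∑ C (λ α → ⟪ resolved? α ξ ⟫ * h ξ α))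
      exch = trans (∑-swap V C _) (trans (∑-cong C ∑-collides) (sym (∑-swap V C _)))
      factor : ∀ ξ → ⟪ proper? P′ ξ ⟫ * g ξ 0 +ℚ i * ∑ C (λ α → ⟪ resolved? α ξ ⟫ * h ξ α) ≡
                     ⟪ proper? P′ ξ ⟫ * (g ξ 0 +ℚ i * ∑ C (λ α → ⟪ has? P′ ξ r α ⟫ * h ξ α))
      factor ξ = trans
        (cong (λ s → ⟪ proper? P′ ξ ⟫ * g ξ 0 +ℚ i * s) (trans
          (∑-cong C (λ α → trans (cong (_* h ξ α) (⟪⟫-× (proper? P′ ξ) (has? P′ ξ r α))) (ℚₚ.*-assoc ⟪ proper? P′ ξ ⟫ _ _)))
          (∑-*ˡ C ⟪ proper? P′ ξ ⟫ _)))
        (solve 4 (λ a b c d → a :* b :+ c :* (a :* d) := a :* (b :+ c :* d)) refl ⟪ proper? P′ ξ ⟫ (g ξ 0) i _)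
      split : ∑ V f ≡ ∑ V (λ ξ → ⟪ proper? P′ ξ ⟫ * (g ξ 0 +ℚ i * ∑ C (λ α → ⟪ has? P′ ξ r α ⟫ * h ξ α)))
      split = begin
        ∑ V f
          ≡⟨ ∑-cong V afterRoot-split ⟩
        ∑ V (λ ξ → ⟪ proper? P′ ξ ⟫ * g ξ 0 +ℚ i * ∑ C (λ α → ⟪ collides? α ξ ⟫ * γ ξ α))
          ≡⟨ trans (∑-+ V _ _) (cong (∑ V (λ ξ → ⟪ proper? P′ ξ ⟫ * g ξ 0) +ℚ_) (trans (∑-*ˡ V i _) (cong (i *_) exch))) ⟩
        ∑ V (λ ξ → ⟪ proper? P′ ξ ⟫ * g ξ 0) +ℚ i * ∑ V (λ ξ → ∑ C (λ α → ⟪ resolved? α ξ ⟫ * h ξ α))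
          ≡⟨ trans (∑-+ V _ _) (cong (∑ V (λ ξ → ⟪ proper? P′ ξ ⟫ * g ξ 0) +ℚ_) (∑-*ˡ V i _)) ⟨
        ∑ V (λ ξ → ⟪ proper? P′ ξ ⟫ * g ξ 0 +ℚ i * ∑ C (λ α → ⟪ resolved? α ξ ⟫ * h ξ α))
          ≡⟨ ∑-cong V factor ⟩
        ∑ V (λ ξ → ⟪ proper? P′ ξ ⟫ * (g ξ 0 +ℚ i * ∑ C (λ α → ⟪ has? P′ ξ r α ⟫ * h ξ α))) ∎

-- The mean chain length

module _ {κ : ℕ} (a b : Fin κ) where

  swap : Fin κ → Fin κ
  swap c = if ⌊ c ≟ a ⌋ then b else if ⌊ c ≟ b ⌋ then a else c

  swap-left : swap a ≡ b
  swap-left with a ≟ a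
  ... | yes _  = refl
  ... | no a≢a = ⊥-elim (a≢a refl)

  swap-right : swap b ≡ a
  swap-right with b ≟ a
  ... | yes b≡a = b≡a
  ... | no _ with b ≟ b
  ...   | yes _  = refl
  ...   | no b≢b = ⊥-elim (b≢b refl)

  swap-other : ∀ {c} → c ≢ a → c ≢ b → swap c ≡ c
  swap-other {c} c≢a c≢b with c ≟ a
  ... | yes c≡a = ⊥-elim (c≢a c≡a)
  ... | no _ with c ≟ b
  ...   | yes c≡b = ⊥-elim (c≢b c≡b)
  ...   | no _    = refl

  swap-involutive : ∀ c → swap (swap c) ≡ c
  swap-involutive c = byCases (c ≟ a) (c ≟ b)
    where
    byCases : Dec (c ≡ a) → Dec (c ≡ b) → swap (swap c) ≡ c
    byCases (yes refl) _          = trans (cong swap swap-left) swap-right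
    byCases (no _)     (yes refl) = trans (cong swap swap-right) swap-left
    byCases (no c≢a)   (no c≢b)   = trans (cong swap (swap-other c≢a c≢b)) (swap-other c≢a c≢b)

  swap-injective : ∀ {c d} → swap c ≡ swap d → c ≡ d
  swap-injective {c} {d} eq = trans (sym (swap-involutive c)) (trans (cong swap eq) (swap-involutive d))

module Subtree {n : ℕ} {P : Parents n} (R : Rooted P) (u : Fin n) where
  open Rooted R

  -- Decides whether x lies strictly below u by climbing from x. With the depth of x as fuel,
  -- membership of a child unfolds exactly to that of its parent.
  below : ℕ → Fin n → Bool
  below zero    x = false
  below (suc k) x = maybe′ (λ y → ⌊ y ≟ u ⌋ ∨ below k y) false (P x)

  isBelow : Fin n → Bool
  isBelow x = below (dep x) x

  isBelow-child : ∀ {x y} → P x ≡ just y → isBelow x ≡ (⌊ y ≟ u ⌋ ∨ isBelow y)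
  isBelow-child Px rewrite dep-child Px | Px = refl

  isBelow-child-of : ∀ {x} → P x ≡ just u → isBelow x ≡ true
  isBelow-child-of Px rewrite isBelow-child Px with u ≟ u
  ... | yes _  = refl
  ... | no u≢u = ⊥-elim (u≢u refl)

  isBelow-child-other : ∀ {x y} → P x ≡ just y → y ≢ u → isBelow x ≡ isBelow y
  isBelow-child-other {y = y} Px y≢u rewrite isBelow-child Px with y ≟ u
  ... | yes y≡u = ⊥-elim (y≢u y≡u)
  ... | no _    = refl

  below⇒deeper : ∀ k x → dep x ≡ k → below k x ≡ true → dep u ℕ.< dep x
  below⇒deeper (suc k) x dx eq with P x in Px
  ... | just y with y ≟ u
  ...   | yes refl = ℕₚ.≤-reflexive (sym (dep-child Px))
  ...   | no _     = ℕₚ.≤-trans (below⇒deeper k y (ℕₚ.suc-injective (trans (sym (dep-child Px)) dx)) eq)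
                       (ℕₚ.≤-trans (ℕₚ.n≤1+n _) (ℕₚ.≤-reflexive (sym (dep-child Px))))

  ¬isBelow : ∀ {x} → dep x ≤ dep u → isBelow x ≡ false
  ¬isBelow {x} x≤u with isBelow x in eq
  ... | false = refl
  ... | true  = ⊥-elim (ℕₚ.<⇒≱ (below⇒deeper (dep x) x refl eq) x≤u)

-- Transposing two colours strictly below a vertex

module SwapBelow {n κ : ℕ} {P : Parents n} (R : Rooted P) {u v y : Fin n}
                 (Pu : P u ≡ just v) (Pv : P v ≡ just y) (γ : Fin κ) where
  open Rooted R
  open Subtree R u

  recolored : Vec (Fin κ) n → Fin n → Bool → Fin κ
  recolored χ x b = if b then swap (lookup χ v) γ (lookup χ x) else lookup χ x

  swapBelow : Vec (Fin κ) n → Vec (Fin κ) n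
  swapBelow χ = tabulate (λ x → recolored χ x (isBelow x))

  inside : ∀ χ {x} → isBelow x ≡ true → lookup (swapBelow χ) x ≡ swap (lookup χ v) γ (lookup χ x)
  inside χ {x} eq = trans (lookup∘tabulate _ x) (cong (recolored χ x) eq)

  outside : ∀ χ {x} → isBelow x ≡ false → lookup (swapBelow χ) x ≡ lookup χ x
  outside χ {x} eq = trans (lookup∘tabulate _ x) (cong (recolored χ x) eq)

  u-outside : isBelow u ≡ false
  u-outside = ¬isBelow ℕₚ.≤-refl

  v-outside : isBelow v ≡ false
  v-outside = ¬isBelow (ℕₚ.≤-trans (ℕₚ.n≤1+n _) (ℕₚ.≤-reflexive (sym (dep-child Pu))))

  -- The transposition depends on the colour of v, and v lies outside the swapped region, so the
  -- second swap uses the same transposition.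
  swapBelow-involutive : ∀ χ → swapBelow (swapBelow χ) ≡ χ
  swapBelow-involutive χ = trans (tabulate-cong pointwise) (tabulate∘lookup χ)
    where
    pointwise : ∀ x → recolored (swapBelow χ) x (isBelow x) ≡ lookup χ x
    pointwise x with isBelow x in eq
    ... | true  = trans (cong₂ (λ c d → swap c γ d) (outside χ v-outside) (inside χ eq)) (swap-involutive (lookup χ v) γ (lookup χ x))
    ... | false = outside χ eq

  -- Swapped and unswapped colours meet only between u and its children. There the colour of u is a
  -- fixed point of the transposition: it differs from γ by assumption and from the colour of v
  -- because v is not a root.
  swapBelow-proper : ∀ χ → Proper P χ → γ ≢ lookup χ u → Proper P (swapBelow χ)
  swapBelow-proper χ (sib , par) γ≢u = sib′ , par′
    where
    π : Fin κ → Fin κ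
    π = swap (lookup χ v) γ
    differ : ∀ {s t} → isBelow s ≡ isBelow t → lookup χ s ≢ lookup χ t → lookup (swapBelow χ) s ≢ lookup (swapBelow χ) t
    differ {s} {t} s~t s≢t e = byCase (isBelow t) refl
      where
      byCase : ∀ b → isBelow t ≡ b → ⊥
      byCase true  eq = s≢t (swap-injective (lookup χ v) γ (trans (sym (inside χ (trans s~t eq))) (trans e (inside χ eq))))
      byCase false eq = s≢t (trans (sym (outside χ (trans s~t eq))) (trans e (outside χ eq)))
    sib′ : SiblingsDiffer P (swapBelow χ)
    sib′ s t x Ps Pt s≢t = differ (trans (isBelow-child Ps) (sym (isBelow-child Pt))) (sib s t x Ps Pt s≢t)
    par′ : ∀ s x z → P s ≡ just x → P x ≡ just z → lookup (swapBelow χ) s ≢ lookup (swapBelow χ) x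
    par′ s x z Ps Px e with x ≟ u
    ... | no x≢u   = differ (isBelow-child-other Ps x≢u) (par s x z Ps Px) e
    ... | yes refl = par s u z Ps Px (swap-injective (lookup χ v) γ (begin
      π (lookup χ s)            ≡⟨ inside χ (isBelow-child-of Ps) ⟨
      lookup (swapBelow χ) s    ≡⟨ e ⟩
      lookup (swapBelow χ) u    ≡⟨ outside χ u-outside ⟩
      lookup χ u                ≡⟨ swap-other (lookup χ v) γ (par u v y Pu Pv) (γ≢u ∘ sym) ⟨
      π (lookup χ u)            ∎))
      where open ≡-Reasoning

  child-inside : ∀ {z w} → z ≡ u ⊎ isBelow z ≡ true → P w ≡ just z → isBelow w ≡ true
  child-inside {z} z∈ Pw with z ≟ u
  child-inside z∈        Pw | yes refl = isBelow-child-of Pw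
  child-inside (inj₁ z≡u) Pw | no z≢u  = ⊥-elim (z≢u z≡u)
  child-inside (inj₂ z↓)  Pw | no z≢u  = trans (isBelow-child-other Pw z≢u) z↓

  find-swapBelow : ∀ χ z β → z ≡ u ⊎ isBelow z ≡ true →
    find P (swapBelow χ) z (swap (lookup χ v) γ β) ≡ find P χ z β
  find-swapBelow χ z β z∈ = find-⇔ P (swapBelow χ) χ
    (λ w Pw e → swap-injective (lookup χ v) γ (trans (sym (inside χ (child-inside z∈ Pw))) e))
    (λ w Pw e → trans (inside χ (child-inside z∈ Pw)) (cong (swap (lookup χ v) γ) e))

  -- A chain started at or below u reads only colours strictly below u, and these are all permuted
  -- alike.
  len-swapBelow : ∀ χ k z α β → z ≡ u ⊎ isBelow z ≡ true →
    len k P (swapBelow χ) z (swap (lookup χ v) γ α) (swap (lookup χ v) γ β) ≡ len k P χ z α β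
  len-swapBelow χ zero    z α β z∈ = refl
  len-swapBelow χ (suc k) z α β z∈ rewrite find-swapBelow χ z β z∈ with find P χ z β in eq
  ... | nothing = refl
  ... | just w  = cong suc (len-swapBelow χ k w β α (inj₂ (child-inside z∈ (proj₁ (find-just P χ eq)))))

  -- On colourings in which u is not coloured γ, the swap is an involution that turns continuing
  -- from u with the colour of v into continuing with γ.
  ∑-swapBelow : ∀ k →
    ∑ (allVec n) (λ χ → ⟪ proper? P χ ×-dec ¬? (lookup χ u ≟ γ) ⟫ * ι (len k P χ u (lookup χ u) (lookup χ v))) ≡
    ∑ (allVec n) (λ χ → ⟪ proper? P χ ×-dec ¬? (lookup χ u ≟ γ) ⟫ * ι (len k P χ u (lookup χ u) γ))
  ∑-swapBelow k = trans
    (∑-cong (allVec n) (λ χ → ⟪⟫-*-cong (allowed? χ) (λ c → cong ι (sym (len≡ χ c)))))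
    (∑-bijection _≟ⱽ_ {allVec n} (allVec-enumerates n) allowed? allowed? swapBelow swapBelow swapped swapped
      (λ χ → ι (len k P χ u (lookup χ u) γ)))
    where
    Allowed : Vec (Fin κ) n → Set
    Allowed χ = Proper P χ × ¬ (lookup χ u ≡ γ)
    allowed? : ∀ χ → Dec (Allowed χ)
    allowed? χ = proper? P χ ×-dec ¬? (lookup χ u ≟ γ)
    swapped : ∀ χ → Allowed χ → Allowed (swapBelow χ) × swapBelow (swapBelow χ) ≡ χ
    swapped χ (prop , u≢γ) =
      (swapBelow-proper χ prop (u≢γ ∘ sym) , u≢γ ∘ trans (sym (outside χ u-outside))) , swapBelow-involutive χ
    len≡ : ∀ χ → Allowed χ → len k P (swapBelow χ) u (lookup (swapBelow χ) u) γ ≡ len k P χ u (lookup χ u) (lookup χ v)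
    len≡ χ (prop , u≢γ) = trans
      (cong₂ (len k P (swapBelow χ) u)
        (trans (outside χ u-outside) (sym (swap-other (lookup χ v) γ (proj₂ prop u v y Pu Pv) u≢γ)))
        (sym (swap-left (lookup χ v) γ)))
      (len-swapBelow χ k u (lookup χ u) (lookup χ v) (inj₁ refl))

module _ {n : ℕ} (P : Parents n) where

  -- The sum of 2^(1 − d) over the descendants at distance 1 ≤ d ≤ k.
  load : ℕ → Fin n → ℚ
  load zero    v = 0ℚ
  load (suc k) v = ∑ (allFin n) (λ u → ⟪ P u ≟ᴾ just v ⟫ * (1ℚ +ℚ ½ * load k u))

  load-nonneg : ∀ k v → 0ℚ ≤ℚ load k v
  load-nonneg zero    v = ℚₚ.≤-refl
  load-nonneg (suc k) v = ∑-nonneg (allFin n) (λ u → *-nonneg (⟪⟫-nonneg (P u ≟ᴾ just v))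
    (+-nonneg (ℚₚ.nonNegative⁻¹ 1ℚ) (*-nonneg (ℚₚ.nonNegative⁻¹ ½) (load-nonneg k u))))

-- Halving the mean at each level of the tree

module MeanLength {n κ : ℕ} (3≤κ : 3 ≤ κ) {P : Parents n} (R : Rooted P) where

  V : List (Vec (Fin κ) n)
  V = allVec n

  C : List (Fin κ)
  C = allFin κ

  totalLen : ℕ → Fin n → Vec (Fin κ) n → ℚ
  totalLen k v χ = ∑ C (λ γ → ι (len k P χ v (lookup χ v) γ))

  -- Summing over all children coloured γ, instead of naming the one found, lets the later sum over
  -- γ collapse to one term per child.
  len-≤ : ∀ k (χ : Vec (Fin κ) n) v α γ → ι (len (suc k) P χ v α γ) ≤ℚ
          ∑ (allFin n) (λ u → ⟪ P u ≟ᴾ just v ⟫ * (⟪ lookup χ u ≟ γ ⟫ * (1ℚ +ℚ ι (len k P χ u γ α))))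
  len-≤ k χ v α γ with find P χ v γ in eq
  ... | nothing = ∑-nonneg (allFin n) 0≤term
    where
    0≤term : ∀ u → 0ℚ ≤ℚ ⟪ P u ≟ᴾ just v ⟫ * (⟪ lookup χ u ≟ γ ⟫ * (1ℚ +ℚ ι (len k P χ u γ α)))
    0≤term u = *-nonneg (⟪⟫-nonneg (P u ≟ᴾ just v)) (*-nonneg (⟪⟫-nonneg (lookup χ u ≟ γ))
      (+-nonneg (ℚₚ.nonNegative⁻¹ 1ℚ) (ι-nonneg (len k P χ u γ α))))
  ... | just w = subst (_≤ℚ ∑ (allFin n) term) (sym term≡) (enumerates-≤ _≟_ {allFin n} (allFin-enumerates n) w term 0≤term)
    where
    term : Fin n → ℚ
    term u = ⟪ P u ≟ᴾ just v ⟫ * (⟪ lookup χ u ≟ γ ⟫ * (1ℚ +ℚ ι (len k P χ u γ α)))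
    0≤term : ∀ u → 0ℚ ≤ℚ term u
    0≤term u = *-nonneg (⟪⟫-nonneg (P u ≟ᴾ just v)) (*-nonneg (⟪⟫-nonneg (lookup χ u ≟ γ))
      (+-nonneg (ℚₚ.nonNegative⁻¹ 1ℚ) (ι-nonneg (len k P χ u γ α))))
    term≡ : ι (suc (len k P χ w γ α)) ≡ term w
    term≡ = trans (ι-+ 1 (len k P χ w γ α)) (sym (trans
      (cong₂ (λ a b → a * (b * (1ℚ +ℚ ι (len k P χ w γ α))))
        (⟪⟫-yes (P w ≟ᴾ just v) (proj₁ (find-just P χ eq))) (⟪⟫-yes (lookup χ w ≟ γ) (proj₂ (find-just P χ eq))))
      (trans (ℚₚ.*-identityˡ _) (ℚₚ.*-identityˡ _))))

  totalLen-≤ : ∀ k v χ → totalLen (suc k) v χ ≤ℚ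
    ∑ (allFin n) (λ u → ⟪ P u ≟ᴾ just v ⟫ * (1ℚ +ℚ ι (len k P χ u (lookup χ u) (lookup χ v))))
  totalLen-≤ k v χ = begin
    totalLen (suc k) v χ
      ≤⟨ ∑-mono C (λ γ → len-≤ k χ v (lookup χ v) γ) ⟩
    ∑ C (λ γ → ∑ (allFin n) (λ u → ⟪ P u ≟ᴾ just v ⟫ * (⟪ lookup χ u ≟ γ ⟫ * (1ℚ +ℚ ι (len k P χ u γ (lookup χ v))))))
      ≡⟨ ∑-swap C (allFin n) _ ⟩
    ∑ (allFin n) (λ u → ∑ C (λ γ → ⟪ P u ≟ᴾ just v ⟫ * (⟪ lookup χ u ≟ γ ⟫ * (1ℚ +ℚ ι (len k P χ u γ (lookup χ v))))))
      ≡⟨ ∑-cong (allFin n) (λ u → trans (∑-*ˡ C ⟪ P u ≟ᴾ just v ⟫ _) (cong (⟪ P u ≟ᴾ just v ⟫ *_)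
           (allFin-enumerates κ (lookup χ u) (λ γ → 1ℚ +ℚ ι (len k P χ u γ (lookup χ v)))))) ⟩
    ∑ (allFin n) (λ u → ⟪ P u ≟ᴾ just v ⟫ * (1ℚ +ℚ ι (len k P χ u (lookup χ u) (lookup χ v)))) ∎
    where open ℚₚ.≤-Reasoning

  -- The origin of the factor ½: `3 ≤ κ` leaves at least two colours besides c.
  two-others : ∀ c → ι 2 ≤ℚ ∑ C (λ γ → ⟪ ¬? (c ≟ γ) ⟫)
  two-others c = subst₂ _≤ℚ_ (minus (ι 2)) (minus others) (ℚₚ.+-monoˡ-≤ (ℚ.- 1ℚ) (begin
    ι 2 +ℚ 1ℚ     ≡⟨ ι-+ 2 1 ⟨
    ι 3           ≤⟨ ι-mono 3≤κ ⟩
    ι κ           ≡⟨ trans (sym (ℚₚ.*-identityʳ (ι κ))) (sym (∑-const-allFin κ 1ℚ)) ⟩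
    ∑ C (λ _ → 1ℚ)  ≡⟨ ∑-cong C (λ γ → sym (⟪⟫-¬ (c ≟ γ))) ⟩
    ∑ C (λ γ → ⟪ ¬? (c ≟ γ) ⟫ +ℚ ⟪ c ≟ γ ⟫)  ≡⟨ ∑-+ C (λ γ → ⟪ ¬? (c ≟ γ) ⟫) (λ γ → ⟪ c ≟ γ ⟫) ⟩
    others +ℚ ∑ C (λ γ → ⟪ c ≟ γ ⟫)          ≡⟨ cong (others +ℚ_) (trans (∑-cong C (λ γ → sym (ℚₚ.*-identityʳ ⟪ c ≟ γ ⟫))) (allFin-enumerates κ c (λ _ → 1ℚ))) ⟩
    others +ℚ 1ℚ  ∎))
    where
    open ℚₚ.≤-Reasoning
    others = ∑ C (λ γ → ⟪ ¬? (c ≟ γ) ⟫)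
    minus : ∀ x → (x +ℚ 1ℚ) +ℚ ℚ.- 1ℚ ≡ x
    minus x = trans (ℚₚ.+-assoc x 1ℚ (ℚ.- 1ℚ)) (ℚₚ.+-identityʳ x)

  -- The chain entering u may continue with any of the κ − 1 ≥ 2 colours other than
  -- that of u, all equally likely by symmetry.
  ∑-len-≤-half : ∀ k {u v y} → P u ≡ just v → P v ≡ just y →
    ∑ V (λ χ → ⟪ proper? P χ ⟫ * ι (len k P χ u (lookup χ u) (lookup χ v))) ≤ℚ
    ½ * ∑ V (λ χ → ⟪ proper? P χ ⟫ * totalLen k u χ)
  ∑-len-≤-half k {u} {v} {y} Pu Pv = begin
    ∑ V (λ χ → ⟪ proper? P χ ⟫ * L χ)
      ≡⟨ halve _ ⟩
    ½ * (ι 2 * ∑ V (λ χ → ⟪ proper? P χ ⟫ * L χ))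
      ≤⟨ *-monoˡ-≤ (ℚₚ.nonNegative⁻¹ ½) bound ⟩
    ½ * ∑ V (λ χ → ⟪ proper? P χ ⟫ * totalLen k u χ) ∎
    where
    open ℚₚ.≤-Reasoning
    L : Vec (Fin κ) n → ℚ
    L χ = ι (len k P χ u (lookup χ u) (lookup χ v))
    halve : ∀ x → x ≡ ½ * (ι 2 * x)
    halve x = trans (sym (ℚₚ.*-identityˡ x)) (ℚₚ.*-assoc ½ (ι 2) x)
    drop : ∀ χ γ → ⟪ proper? P χ ×-dec ¬? (lookup χ u ≟ γ) ⟫ * ι (len k P χ u (lookup χ u) γ)
                   ≤ℚ ⟪ proper? P χ ⟫ * ι (len k P χ u (lookup χ u) γ)
    drop χ γ = *-monoʳ-≤ (ι-nonneg (len k P χ u (lookup χ u) γ))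
      (⟪⟫-mono (proper? P χ ×-dec ¬? (lookup χ u ≟ γ)) (proper? P χ) proj₁)
    spread : ∀ χ → ι 2 * (⟪ proper? P χ ⟫ * L χ) ≤ℚ ∑ C (λ γ → ⟪ proper? P χ ×-dec ¬? (lookup χ u ≟ γ) ⟫ * L χ)
    spread χ = begin
      ι 2 * (⟪ proper? P χ ⟫ * L χ)
        ≤⟨ *-monoʳ-≤ (*-nonneg (⟪⟫-nonneg (proper? P χ)) (ι-nonneg (len k P χ u (lookup χ u) (lookup χ v)))) (two-others (lookup χ u)) ⟩
      ∑ C (λ γ → ⟪ ¬? (lookup χ u ≟ γ) ⟫) * (⟪ proper? P χ ⟫ * L χ)
        ≡⟨ ∑-*ʳ C (⟪ proper? P χ ⟫ * L χ) (λ γ → ⟪ ¬? (lookup χ u ≟ γ) ⟫) ⟨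
      ∑ C (λ γ → ⟪ ¬? (lookup χ u ≟ γ) ⟫ * (⟪ proper? P χ ⟫ * L χ))
        ≡⟨ ∑-cong C (λ γ → trans (solve 3 (λ a b c → a :* (b :* c) := (b :* a) :* c) refl ⟪ ¬? (lookup χ u ≟ γ) ⟫ ⟪ proper? P χ ⟫ (L χ))
             (cong (_* L χ) (sym (⟪⟫-× (proper? P χ) (¬? (lookup χ u ≟ γ)))))) ⟩
      ∑ C (λ γ → ⟪ proper? P χ ×-dec ¬? (lookup χ u ≟ γ) ⟫ * L χ) ∎
    bound : ι 2 * ∑ V (λ χ → ⟪ proper? P χ ⟫ * L χ) ≤ℚ ∑ V (λ χ → ⟪ proper? P χ ⟫ * totalLen k u χ)
    bound = begin
      ι 2 * ∑ V (λ χ → ⟪ proper? P χ ⟫ * L χ)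
        ≡⟨ ∑-*ˡ V (ι 2) (λ χ → ⟪ proper? P χ ⟫ * L χ) ⟨
      ∑ V (λ χ → ι 2 * (⟪ proper? P χ ⟫ * L χ))
        ≤⟨ ∑-mono V spread ⟩
      ∑ V (λ χ → ∑ C (λ γ → ⟪ proper? P χ ×-dec ¬? (lookup χ u ≟ γ) ⟫ * L χ))
        ≡⟨ ∑-swap V C _ ⟩
      ∑ C (λ γ → ∑ V (λ χ → ⟪ proper? P χ ×-dec ¬? (lookup χ u ≟ γ) ⟫ * L χ))
        ≡⟨ ∑-cong C (λ γ → SwapBelow.∑-swapBelow R Pu Pv γ k) ⟩
      ∑ C (λ γ → ∑ V (λ χ → ⟪ proper? P χ ×-dec ¬? (lookup χ u ≟ γ) ⟫ * ι (len k P χ u (lookup χ u) γ)))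
        ≤⟨ ∑-mono C (λ γ → ∑-mono V (λ χ → drop χ γ)) ⟩
      ∑ C (λ γ → ∑ V (λ χ → ⟪ proper? P χ ⟫ * ι (len k P χ u (lookup χ u) γ)))
        ≡⟨ ∑-swap V C (λ χ γ → ⟪ proper? P χ ⟫ * ι (len k P χ u (lookup χ u) γ)) ⟨
      ∑ V (λ χ → ∑ C (λ γ → ⟪ proper? P χ ⟫ * ι (len k P χ u (lookup χ u) γ)))
        ≡⟨ ∑-cong V (λ χ → ∑-*ˡ C ⟪ proper? P χ ⟫ _) ⟩
      ∑ V (λ χ → ⟪ proper? P χ ⟫ * totalLen k u χ) ∎

  Z : ℚ
  Z = ∑ V (λ χ → ⟪ proper? P χ ⟫)

  -- A child u adds 1 for its own recolouring and on average at most half of its own total for the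
  -- continuation, which is the recursion of `load`. That v has a parent makes its colour real, and
  -- u inherits the condition with v as parent.
  ∑-totalLen-≤ : ∀ k {v y} → P v ≡ just y → ∑ V (λ χ → ⟪ proper? P χ ⟫ * totalLen k v χ) ≤ℚ Z * load P k v
  ∑-totalLen-≤ zero {v} Pv = ℚₚ.≤-reflexive (trans
    (∑-cong V (λ χ → trans (cong (⟪ proper? P χ ⟫ *_) (∑-zero C)) (ℚₚ.*-zeroʳ ⟪ proper? P χ ⟫)))
    (trans (∑-zero V) (sym (ℚₚ.*-zeroʳ Z))))
  ∑-totalLen-≤ (suc k) {v} {y} Pv = begin
    ∑ V (λ χ → ⟪ proper? P χ ⟫ * totalLen (suc k) v χ)
      ≤⟨ ∑-mono V (λ χ → *-monoˡ-≤ (⟪⟫-nonneg (proper? P χ)) (totalLen-≤ k v χ)) ⟩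
    ∑ V (λ χ → ⟪ proper? P χ ⟫ * ∑ (allFin n) (λ u → ⟪ P u ≟ᴾ just v ⟫ * (1ℚ +ℚ L u χ)))
      ≡⟨ ∑-cong V (λ χ → trans (sym (∑-*ˡ (allFin n) ⟪ proper? P χ ⟫ _)) (∑-cong (allFin n) (λ u →
           solve 3 (λ a b c → a :* (b :* (con 1ℚ :+ c)) := b :* (a :+ a :* c)) refl ⟪ proper? P χ ⟫ ⟪ P u ≟ᴾ just v ⟫ (L u χ)))) ⟩
    ∑ V (λ χ → ∑ (allFin n) (λ u → ⟪ P u ≟ᴾ just v ⟫ * (⟪ proper? P χ ⟫ +ℚ ⟪ proper? P χ ⟫ * L u χ)))
      ≡⟨ ∑-swap V (allFin n) _ ⟩
    ∑ (allFin n) (λ u → ∑ V (λ χ → ⟪ P u ≟ᴾ just v ⟫ * (⟪ proper? P χ ⟫ +ℚ ⟪ proper? P χ ⟫ * L u χ)))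
      ≡⟨ ∑-cong (allFin n) (λ u → trans (∑-*ˡ V ⟪ P u ≟ᴾ just v ⟫ _)
           (cong (⟪ P u ≟ᴾ just v ⟫ *_) (∑-+ V (λ χ → ⟪ proper? P χ ⟫) (λ χ → ⟪ proper? P χ ⟫ * L u χ)))) ⟩
    ∑ (allFin n) (λ u → ⟪ P u ≟ᴾ just v ⟫ * (Z +ℚ ∑ V (λ χ → ⟪ proper? P χ ⟫ * L u χ)))
      ≤⟨ ∑-mono (allFin n) (λ u → ⟪⟫-*-mono (P u ≟ᴾ just v) (λ Pu → ℚₚ.+-monoʳ-≤ Z
           (ℚₚ.≤-trans (∑-len-≤-half k Pu Pv) (*-monoˡ-≤ (ℚₚ.nonNegative⁻¹ ½) (∑-totalLen-≤ k Pu))))) ⟩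
    ∑ (allFin n) (λ u → ⟪ P u ≟ᴾ just v ⟫ * (Z +ℚ ½ * (Z * load P k u)))
      ≡⟨ ∑-cong (allFin n) (λ u → solve 4 (λ a z h l → a :* (z :+ h :* (z :* l)) := z :* (a :* (con 1ℚ :+ h :* l))) refl
           ⟪ P u ≟ᴾ just v ⟫ Z ½ (load P k u)) ⟩
    ∑ (allFin n) (λ u → Z * (⟪ P u ≟ᴾ just v ⟫ * (1ℚ +ℚ ½ * load P k u)))
      ≡⟨ ∑-*ˡ (allFin n) Z _ ⟩
    Z * load P (suc k) v ∎
    where
    open ℚₚ.≤-Reasoning
    L : Fin n → Vec (Fin κ) n → ℚ
    L u χ = ι (len k P χ u (lookup χ u) (lookup χ v))

-- Amortization

module _ {n : ℕ} (P : Parents n) where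

  nonRoot? : ∀ v → Dec (P v ≢ nothing)
  nonRoot? v = ¬? (P v ≟ᴾ nothing)

  edges : ℚ
  edges = ∑ (allFin n) (λ u → ⟪ nonRoot? u ⟫)

  ∑-parent : ∀ u → ∑ (allFin n) (λ v → ⟪ P u ≟ᴾ just v ⟫) ≡ ⟪ nonRoot? u ⟫
  ∑-parent u = byParent (P u)
    where
    byParent : ∀ m → ∑ (allFin n) (λ v → ⟪ m ≟ᴾ just v ⟫) ≡ ⟪ ¬? (m ≟ᴾ nothing) ⟫
    byParent nothing  = ∑-zero (allFin n)
    byParent (just x) = trans (∑-cong (allFin n) (λ v → trans
      (⟪⟫-⇔ (just x ≟ᴾ just v) (x ≟ v) Maybeₚ.just-injective (cong just)) (sym (ℚₚ.*-identityʳ ⟪ x ≟ v ⟫))))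
      (allFin-enumerates n x (λ _ → 1ℚ))

  -- A non-root is counted by its one parent, so passing from k to `suc k` turns a total T into at
  -- most edges + ½ T, whose fixed point is twice the number of edges.
  ∑-load-≤ : ∀ k → ∑ (allFin n) (load P k) ≤ℚ ι 2 * edges
  ∑-load-≤ zero = subst (_≤ℚ ι 2 * edges) (sym (∑-zero (allFin n)))
    (*-nonneg (ι-nonneg 2) (∑-nonneg (allFin n) (λ u → ⟪⟫-nonneg (nonRoot? u))))
  ∑-load-≤ (suc k) = begin
    ∑ (allFin n) (λ v → ∑ (allFin n) (λ u → ⟪ P u ≟ᴾ just v ⟫ * (1ℚ +ℚ ½ * load P k u)))
      ≡⟨ ∑-swap (allFin n) (allFin n) _ ⟩
    ∑ (allFin n) (λ u → ∑ (allFin n) (λ v → ⟪ P u ≟ᴾ just v ⟫ * (1ℚ +ℚ ½ * load P k u)))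
      ≡⟨ ∑-cong (allFin n) (λ u → trans (∑-*ʳ (allFin n) (1ℚ +ℚ ½ * load P k u) (λ v → ⟪ P u ≟ᴾ just v ⟫))
           (cong (_* (1ℚ +ℚ ½ * load P k u)) (∑-parent u))) ⟩
    ∑ (allFin n) (λ u → ⟪ nonRoot? u ⟫ * (1ℚ +ℚ ½ * load P k u))
      ≤⟨ ∑-mono (allFin n) drop ⟩
    ∑ (allFin n) (λ u → ⟪ nonRoot? u ⟫ +ℚ ½ * load P k u)
      ≡⟨ trans (∑-+ (allFin n) (λ u → ⟪ nonRoot? u ⟫) (λ u → ½ * load P k u)) (cong (edges +ℚ_) (∑-*ˡ (allFin n) ½ (load P k))) ⟩
    edges +ℚ ½ * ∑ (allFin n) (load P k)
      ≤⟨ ℚₚ.+-monoʳ-≤ edges (*-monoˡ-≤ (ℚₚ.nonNegative⁻¹ ½) (∑-load-≤ k)) ⟩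
    edges +ℚ ½ * (ι 2 * edges)
      ≡⟨ solve 1 (λ e → e :+ con ½ :* (con (ι 2) :* e) := con (ι 2) :* e) refl edges ⟩
    ι 2 * edges ∎
    where
    open ℚₚ.≤-Reasoning
    drop : ∀ u → ⟪ nonRoot? u ⟫ * (1ℚ +ℚ ½ * load P k u) ≤ℚ ⟪ nonRoot? u ⟫ +ℚ ½ * load P k u
    drop u = ℚₚ.≤-trans (ℚₚ.≤-reflexive (solve 2 (λ a b → a :* (con 1ℚ :+ b) := a :+ a :* b) refl ⟪ nonRoot? u ⟫ (½ * load P k u)))
      (ℚₚ.+-monoʳ-≤ ⟪ nonRoot? u ⟫ (⟪⟫-*-≤ (nonRoot? u) (*-nonneg (ℚₚ.nonNegative⁻¹ ½) (load-nonneg P k u))))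

  -- Each non-root was charged at most its present load when it got its parent.
  paid : ℚ
  paid = ∑ (allFin n) (λ v → ⟪ nonRoot? v ⟫ * load P (suc n) v)

  paid-nonneg : 0ℚ ≤ℚ paid
  paid-nonneg = ∑-nonneg (allFin n) (λ v → *-nonneg (⟪⟫-nonneg (nonRoot? v)) (load-nonneg P (suc n) v))

  paid-≤ : paid ≤ℚ ι 2 * edges
  paid-≤ = ℚₚ.≤-trans (∑-mono (allFin n) (λ v → ⟪⟫-*-≤ (nonRoot? v) (load-nonneg P (suc n) v))) (∑-load-≤ (suc n))

load-mono : ∀ {n} (P Q : Parents n) → (∀ {u v} → P u ≡ just v → Q u ≡ just v) → ∀ k v → load P k v ≤ℚ load Q k v
load-mono P Q P⊆Q zero    v = ℚₚ.≤-refl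
load-mono {n} P Q P⊆Q (suc k) v = ∑-mono (allFin n) (λ u → ℚₚ.≤-trans
  (*-monoˡ-≤ (⟪⟫-nonneg (P u ≟ᴾ just v)) (ℚₚ.+-monoʳ-≤ 1ℚ (*-monoˡ-≤ (ℚₚ.nonNegative⁻¹ ½) (load-mono P Q P⊆Q k u))))
  (*-monoʳ-≤ (+-nonneg (ℚₚ.nonNegative⁻¹ 1ℚ) (*-nonneg (ℚₚ.nonNegative⁻¹ ½) (load-nonneg Q k u)))
    (⟪⟫-mono (P u ≟ᴾ just v) (Q u ≟ᴾ just v) P⊆Q)))

module _ {n : ℕ} {P P′ : Parents n} {p r : Fin n} (Pr : P r ≡ nothing)
         (P′r : P′ r ≡ just p) (P′≡P : ∀ {v} → v ≢ r → P′ v ≡ P v) where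

  nonRoot-link : ∀ v → ⟪ nonRoot? P v ⟫ +ℚ ⟪ r ≟ v ⟫ ≡ ⟪ nonRoot? P′ v ⟫
  nonRoot-link v = byCase (r ≟ v)
    where
    byCase : (d : Dec (r ≡ v)) → ⟪ nonRoot? P v ⟫ +ℚ ⟪ d ⟫ ≡ ⟪ nonRoot? P′ v ⟫
    byCase (yes refl) = trans (cong (_+ℚ 1ℚ) (⟪⟫-no (nonRoot? P r) (λ nr → nr Pr)))
                              (sym (⟪⟫-yes (nonRoot? P′ r) (just≢nothing P′r)))
    byCase (no r≢v)   = trans (ℚₚ.+-identityʳ ⟪ nonRoot? P v ⟫)
                              (cong (λ m → ⟪ ¬? (m ≟ᴾ nothing) ⟫) (sym (P′≡P (r≢v ∘ sym))))

  edges-link : edges P +ℚ 1ℚ ≡ edges P′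
  edges-link = begin
    edges P +ℚ 1ℚ
      ≡⟨ cong (edges P +ℚ_) (trans (sym (allFin-enumerates n r (λ _ → 1ℚ))) (∑-cong (allFin n) (λ v → ℚₚ.*-identityʳ ⟪ r ≟ v ⟫))) ⟩
    edges P +ℚ ∑ (allFin n) (λ v → ⟪ r ≟ v ⟫)
      ≡⟨ ∑-+ (allFin n) (λ v → ⟪ nonRoot? P v ⟫) (λ v → ⟪ r ≟ v ⟫) ⟨
    ∑ (allFin n) (λ v → ⟪ nonRoot? P v ⟫ +ℚ ⟪ r ≟ v ⟫)
      ≡⟨ ∑-cong (allFin n) nonRoot-link ⟩
    edges P′ ∎
    where open ≡-Reasoning

  -- Loads only grow with the forest, and r becomes a non-root, so the charge of this insertion
  -- appears as a new summand.
  paid-link : paid P +ℚ load P′ (suc n) r ≤ℚ paid P′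
  paid-link = begin
    paid P +ℚ load P′ (suc n) r
      ≡⟨ cong (paid P +ℚ_) (allFin-enumerates n r (load P′ (suc n))) ⟨
    paid P +ℚ ∑ (allFin n) (λ v → ⟪ r ≟ v ⟫ * load P′ (suc n) v)
      ≤⟨ ℚₚ.+-monoˡ-≤ (∑ (allFin n) (λ v → ⟪ r ≟ v ⟫ * load P′ (suc n) v))
           (∑-mono (allFin n) (λ v → *-monoˡ-≤ (⟪⟫-nonneg (nonRoot? P v)) (load-mono P P′ P⊆P′ (suc n) v))) ⟩
    ∑ (allFin n) (λ v → ⟪ nonRoot? P v ⟫ * load P′ (suc n) v) +ℚ ∑ (allFin n) (λ v → ⟪ r ≟ v ⟫ * load P′ (suc n) v)
      ≡⟨ ∑-+ (allFin n) (λ v → ⟪ nonRoot? P v ⟫ * load P′ (suc n) v) (λ v → ⟪ r ≟ v ⟫ * load P′ (suc n) v) ⟨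
    ∑ (allFin n) (λ v → ⟪ nonRoot? P v ⟫ * load P′ (suc n) v +ℚ ⟪ r ≟ v ⟫ * load P′ (suc n) v)
      ≡⟨ ∑-cong (allFin n) (λ v → trans (sym (ℚₚ.*-distribʳ-+ (load P′ (suc n) v) ⟪ nonRoot? P v ⟫ ⟪ r ≟ v ⟫))
           (cong (_* load P′ (suc n) v) (nonRoot-link v))) ⟩
    paid P′ ∎
    where
    open ℚₚ.≤-Reasoning
    P⊆P′ : ∀ {u v} → P u ≡ just v → P′ u ≡ just v
    P⊆P′ {u} Pu = trans (P′≡P (λ { refl → just≢nothing Pu Pr })) Pu

-- Each load is taken in the forest right after its insertion; descendants that r acquires later are
-- not charged to it.
totalLoad : ∀ {n} → Parents n → List (Fin n × Fin n) → ℚ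
totalLoad     P []             = 0ℚ
totalLoad {n} P ((p , r) ∷ us) = load (link P r p) (suc n) r +ℚ totalLoad (link P r p) us

totalLoad-nonneg : ∀ {n} (P : Parents n) us → 0ℚ ≤ℚ totalLoad P us
totalLoad-nonneg     P []             = ℚₚ.≤-refl
totalLoad-nonneg {n} P ((p , r) ∷ us) = +-nonneg (load-nonneg (link P r p) (suc n) r) (totalLoad-nonneg (link P r p) us)

-- `paid` serves as a potential: each charge moves from `totalLoad` into it, while the number of
-- edges present plus edges to come is constant.
totalLoad-≤ : ∀ {n Δ} {P : Parents n} {us} → ValidSeq Δ P us → totalLoad P us +ℚ paid P ≤ℚ ι 2 * (edges P +ℚ ι (length us))
totalLoad-≤ {P = P} done = subst₂ _≤ℚ_ (sym (ℚₚ.+-identityˡ (paid P))) (cong (ι 2 *_) (sym (ℚₚ.+-identityʳ (edges P)))) (paid-≤ P)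
totalLoad-≤ {n} {P = P} {(p , r) ∷ us} (step Pr _ _ valid) = begin
  (load P′ (suc n) r +ℚ totalLoad P′ us) +ℚ paid P
    ≡⟨ solve 3 (λ a b c → (a :+ b) :+ c := b :+ (c :+ a)) refl (load P′ (suc n) r) (totalLoad P′ us) (paid P) ⟩
  totalLoad P′ us +ℚ (paid P +ℚ load P′ (suc n) r)
    ≤⟨ ℚₚ.+-monoʳ-≤ (totalLoad P′ us) (paid-link Pr (link-new P r p) (link-old P r p)) ⟩
  totalLoad P′ us +ℚ paid P′
    ≤⟨ totalLoad-≤ valid ⟩
  ι 2 * (edges P′ +ℚ ι (length us))
    ≡⟨ cong (λ e → ι 2 * (e +ℚ ι (length us))) (edges-link Pr (link-new P r p) (link-old P r p)) ⟨
  ι 2 * ((edges P +ℚ 1ℚ) +ℚ ι (length us))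
    ≡⟨ cong (ι 2 *_) (trans (ℚₚ.+-assoc (edges P) 1ℚ (ι (length us))) (cong (edges P +ℚ_) (sym (ι-+ 1 (length us))))) ⟩
  ι 2 * (edges P +ℚ ι (suc (length us))) ∎
  where
  open ℚₚ.≤-Reasoning
  P′ = link P r p

inv-*-ι-≥1 : ∀ {κ} → 1 ≤ κ → inv κ * ι κ ≡ 1ℚ
inv-*-ι-≥1 {suc κ} _ = inv-*-ι κ

-- The cost of one insertion

module StepBound {n κ : ℕ} (3≤κ : 3 ≤ κ) {P P′ : Parents n} {p r : Fin n} (Pr : P r ≡ nothing)
                 (P′r : P′ r ≡ just p) (P′≡P : ∀ {v} → v ≢ r → P′ v ≡ P v) (R′ : Rooted P′) where
  open Step {κ = κ} Pr P′r P′≡P R′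
  open MeanLength 3≤κ R′ using (V; C; totalLen) renaming (Z to Z′)

  -- `W` is the relative weight with which each proper colouring of the new forest is reached: 1
  -- without a collision, and `i` for each colour at a child of r. With d children and d < κ it
  -- equals κ/(κ - d).
  Z W : ℚ
  Z = ∑ V (λ χ → ⟪ proper? P χ ⟫)
  W = 1ℚ +ℚ i * ι (children P′ r)

  inv-*-ικ : inv κ * ι κ ≡ 1ℚ
  inv-*-ικ = inv-*-ι-≥1 (ℕₚ.≤-trans (s≤s z≤n) 3≤κ)

  i-nonneg : 0ℚ ≤ℚ i
  i-nonneg = inv-nonneg (κ ∸ children P′ r)

  -- In essence i / W = 1/κ; the inequality also covers `κ ∸ d` equal to 0, where `i` takes the
  -- default value 0.
  i-≤ : i ≤ℚ inv κ * W
  i-≤ = begin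
    i                      ≡⟨ ℚₚ.*-identityˡ i ⟨
    1ℚ * i                 ≡⟨ cong (_* i) inv-*-ικ ⟨
    inv κ * ι κ * i        ≡⟨ ℚₚ.*-assoc (inv κ) (ι κ) i ⟩
    inv κ * (ι κ * i)      ≤⟨ *-monoˡ-≤ (inv-nonneg κ) bound ⟩
    inv κ * W              ∎
    where
    open ℚₚ.≤-Reasoning
    d = children P′ r
    bound : ι κ * i ≤ℚ W
    bound = begin
      ι κ * i                        ≤⟨ *-monoʳ-≤ i-nonneg (ι-mono (ℕₚ.m≤n+m∸n κ d)) ⟩
      ι (d + (κ ∸ d)) * i            ≡⟨ cong (_* i) (ι-+ d (κ ∸ d)) ⟩
      (ι d +ℚ ι (κ ∸ d)) * i         ≡⟨ solve 3 (λ a b c → (a :+ b) :* c := c :* b :+ c :* a) refl (ι d) (ι (κ ∸ d)) i ⟩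
      i * ι (κ ∸ d) +ℚ i * ι d       ≤⟨ ℚₚ.+-monoˡ-≤ (i * ι d) (inv-*-ι-≤1 (κ ∸ d)) ⟩
      W                              ∎

  insertion-mass-≤1 : ∀ χ → insertion (λ _ _ → 1ℚ) χ ≤ℚ 1ℚ
  insertion-mass-≤1 χ = average-≤1 (avail ⟦ P , χ ⟧ p) (λ β → inner (χ [ r ]≔ β) (find P′ (χ [ r ]≔ β) r (lookup (χ [ r ]≔ β) r)))
    where
    inner : ∀ ξ m → maybe′ (λ _ → inv (length (avail ⟦ P′ , ξ ⟧ r)) * ∑ (avail ⟦ P′ , ξ ⟧ r) (λ _ → 1ℚ)) 1ℚ m ≤ℚ 1ℚ
    inner ξ nothing  = ℚₚ.≤-refl
    inner ξ (just _) = average-≤1 (avail ⟦ P′ , ξ ⟧ r) (λ _ → ℚₚ.≤-refl)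

  -- `∑-insertion` for the payoff 1. It bounds the normalising factor by the ratio of two numbers of
  -- colourings without computing either.
  mass-≤ : μ * (ι κ * (W * Z′)) ≤ℚ Z
  mass-≤ = begin
    μ * (ι κ * (W * Z′))
      ≡⟨ cong (λ s → μ * (ι κ * s)) (trans (sym (∑-*ˡ V W (λ ξ → ⟪ proper? P′ ξ ⟫))) (∑-cong V weigh)) ⟩
    μ * (ι κ * ∑ V (λ ξ → ⟪ proper? P′ ξ ⟫ * (1ℚ +ℚ i * ∑ C (λ α → ⟪ has? P′ ξ r α ⟫ * 1ℚ))))
      ≡⟨ ∑-insertion (λ _ _ → 1ℚ) ⟨
    ∑ V (λ χ → ⟪ proper? P χ ⟫ * insertion (λ _ _ → 1ℚ) χ)
      ≤⟨ ∑-mono V (λ χ → *-monoˡ-≤ (⟪⟫-nonneg (proper? P χ)) (insertion-mass-≤1 χ)) ⟩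
    ∑ V (λ χ → ⟪ proper? P χ ⟫ * 1ℚ)
      ≡⟨ ∑-cong V (λ χ → ℚₚ.*-identityʳ ⟪ proper? P χ ⟫) ⟩
    Z ∎
    where
    open ℚₚ.≤-Reasoning
    weigh : ∀ ξ → W * ⟪ proper? P′ ξ ⟫ ≡ ⟪ proper? P′ ξ ⟫ * (1ℚ +ℚ i * ∑ C (λ α → ⟪ has? P′ ξ r α ⟫ * 1ℚ))
    weigh ξ = trans (ℚₚ.*-comm W ⟪ proper? P′ ξ ⟫) (⟪⟫-*-cong (proper? P′ ξ) (λ prop → cong (λ s → 1ℚ +ℚ i * s)
      (sym (trans (∑-cong C (λ α → ℚₚ.*-identityʳ ⟪ has? P′ ξ r α ⟫)) (∑-has P′ ξ (proj₁ prop) r)))))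

  insertion-≤ : ∀ (v : Vec (Fin κ) n → ℚ) →
    ∑ V (λ χ → ⟪ proper? P χ ⟫ * insertion (λ ξ k → ι k +ℚ v ξ) χ) ≤ℚ
    μ * (ι κ * (W * (∑ V (λ ξ → ⟪ proper? P′ ξ ⟫ * v ξ) +ℚ inv κ * ∑ V (λ ξ → ⟪ proper? P′ ξ ⟫ * totalLen (suc n) r ξ))))
  insertion-≤ v = begin
    ∑ V (λ χ → ⟪ proper? P χ ⟫ * insertion (λ ξ k → ι k +ℚ v ξ) χ)
      ≡⟨ ∑-insertion (λ ξ k → ι k +ℚ v ξ) ⟩
    μ * (ι κ * ∑ V (λ ξ → ⟪ proper? P′ ξ ⟫ * ((ι 0 +ℚ v ξ) +ℚ i * ∑ C (λ α → ⟪ has? P′ ξ r α ⟫ * (L ξ α +ℚ v ξ)))))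
      ≤⟨ *-monoˡ-≤ (inv-nonneg (κ ∸ (parentEdges P p + children P p))) (*-monoˡ-≤ (ι-nonneg κ)
           (∑-mono V (λ ξ → ⟪⟫-*-mono (proper? P′ ξ) (pointwise ξ)))) ⟩
    μ * (ι κ * ∑ V (λ ξ → ⟪ proper? P′ ξ ⟫ * (W * (v ξ +ℚ inv κ * totalLen (suc n) r ξ))))
      ≡⟨ cong (λ s → μ * (ι κ * s)) (trans (∑-cong V (λ ξ → solve 5
           (λ a w x k t → a :* (w :* (x :+ k :* t)) := w :* (a :* x :+ k :* (a :* t))) refl ⟪ proper? P′ ξ ⟫ W (v ξ) (inv κ) (totalLen (suc n) r ξ)))
           (trans (∑-*ˡ V W (λ ξ → ⟪ proper? P′ ξ ⟫ * v ξ +ℚ inv κ * (⟪ proper? P′ ξ ⟫ * totalLen (suc n) r ξ)))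
             (cong (W *_) (trans (∑-+ V (λ ξ → ⟪ proper? P′ ξ ⟫ * v ξ) (λ ξ → inv κ * (⟪ proper? P′ ξ ⟫ * totalLen (suc n) r ξ)))
               (cong (∑ V (λ ξ → ⟪ proper? P′ ξ ⟫ * v ξ) +ℚ_) (∑-*ˡ V (inv κ) (λ ξ → ⟪ proper? P′ ξ ⟫ * totalLen (suc n) r ξ))))))) ⟩
    μ * (ι κ * (W * (∑ V (λ ξ → ⟪ proper? P′ ξ ⟫ * v ξ) +ℚ inv κ * ∑ V (λ ξ → ⟪ proper? P′ ξ ⟫ * totalLen (suc n) r ξ)))) ∎
    where
    open ℚₚ.≤-Reasoning
    L : Vec (Fin κ) n → Fin κ → ℚ
    L ξ α = ι (len (suc n) P′ ξ r (lookup ξ r) α)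
    pointwise : ∀ ξ → Proper P′ ξ →
      (ι 0 +ℚ v ξ) +ℚ i * ∑ C (λ α → ⟪ has? P′ ξ r α ⟫ * (L ξ α +ℚ v ξ)) ≤ℚ W * (v ξ +ℚ inv κ * totalLen (suc n) r ξ)
    pointwise ξ prop = begin
      (ι 0 +ℚ v ξ) +ℚ i * ∑ C (λ α → ⟪ has? P′ ξ r α ⟫ * (L ξ α +ℚ v ξ))
        ≡⟨ cong₂ (λ s t → s +ℚ i * t) (ℚₚ.+-identityˡ (v ξ)) (trans
             (∑-cong C (λ α → ℚₚ.*-distribˡ-+ ⟪ has? P′ ξ r α ⟫ (L ξ α) (v ξ)))
             (trans (∑-+ C (λ α → ⟪ has? P′ ξ r α ⟫ * L ξ α) (λ α → ⟪ has? P′ ξ r α ⟫ * v ξ))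
               (cong (∑ C (λ α → ⟪ has? P′ ξ r α ⟫ * L ξ α) +ℚ_) (trans (∑-*ʳ C (v ξ) (λ α → ⟪ has? P′ ξ r α ⟫))
                 (cong (_* v ξ) (∑-has P′ ξ (proj₁ prop) r)))))) ⟩
      v ξ +ℚ i * (∑ C (λ α → ⟪ has? P′ ξ r α ⟫ * L ξ α) +ℚ ι (children P′ r) * v ξ)
        ≤⟨ ℚₚ.+-monoʳ-≤ (v ξ) (*-monoˡ-≤ i-nonneg (ℚₚ.+-monoˡ-≤ (ι (children P′ r) * v ξ)
             (∑-mono C (λ α → ⟪⟫-*-≤ (has? P′ ξ r α) (ι-nonneg (len (suc n) P′ ξ r (lookup ξ r) α)))))) ⟩
      v ξ +ℚ i * (totalLen (suc n) r ξ +ℚ ι (children P′ r) * v ξ)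
        ≡⟨ solve 4 (λ x j t d → x :+ j :* (t :+ d :* x) := (con 1ℚ :+ j :* d) :* x :+ j :* t) refl
             (v ξ) i (totalLen (suc n) r ξ) (ι (children P′ r)) ⟩
      W * v ξ +ℚ i * totalLen (suc n) r ξ
        ≤⟨ ℚₚ.+-monoʳ-≤ (W * v ξ) (*-monoʳ-≤ (∑-nonneg C (λ γ → ι-nonneg (len (suc n) P′ ξ r (lookup ξ r) γ))) i-≤) ⟩
      W * v ξ +ℚ inv κ * W * totalLen (suc n) r ξ
        ≡⟨ solve 4 (λ w x k t → w :* x :+ k :* w :* t := w :* (x :+ k :* t)) refl W (v ξ) (inv κ) (totalLen (suc n) r ξ) ⟩
      W * (v ξ +ℚ inv κ * totalLen (suc n) r ξ) ∎

  -- Hypothesis and conclusion have the same shape, so this is the induction step along the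
  -- sequence; the factors `μ`, κ and `W` are absorbed by the passage from `Z′` to `Z`.
  step-≤ : ∀ (v : Vec (Fin κ) n → ℚ) B → 0ℚ ≤ℚ B → ∑ V (λ ξ → ⟪ proper? P′ ξ ⟫ * v ξ) ≤ℚ inv κ * (Z′ * B) →
    ∑ V (λ χ → ⟪ proper? P χ ⟫ * insertion (λ ξ k → ι k +ℚ v ξ) χ) ≤ℚ inv κ * (Z * (load P′ (suc n) r +ℚ B))
  step-≤ v B 0≤B v≤B = begin
    ∑ V (λ χ → ⟪ proper? P χ ⟫ * insertion (λ ξ k → ι k +ℚ v ξ) χ)
      ≤⟨ insertion-≤ v ⟩
    μ * (ι κ * (W * (∑ V (λ ξ → ⟪ proper? P′ ξ ⟫ * v ξ) +ℚ inv κ * ∑ V (λ ξ → ⟪ proper? P′ ξ ⟫ * totalLen (suc n) r ξ))))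
      ≤⟨ *-monoˡ-≤ (inv-nonneg (κ ∸ (parentEdges P p + children P p))) (*-monoˡ-≤ (ι-nonneg κ) (*-monoˡ-≤ W-nonneg
           (ℚₚ.+-mono-≤ v≤B (*-monoˡ-≤ (inv-nonneg κ) (MeanLength.∑-totalLen-≤ 3≤κ R′ (suc n) P′r))))) ⟩
    μ * (ι κ * (W * (inv κ * (Z′ * B) +ℚ inv κ * (Z′ * load P′ (suc n) r))))
      ≡⟨ solve 7 (λ m k w j z b l → m :* (k :* (w :* (j :* (z :* b) :+ j :* (z :* l)))) := j :* ((m :* (k :* (w :* z))) :* (l :+ b)))
           refl μ (ι κ) W (inv κ) Z′ B (load P′ (suc n) r) ⟩
    inv κ * (μ * (ι κ * (W * Z′)) * (load P′ (suc n) r +ℚ B))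
      ≤⟨ *-monoˡ-≤ (inv-nonneg κ) (*-monoʳ-≤ (+-nonneg (load-nonneg P′ (suc n) r) 0≤B) mass-≤) ⟩
    inv κ * (Z * (load P′ (suc n) r +ℚ B)) ∎
    where
    open ℚₚ.≤-Reasoning
    W-nonneg : 0ℚ ≤ℚ W
    W-nonneg = +-nonneg (ℚₚ.nonNegative⁻¹ 1ℚ) (*-nonneg i-nonneg (ι-nonneg (children P′ r)))

module _ {n κ : ℕ} (3≤κ : 3 ≤ κ) where

  ∑-value-≤ : ∀ {Δ} {P : Parents n} {us} → Rooted P → ValidSeq Δ P us →
    ∑ (allVec {κ} n) (λ χ → ⟪ proper? P χ ⟫ * value P χ us) ≤ℚ inv κ * (∑ (allVec {κ} n) (λ χ → ⟪ proper? P χ ⟫) * totalLoad P us)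
  ∑-value-≤ {P = P} R done = ℚₚ.≤-reflexive (trans
    (trans (∑-cong (allVec n) (λ χ → ℚₚ.*-zeroʳ ⟪ proper? P χ ⟫)) (∑-zero (allVec n)))
    (sym (trans (cong (inv κ *_) (ℚₚ.*-zeroʳ (∑ (allVec {κ} n) (λ χ → ⟪ proper? P χ ⟫)))) (ℚₚ.*-zeroʳ (inv κ)))))
  ∑-value-≤ {P = P} {(p , r) ∷ us} R (step Pr p≁r _ valid) =
    StepBound.step-≤ 3≤κ Pr (link-new P r p) (link-old P r p) R′ (λ ξ → value (link P r p) ξ us)
      (totalLoad (link P r p) us) (totalLoad-nonneg (link P r p) us) (∑-value-≤ R′ valid)
    where R′ = rooted-link R Pr p≁r

  expectedTotalRecourse-≤ : ∀ {Δ} {us} → ValidSeq Δ (noParents {n}) us →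
    expectedTotalRecourse κ us ≤ℚ inv κ * (ι 2 * ι (length us))
  expectedTotalRecourse-≤ {us = us} valid = begin
    expectedTotalRecourse κ us
      ≡⟨ expectation≡E (runSeq {n} {κ} emptyForest us) ⟩
    X
      ≤⟨ ℚₚ.*-cancelˡ-≤-pos Z {{ℚ.positive (ℚₚ.<-≤-trans (ℚₚ.positive⁻¹ 1ℚ) 1≤Z)}} scaled ⟩
    inv κ * totalLoad noParents us
      ≤⟨ *-monoˡ-≤ (inv-nonneg κ) load≤ ⟩
    inv κ * (ι 2 * ι (length us)) ∎
    where
    open ℚₚ.≤-Reasoning
    V = allVec {κ} n
    X Z : ℚ
    X = E (runSeq {n} {κ} emptyForest us) ι
    Z = ∑ V (λ χ → ⟪ proper? noParents χ ⟫)
    χ₀ : Vec (Fin κ) n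
    χ₀ = replicate n (Data.Fin.fromℕ< {0} (ℕₚ.≤-trans (s≤s z≤n) 3≤κ))
    proper₀ : Proper (noParents {n}) χ₀
    proper₀ = (λ _ _ _ ()) , (λ _ _ _ ())
    1≤Z : 1ℚ ≤ℚ Z
    1≤Z = subst (_≤ℚ Z) (⟪⟫-yes (proper? noParents χ₀) proper₀)
      (enumerates-≤ _≟ⱽ_ {V} (allVec-enumerates n) χ₀ (λ χ → ⟪ proper? noParents χ ⟫) (λ χ → ⟪⟫-nonneg (proper? noParents χ)))
    -- In the empty forest every vector is proper and represents the same forest, so averaging over
    -- all of them leaves the expectation unchanged.
    scaled : Z * X ≤ℚ Z * (inv κ * totalLoad noParents us)
    scaled = begin
      Z * X
        ≡⟨ ∑-*ʳ V X (λ χ → ⟪ proper? noParents χ ⟫) ⟨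
      ∑ V (λ χ → ⟪ proper? noParents χ ⟫ * X)
        ≤⟨ ∑-mono V (λ χ → *-monoˡ-≤ (⟪⟫-nonneg (proper? noParents χ)) (runSeq-≤-value {us = us} rooted-empty valid {χ = χ} (λ _ → refl))) ⟩
      ∑ V (λ χ → ⟪ proper? noParents χ ⟫ * value noParents χ us)
        ≤⟨ ∑-value-≤ rooted-empty valid ⟩
      inv κ * (Z * totalLoad noParents us)
        ≡⟨ solve 3 (λ a b c → a :* (b :* c) := b :* (a :* c)) refl (inv κ) Z (totalLoad noParents us) ⟩
      Z * (inv κ * totalLoad noParents us) ∎
    load≤ : totalLoad noParents us ≤ℚ ι 2 * ι (length us)
    load≤ = begin
      totalLoad noParents us                          ≡⟨ ℚₚ.+-identityʳ (totalLoad noParents us) ⟨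
      totalLoad noParents us +ℚ 0ℚ                    ≤⟨ ℚₚ.+-monoʳ-≤ (totalLoad noParents us) (paid-nonneg (noParents {n})) ⟩
      totalLoad noParents us +ℚ paid (noParents {n})        ≤⟨ totalLoad-≤ valid ⟩
      ι 2 * (edges (noParents {n}) +ℚ ι (length us))  ≡⟨ cong (ι 2 *_) (trans (cong (_+ℚ ι (length us)) (∑-zero (allFin n))) (ℚₚ.+-identityˡ (ι (length us)))) ⟩
      ι 2 * ι (length us)                             ∎

upperBound : ∀ Δ c n → 3 ≤ Δ → (us : List (Fin n × Fin n)) → ValidSeq Δ noParents us →
             expectedTotalRecourse (Δ + c) us * ι Δ ≤ℚ ι 2 * ι (length us)
upperBound Δ c n 3≤Δ us valid = begin
  expectedTotalRecourse κ us * ι Δ          ≤⟨ *-monoʳ-≤ (ι-nonneg Δ) (expectedTotalRecourse-≤ 3≤κ valid) ⟩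
  inv κ * (ι 2 * ι (length us)) * ι Δ       ≡⟨ solve 3 (λ a b d → a :* b :* d := b :* (a :* d)) refl (inv κ) (ι 2 * ι (length us)) (ι Δ) ⟩
  ι 2 * ι (length us) * (inv κ * ι Δ)       ≤⟨ *-monoˡ-≤ (*-nonneg (ι-nonneg 2) (ι-nonneg (length us))) (*-monoˡ-≤ (inv-nonneg κ) (ι-mono (ℕₚ.m≤m+n Δ c))) ⟩
  ι 2 * ι (length us) * (inv κ * ι κ)       ≡⟨ cong (ι 2 * ι (length us) *_) (inv-*-ι-≥1 (ℕₚ.≤-trans (s≤s z≤n) 3≤κ)) ⟩
  ι 2 * ι (length us) * 1ℚ                  ≡⟨ ℚₚ.*-identityʳ (ι 2 * ι (length us)) ⟩
  ι 2 * ι (length us)                       ∎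
  where
  open ℚₚ.≤-Reasoning
  κ = Δ + c
  3≤κ : 3 ≤ κ
  3≤κ = ℕₚ.≤-trans 3≤Δ (ℕₚ.m≤m+n Δ c)

-- The lower bound: a path built from the bottom up

length≤1 : ∀ {A : Set} {xs : List A} → Unique xs → (∀ {x y} → x ∈ xs → y ∈ xs → x ≡ y) → length xs ≤ 1
length≤1 {xs = []}         _                      eq = z≤n
length≤1 {xs = _ ∷ []}     _                      eq = s≤s z≤n
length≤1 {xs = _ ∷ _ ∷ _} ((x≢y All.∷ _) ∷ _) eq = ⊥-elim (x≢y (eq (here refl) (there (here refl))))

module _ {n : ℕ} where

  Upward : Parents n → Set
  Upward P = ∀ {w p} → P w ≡ just p → toℕ p ≡ suc (toℕ w)

  mutual

    -- When every parent is the successor of its child, a vertex has at most one child.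
    degree-upward : ∀ (P : Parents n) → Upward P → ∀ x → degree P x ≤ 2
    degree-upward P up x with P x
    ... | nothing = ℕₚ.m≤n⇒m≤1+n (length≤1 (Uniqueₚ.filter⁺ _ (Uniqueₚ.allFin⁺ n)) (only P up x))
    ... | just _  = s≤s (length≤1 (Uniqueₚ.filter⁺ _ (Uniqueₚ.allFin⁺ n)) (only P up x))

    only : ∀ (P : Parents n) → Upward P → ∀ x {w w′} → w ∈ filterᵇ _ (allFin n) → w′ ∈ filterᵇ _ (allFin n) → w ≡ w′
    only P up x {w} {w′} w∈ w′∈ = Finₚ.toℕ-injective (ℕₚ.suc-injective (trans
      (sym (up (isChild⁻ P x w (proj₂ (∈-filter⁻ _ {xs = allFin n} w∈)))))
      (up (isChild⁻ P x w′ (proj₂ (∈-filter⁻ _ {xs = allFin n} w′∈))))))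

    isChild⁻ : ∀ (P : Parents n) x w → _ → P w ≡ just x
    isChild⁻ P x w t with P w
    ... | just p with p ≟ x
    ...   | yes refl = refl

  rootWith-root : ∀ k (P : Parents n) {v} → P v ≡ nothing → rootWith k P v ≡ v
  rootWith-root zero    P     Pv = refl
  rootWith-root (suc k) P {v} Pv rewrite Pv = refl

  lower< : ∀ k i → i + suc k ℕ.< n → i ℕ.< n
  lower< k i h = ℕₚ.≤-<-trans (ℕₚ.m≤m+n i (suc k)) h

  next< : ∀ k i → i + suc k ℕ.< n → suc i + k ℕ.< n
  next< k i h = subst (ℕ._< n) (ℕₚ.+-suc i k) h

  upper< : ∀ k i → i + suc k ℕ.< n → suc i ℕ.< n
  upper< k i h = ℕₚ.≤-<-trans (ℕₚ.m≤m+n (suc i) k) (next< k i h)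

  pathEdge : ∀ k i → i + suc k ℕ.< n → Fin n × Fin n
  pathEdge k i h = fromℕ< (upper< k i h) , fromℕ< (lower< k i h)

  -- k insertions remain and i is the current top; the vertex `suc i` that becomes its parent is
  -- still isolated.
  path : ∀ k i → i + k ℕ.< n → List (Fin n × Fin n)
  path zero    i _ = []
  path (suc k) i h = pathEdge k i h ∷ path k (suc i) (next< k i h)

  length-path : ∀ k i h → length (path k i h) ≡ k
  length-path zero    i h = refl
  length-path (suc k) i h = cong suc (length-path k (suc i) (next< k i h))

  path-valid : ∀ {Δ} → 3 ≤ Δ → ∀ k i h {P : Parents n} → Upward P → (∀ w → i ≤ toℕ w → P w ≡ nothing) →
               ValidSeq Δ P (path k i h)
  path-valid 3≤Δ zero    i h up above = done
  path-valid {Δ} 3≤Δ (suc k) i h {P} up above = step Pr p≁r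
    (λ x → ℕₚ.≤-trans (degree-upward (link P r p) up′ x) (ℕₚ.≤-trans (s≤s (s≤s z≤n)) 3≤Δ))
    (path-valid 3≤Δ k (suc i) (next< k i h) up′ above′)
    where
    r p : Fin n
    r = fromℕ< (lower< k i h)
    p = fromℕ< (upper< k i h)
    r≡ : toℕ r ≡ i
    r≡ = Finₚ.toℕ-fromℕ< (lower< k i h)
    p≡ : toℕ p ≡ suc i
    p≡ = Finₚ.toℕ-fromℕ< (upper< k i h)
    Pr : P r ≡ nothing
    Pr = above r (ℕₚ.≤-reflexive (sym r≡))
    p≁r : rootOf P p ≢ r
    p≁r eq = ℕₚ.1+n≢n (trans (sym p≡) (trans (cong toℕ (trans (sym (rootWith-root n P (above p (ℕₚ.≤-trans (ℕₚ.n≤1+n i) (ℕₚ.≤-reflexive (sym p≡)))))) eq)) r≡))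
    up′ : Upward (link P r p)
    up′ {w} eq with w ≟ r
    up′ refl | yes refl = trans p≡ (cong suc (sym r≡))
    up′ eq   | no _     = up eq
    above′ : ∀ w → suc i ≤ toℕ w → link P r p w ≡ nothing
    above′ w i<w = trans (link-old P r p (λ { refl → ℕₚ.1+n≰n (ℕₚ.≤-trans i<w (ℕₚ.≤-reflexive r≡)) })) (above w (ℕₚ.<⇒≤ i<w))

-- The witness `x₀` excludes the empty list, whose average would be 0.
average-≥ : ∀ {A : Set} (xs : List A) {x₀} → x₀ ∈ xs → ∀ {f : A → ℚ} {b} → (∀ x → b ≤ℚ f x) → b ≤ℚ inv (length xs) * ∑ xs f
average-≥ xs@(_ ∷ ys) _ {f} {b} b≤f = begin
  b                                  ≡⟨ ℚₚ.*-identityˡ b ⟨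
  1ℚ * b                             ≡⟨ cong (_* b) (inv-*-ι (length ys)) ⟨
  inv (length xs) * ι (length xs) * b  ≡⟨ ℚₚ.*-assoc (inv (length xs)) (ι (length xs)) b ⟩
  inv (length xs) * (ι (length xs) * b)  ≡⟨ cong (inv (length xs) *_) (∑-const xs b) ⟨
  inv (length xs) * ∑ xs (λ _ → b)   ≤⟨ average-mono xs b≤f ⟩
  inv (length xs) * ∑ xs f           ∎
  where open ℚₚ.≤-Reasoning

otherColor : ∀ {κ} → 2 ≤ κ → (β : Fin κ) → ∃ λ c → c ≢ β
otherColor (s≤s (s≤s _)) zero    = suc zero , λ ()
otherColor (s≤s (s≤s _)) (suc β) = zero , λ ()

-- Recourse on the growing path

module _ {n κ : ℕ} where

  -- Only the shape is tracked: the new colour is drawn uniformly and independently of the present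
  -- colouring, so nothing has to be known about the latter.
  PathForest : ℕ → Forest n κ → Set
  PathForest i F =
    (∀ w → toℕ w ℕ.< i → ∃ λ p → ∃ λ c → F w ≡ just (p , c) × toℕ p ≡ suc (toℕ w)) ×
    (∀ w → i ≤ toℕ w → F w ≡ nothing)

  setEdge-new : ∀ (F : Forest n κ) w p c → setEdge F w p c w ≡ just (p , c)
  setEdge-new F w p c with w ≟ w
  ... | yes _  = refl
  ... | no w≢w = ⊥-elim (w≢w refl)

  setEdge-old : ∀ (F : Forest n κ) w p c {v} → v ≢ w → setEdge F w p c v ≡ F v
  setEdge-old F w p c {v} v≢w with v ≟ w
  ... | yes v≡w = ⊥-elim (v≢w v≡w)
  ... | no _    = refl

  edge-upward : ∀ {i F w p c} → PathForest i F → F w ≡ just (p , c) → toℕ p ≡ suc (toℕ w) × toℕ w ℕ.< i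
  edge-upward {i} {F} {w} (below , above) Fw with toℕ w ℕ.<? i
  ... | no w≮i = ⊥-elim (just≢nothing Fw (above w (ℕₚ.≮⇒≥ w≮i)))
  ... | yes w<i with below w w<i
  ...   | p , c , Fw′ , up with refl ← trans (sym Fw) Fw′ = up , w<i

  recolor-path : ∀ {i F w p} c → PathForest i F → toℕ p ≡ suc (toℕ w) → toℕ w ℕ.< i → PathForest i (setEdge F w p c)
  recolor-path {i} {F} {w} {p} c (below , above) up w<i = below′ , above′
    where
    below′ : ∀ v → toℕ v ℕ.< i → ∃ λ q → ∃ λ d → setEdge F w p c v ≡ just (q , d) × toℕ q ≡ suc (toℕ v)
    below′ v v<i with v ≟ w
    ... | yes refl = p , c , refl , up
    ... | no _     = below v v<i
    above′ : ∀ v → i ≤ toℕ v → setEdge F w p c v ≡ nothing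
    above′ v i≤v = trans (setEdge-old F w p c (λ { refl → ℕₚ.<⇒≱ w<i i≤v })) (above v i≤v)

  extend-path : ∀ {i F w p} c → PathForest i F → toℕ w ≡ i → toℕ p ≡ suc i → PathForest (suc i) (setEdge F w p c)
  extend-path {i} {F} {w} {p} c (below , above) w≡i p≡ = below′ , above′
    where
    below′ : ∀ v → toℕ v ℕ.< suc i → ∃ λ q → ∃ λ d → setEdge F w p c v ≡ just (q , d) × toℕ q ≡ suc (toℕ v)
    below′ v (s≤s v≤i) with v ≟ w
    ... | yes refl = p , c , refl , trans p≡ (cong suc (sym w≡i))
    ... | no v≢w   = below v (ℕₚ.≤∧≢⇒< v≤i (λ v≡i → v≢w (Finₚ.toℕ-injective (trans v≡i (sym w≡i)))))
    above′ : ∀ v → suc i ≤ toℕ v → setEdge F w p c v ≡ nothing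
    above′ v i<v = trans (setEdge-old F w p c (λ { refl → ℕₚ.<⇒≢ i<v (sym w≡i) })) (above v (ℕₚ.<⇒≤ i<v))

  fixForbidden-path : ∀ k {i F} v α β → PathForest i F → PathForest i (proj₁ (fixForbidden k F v α β))
  fixForbidden-path zero    v α β path = path
  fixForbidden-path (suc k) {F = F} v α β path with childWithColor F v β in eq
  ... | nothing = path
  ... | just w  = fixForbidden-path k w β α
    (let up , w<i = edge-upward path (childWithColor-just F eq) in recolor-path α path up w<i)

  module _ (2≤κ : 2 ≤ κ) {i : ℕ} {F : Forest n κ} {p r : Fin n}
           (pathF : PathForest i F) (r≡ : toℕ r ≡ i) (p≡ : toℕ p ≡ suc i) where

    avail-new : avail F p ≡ allFin κ
    avail-new = trans (avail≡filter F p) (filter-all _ (All.universal unused (allFin κ)))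
      where
      unused : ∀ a → ¬ Used F p a
      unused a (inj₁ (y , Fp)) = ℕₚ.1+n≰n (ℕₚ.≤-trans (ℕₚ.≤-reflexive (cong suc (sym p≡))) (ℕₚ.≤-trans (proj₂ (edge-upward pathF Fp)) (ℕₚ.n≤1+n i)))
      unused a (inj₂ (w , Fw)) = let up , w<i = edge-upward pathF Fw
        in ℕₚ.<-irrefl (ℕₚ.suc-injective (trans (sym up) p≡)) w<i

    module _ (G : Forest n κ × ℕ → ℚ) {a b : ℚ} (0≤a : 0ℚ ≤ℚ a)
             (G-zero : ∀ F′ → PathForest (suc i) F′ → b ≤ℚ G (F′ , 0))
             (G-suc : ∀ F′ k → PathForest (suc i) F′ → a +ℚ b ≤ℚ G (F′ , suc k)) where

      -- In a collision both edges at r have colour β, so another colour of the palette is free and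
      -- the choice of α loses no mass.
      recolored-≥ : ∀ β w → childWithColor (setEdge F r p β) r β ≡ just w →
                    a +ℚ b ≤ℚ afterRootToChild (setEdge F r p β) r β (just w) G
      recolored-≥ β w eq = average-≥ (avail F₁ r) free (λ α → G-suc _ _ (fixForbidden-path n w β α
          (let up , w<i = edge-upward path₁ F₁w in recolor-path α path₁ up w<i)))
        where
        F₁ : Forest n κ
        F₁ = setEdge F r p β
        path₁ : PathForest (suc i) F₁
        path₁ = extend-path β pathF r≡ p≡
        F₁w : F₁ w ≡ just (r , β)
        F₁w = childWithColor-just F₁ eq
        other : ∃ λ c → c ≢ β
        other = otherColor 2≤κ β
        only-β : ∀ c → Used F₁ r c → c ≡ β
        only-β c (inj₁ (y , F₁r)) with refl ← trans (sym F₁r) (setEdge-new F r p β) = refl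
        only-β c (inj₂ (v , F₁v)) with refl ← Finₚ.toℕ-injective (ℕₚ.suc-injective (trans (sym (proj₁ (edge-upward path₁ F₁v))) (proj₁ (edge-upward path₁ F₁w))))
          with refl ← trans (sym F₁v) F₁w = refl
        free : proj₁ other ∈ avail F₁ r
        free = subst (proj₁ other ∈_) (sym (avail≡filter F₁ r))
          (∈-filter⁺ _ (∈-allFin (proj₁ other)) (λ used → proj₂ other (only-β _ used)))

      not-recolored-≥ : ∀ β → childWithColor (setEdge F r p β) r β ≡ nothing →
                        b ≤ℚ afterRootToChild (setEdge F r p β) r β nothing G
      not-recolored-≥ β eq = G-zero _ (extend-path β pathF r≡ p≡)

      -- Here b stands for what the later insertions contribute and a for the gain from a
      -- recolouring. This bound without the gain serves for the total mass and for the first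
      -- insertion, where r has no child.
      insertEdge-≥ : b ≤ℚ E (insertEdge F (p , r)) G
      insertEdge-≥ = subst (b ≤ℚ_) (sym (E-insertEdge F p r G)) (average-≥ (avail F p)
        (subst (fromℕ< (ℕₚ.<⇒≤ 2≤κ) ∈_) (sym avail-new) (∈-allFin (fromℕ< (ℕₚ.<⇒≤ 2≤κ)))) (λ β → each β _ refl))
        where
        each : ∀ β m → childWithColor (setEdge F r p β) r β ≡ m → b ≤ℚ afterRootToChild (setEdge F r p β) r β m G
        each β nothing  eq = not-recolored-≥ β eq
        each β (just w) eq = ℚₚ.≤-trans (subst (_≤ℚ a +ℚ b) (ℚₚ.+-identityˡ b) (ℚₚ.+-monoˡ-≤ b 0≤a)) (recolored-≥ β w eq)

      -- The colour γ of the one child edge of r is fixed before β is drawn from the whole palette,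
      -- so the term with β = γ, one of κ, brings the gain a.
      insertEdge-≥-collision : 1 ≤ i → inv κ * a +ℚ b ≤ℚ E (insertEdge F (p , r)) G
      insertEdge-≥-collision 1≤i = subst (inv κ * a +ℚ b ≤ℚ_) (sym (E-insertEdge F p r G)) (begin
        inv κ * a +ℚ b
          ≡⟨ cong (inv κ * a +ℚ_) (trans (sym (ℚₚ.*-identityˡ b)) (trans (cong (_* b) (sym inv-*-ικ)) (ℚₚ.*-assoc (inv κ) (ι κ) b))) ⟩
        inv κ * a +ℚ inv κ * (ι κ * b)
          ≡⟨ ℚₚ.*-distribˡ-+ (inv κ) a (ι κ * b) ⟨
        inv κ * (a +ℚ ι κ * b)
          ≡⟨ cong (inv κ *_) (cong₂ _+ℚ_ (sym (allFin-enumerates κ γ (λ _ → a))) (sym (∑-const-allFin κ b))) ⟩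
        inv κ * (∑ (allFin κ) (λ β → ⟪ γ ≟ β ⟫ * a) +ℚ ∑ (allFin κ) (λ _ → b))
          ≡⟨ cong (inv κ *_) (∑-+ (allFin κ) (λ β → ⟪ γ ≟ β ⟫ * a) (λ _ → b)) ⟨
        inv κ * ∑ (allFin κ) (λ β → ⟪ γ ≟ β ⟫ * a +ℚ b)
          ≤⟨ *-monoˡ-≤ (inv-nonneg κ) (∑-mono (allFin κ) (λ β → each β _ refl)) ⟩
        inv κ * ∑ (allFin κ) after
          ≡⟨ cong₂ (λ k cs → inv k * ∑ cs after) (trans (sym (length-tabulate {n = κ} (λ c → c))) (cong length (sym avail-new))) (sym avail-new) ⟩
        inv (length (avail F p)) * ∑ (avail F p) after ∎)
        where
        open ℚₚ.≤-Reasoning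
        after : Fin κ → ℚ
        after β = afterRootToChild (setEdge F r p β) r β (childWithColor (setEdge F r p β) r β) G
        inv-*-ικ : inv κ * ι κ ≡ 1ℚ
        inv-*-ικ = inv-*-ι-≥1 (ℕₚ.<⇒≤ 2≤κ)
        pred< : ℕ.pred i ℕ.< i
        pred< = ℕₚ.≤-reflexive (ℕₚ.suc-pred i {{ℕ.>-nonZero 1≤i}})
        child : Fin n
        child = fromℕ< (ℕₚ.<-trans pred< (subst (ℕ._< n) r≡ (Finₚ.toℕ<n r)))
        child≡ : toℕ child ≡ ℕ.pred i
        child≡ = Finₚ.toℕ-fromℕ< _
        edge : ∃ λ q → ∃ λ c → F child ≡ just (q , c) × toℕ q ≡ suc (toℕ child)
        edge = proj₁ pathF child (subst (ℕ._< i) (sym child≡) pred<)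
        γ : Fin κ
        γ = proj₁ (proj₂ edge)
        parent≡r : proj₁ edge ≡ r
        parent≡r = Finₚ.toℕ-injective (trans (proj₂ (proj₂ (proj₂ edge)))
          (trans (cong suc child≡) (trans (ℕₚ.suc-pred i {{ℕ.>-nonZero 1≤i}}) (sym r≡))))
        child≢r : child ≢ r
        child≢r eq = ℕₚ.<⇒≢ pred< (trans (sym child≡) (trans (cong toℕ eq) r≡))
        each : ∀ β m → childWithColor (setEdge F r p β) r β ≡ m → ⟪ γ ≟ β ⟫ * a +ℚ b ≤ℚ afterRootToChild (setEdge F r p β) r β m G
        each β (just w) eq = ℚₚ.≤-trans (ℚₚ.+-monoˡ-≤ b (⟪⟫-*-≤ (γ ≟ β) 0≤a)) (recolored-≥ β w eq)
        each β nothing  eq = subst (_≤ℚ G (setEdge F r p β , 0))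
          (sym (trans (cong (λ x → x * a +ℚ b) (⟪⟫-no (γ ≟ β) γ≢β)) (trans (cong (_+ℚ b) (ℚₚ.*-zeroˡ a)) (ℚₚ.+-identityˡ b))))
          (not-recolored-≥ β eq)
          where
          γ≢β : γ ≢ β
          γ≢β γ≡β = childWithColor-nothing (setEdge F r p β) eq child (trans (setEdge-old F r p β child≢r)
            (trans (proj₁ (proj₂ (proj₂ edge))) (cong₂ (λ q c → just (q , c)) parent≡r γ≡β)))

  module _ (2≤κ : 2 ≤ κ) where

    afterEdge : ∀ k i → i + suc k ℕ.< n → (ℕ → ℚ) → Forest n κ × ℕ → ℚ
    afterEdge k i h f Fj = E (runSeq (proj₁ Fj) (path k (suc i) (next< k i h))) (λ t → f (proj₂ Fj + t))

    E-path : ∀ k i h (F : Forest n κ) f →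
             E (runSeq F (path (suc k) i h)) f ≡ E (insertEdge F (pathEdge k i h)) (afterEdge k i h f)
    E-path k i h F f = E-runSeq-∷ F (pathEdge k i h) (path k (suc i) (next< k i h)) f

    -- Needed to count a recolouring in full: mass lost by later choices would diminish its
    -- contribution.
    path-mass : ∀ k i h {F : Forest n κ} → PathForest i F → 1ℚ ≤ℚ E (runSeq F (path k i h)) (λ _ → 1ℚ)
    path-mass zero    i h pathF = ℚₚ.≤-refl
    path-mass (suc k) i h {F} pathF = subst (1ℚ ≤ℚ_) (sym (E-path k i h F (λ _ → 1ℚ)))
      (insertEdge-≥ 2≤κ pathF (Finₚ.toℕ-fromℕ< (lower< k i h)) (Finₚ.toℕ-fromℕ< (upper< k i h))
        (afterEdge k i h (λ _ → 1ℚ)) {a = 0ℚ} ℚₚ.≤-refl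
        (λ F′ path′ → path-mass k (suc i) (next< k i h) path′)
        (λ F′ j path′ → path-mass k (suc i) (next< k i h) path′))

    shift-≥ : ∀ k i h {F : Forest n κ} → PathForest i F → ∀ {b} → b ≤ℚ E (runSeq F (path k i h)) ι →
              ∀ j → ι j +ℚ b ≤ℚ E (runSeq F (path k i h)) (λ t → ι (j + t))
    shift-≥ k i h {F} pathF {b} b≤ j = subst (ι j +ℚ b ≤ℚ_) (sym (E-runSeq-shift F (path k i h) j))
      (ℚₚ.+-mono-≤ (subst (_≤ℚ ι j * E (runSeq F (path k i h)) (λ _ → 1ℚ)) (ℚₚ.*-identityʳ (ι j))
        (*-monoˡ-≤ (ι-nonneg j) (path-mass k i h pathF))) b≤)

    shift-suc-≥ : ∀ k i h {F : Forest n κ} → PathForest i F → ∀ {b} → b ≤ℚ E (runSeq F (path k i h)) ι →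
              ∀ j → 1ℚ +ℚ b ≤ℚ E (runSeq F (path k i h)) (λ t → ι (suc j + t))
    shift-suc-≥ k i h pathF {b} b≤ j =
      ℚₚ.≤-trans (ℚₚ.+-monoˡ-≤ b (ι-mono {1} {suc j} (s≤s z≤n))) (shift-≥ k i h pathF b≤ (suc j))

    path-recourse : ∀ k i h {F : Forest n κ} → 1 ≤ i → PathForest i F → ι k * inv κ ≤ℚ E (runSeq F (path k i h)) ι
    path-recourse zero    i h 1≤i pathF = ℚₚ.≤-reflexive (ℚₚ.*-zeroˡ (inv κ))
    path-recourse (suc k) i h {F} 1≤i pathF = subst₂ _≤ℚ_ (sym grow) (sym (E-path k i h F ι))
      (insertEdge-≥-collision 2≤κ pathF (Finₚ.toℕ-fromℕ< (lower< k i h)) (Finₚ.toℕ-fromℕ< (upper< k i h))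
        (afterEdge k i h ι) {a = 1ℚ} (ℚₚ.nonNegative⁻¹ 1ℚ)
        (λ F′ path′ → path-recourse k (suc i) (next< k i h) (s≤s z≤n) path′)
        (λ F′ j path′ → shift-suc-≥ k (suc i) (next< k i h) path′ (path-recourse k (suc i) (next< k i h) (s≤s z≤n) path′) j)
        1≤i)
      where
      grow : ι (suc k) * inv κ ≡ inv κ * 1ℚ +ℚ ι k * inv κ
      grow = trans (cong (_* inv κ) (ι-+ 1 k)) (solve 2 (λ x y → (con 1ℚ :+ x) :* y := y :* con 1ℚ :+ x :* y) refl (ι k) (inv κ))

    -- At the first insertion r is a single vertex, so `suc k` insertions offer k chances of a
    -- collision.
    path-recourse-empty : ∀ k h → ι k * inv κ ≤ℚ E (runSeq {n} {κ} emptyForest (path (suc k) 0 h)) ι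
    path-recourse-empty k h = subst (ι k * inv κ ≤ℚ_) (sym (E-path k 0 h emptyForest ι))
      (insertEdge-≥ 2≤κ {F = emptyForest} ((λ _ ()) , (λ _ _ → refl)) (Finₚ.toℕ-fromℕ< (lower< k 0 h)) (Finₚ.toℕ-fromℕ< (upper< k 0 h))
        (afterEdge k 0 h ι) {a = 1ℚ} (ℚₚ.nonNegative⁻¹ 1ℚ)
        (λ F′ path′ → path-recourse k 1 (next< k 0 h) (s≤s z≤n) path′)
        (λ F′ j path′ → shift-suc-≥ k 1 (next< k 0 h) path′ (path-recourse k 1 (next< k 0 h) (s≤s z≤n) path′) j))

lowerBound : ∀ Δ c → 3 ≤ Δ → c ≤ Δ → ∀ N → Σ ℕ λ n → Σ (List (Fin n × Fin n)) λ us →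
  ValidSeq Δ noParents us × N ≤ length us × 1 ≤ length us ×
  ½ * ½ * ι (length us) ≤ℚ expectedTotalRecourse (Δ + c) us * ι Δ
lowerBound Δ c 3≤Δ c≤Δ N = n , us , path-valid 3≤Δ (suc k) 0 ℕₚ.≤-refl (λ ()) (λ _ _ → refl) ,
  subst (N ≤_) (sym len≡) (ℕₚ.≤-trans (ℕₚ.n≤1+n N) (ℕₚ.n≤1+n k)) , subst (1 ≤_) (sym len≡) (s≤s z≤n) , (begin
    ½ * ½ * ι (length us)         ≡⟨ cong (λ m → ½ * ½ * ι m) len≡ ⟩
    -- One ½ pays for the first insertion, by 1 + k ≤ k + k with k equal to `suc N`; the other pays
    -- for κ ≤ 2Δ.
    ½ * ½ * ι (1 + k)             ≤⟨ *-monoˡ-≤ (ℚₚ.nonNegative⁻¹ (½ * ½)) (ι-mono (ℕₚ.+-monoˡ-≤ k (s≤s {n = N} z≤n))) ⟩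
    ½ * ½ * ι (k + k)             ≡⟨ cong (½ * ½ *_) (ι-+ k k) ⟩
    ½ * ½ * (ι k +ℚ ι k)          ≡⟨ solve 1 (λ x → con (½ * ½) :* (x :+ x) := con ½ :* x) refl (ι k) ⟩
    ½ * ι k                       ≤⟨ *-monoʳ-≤ (ι-nonneg k) half ⟩
    inv κ * ι Δ * ι k             ≡⟨ solve 3 (λ x y z → x :* y :* z := (z :* x) :* y) refl (inv κ) (ι Δ) (ι k) ⟩
    ι k * inv κ * ι Δ             ≤⟨ *-monoʳ-≤ (ι-nonneg Δ) (path-recourse-empty 2≤κ k ℕₚ.≤-refl) ⟩
    E (runSeq {n} {κ} emptyForest us) ι * ι Δ  ≡⟨ cong (_* ι Δ) (expectation≡E (runSeq {n} {κ} emptyForest us)) ⟨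
    expectedTotalRecourse κ us * ι Δ  ∎)
  where
  open ℚₚ.≤-Reasoning
  k n κ : ℕ
  k = suc N
  n = suc (suc k)
  κ = Δ + c
  us : List (Fin n × Fin n)
  us = path (suc k) 0 ℕₚ.≤-refl
  len≡ : length us ≡ suc k
  len≡ = length-path (suc k) 0 ℕₚ.≤-refl
  3≤κ : 3 ≤ κ
  3≤κ = ℕₚ.≤-trans 3≤Δ (ℕₚ.m≤m+n Δ c)
  2≤κ : 2 ≤ κ
  2≤κ = ℕₚ.<⇒≤ 3≤κ
  half : ½ ≤ℚ inv κ * ι Δ
  half = begin
    ½                              ≡⟨ ℚₚ.*-identityʳ ½ ⟨
    ½ * 1ℚ                         ≡⟨ cong (½ *_) (inv-*-ι-≥1 (ℕₚ.<⇒≤ 2≤κ)) ⟨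
    ½ * (inv κ * ι κ)              ≤⟨ *-monoˡ-≤ (ℚₚ.nonNegative⁻¹ ½) (*-monoˡ-≤ (inv-nonneg κ) (ι-mono (ℕₚ.+-monoʳ-≤ Δ c≤Δ))) ⟩
    ½ * (inv κ * ι (Δ + Δ))        ≡⟨ cong (λ x → ½ * (inv κ * x)) (ι-+ Δ Δ) ⟩
    ½ * (inv κ * (ι Δ +ℚ ι Δ))     ≡⟨ solve 2 (λ x y → con ½ :* (x :* (y :+ y)) := x :* y) refl (inv κ) (ι Δ) ⟩
    inv κ * ι Δ                    ∎

theorem2p9 : (Σ ℚ λ C → (0ℚ < C) ×
    ((Δ c n : ℕ) → 3 ≤ Δ → c + 2 ≤ Δ →
    (us : List (Fin n × Fin n)) → ValidSeq Δ noParents us →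
    expectedTotalRecourse (Δ + c) us * ((+ Δ) / 1) ≤ℚ C * ((+ length us) / 1)))
    ×
    (Σ ℚ λ C → (0ℚ < C) ×
    ((Δ c : ℕ) → 3 ≤ Δ → c + 2 ≤ Δ → (N : ℕ) →
    Σ ℕ λ n → Σ (List (Fin n × Fin n)) λ us →
    ValidSeq Δ noParents us × N ≤ length us × 1 ≤ length us ×
    C * ((+ length us) / 1) ≤ℚ expectedTotalRecourse (Δ + c) us * ((+ Δ) / 1)))
theorem2p9 =
  (ι 2 , ℚₚ.positive⁻¹ (ι 2) , λ Δ c n 3≤Δ _ us valid → upperBound Δ c n 3≤Δ us valid) ,
  (½ * ½ , ℚₚ.positive⁻¹ (½ * ½) , λ Δ c 3≤Δ c+2≤Δ N → lowerBound Δ c 3≤Δ (ℕₚ.≤-trans (ℕₚ.m≤m+n c 2) c+2≤Δ) N)
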